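{- Let $F$ be a finite field with $q$ elements, $q$ odd. For $n\geq 2$, the isoperimetric constant of $\mathrm{Um}(F^n)$ satisfies \[ \mathrm{iso}(\mathrm{Um}(F^n))=\tfrac12\big(q^{n-1}-q^{(n-1)/2}\big)\ \text{ if } n \text{ is odd},\qquad \tfrac12\big(q^{n-1}-q^{n/2-1}\big)\geq \mathrm{iso}(\mathrm{Um}(F^n))\geq \tfrac12\big(q^{n-1}-q^{(n-1)/2}\big)\ \text{ if } n \text{ is even}. \] For $n\geq 3$, the isoperimetric constant of $\mathrm{Um}_0(F^n)$ satisfies \[ \mathrm{iso}(\mathrm{Um}_0(F^n))\geq \tfrac12\Big(\tfrac{q^{n-1}-1}{q-1}-q^{n/2-1}\Big)\ \text{ if } n \text{ is odd},\qquad \mathrm{iso}(\mathrm{Um}_0(F^n))= \tfrac12\Big(\tfrac{q^{n-1}-1}{q-1}-q^{n/2-1}\Big)\ \text{ if } n \text{ is even}. \]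
   Context: Dot product on $F^n$: $a\cdot b=\sum_i a_ib_i$. $\mathrm{Um}(F^n)$ ($n\geq2$) is the bipartite graph on two copies $\{a_\bullet\},\{b_\circ\}$ of $F^n\setminus\{0\}$ with $a_\bullet\sim b_\circ$ iff $a\cdot b=1$. $\mathrm{Um}_0(F^n)$ ($n\geq 3$) is the bipartite graph on two copies of $(F^n\setminus\{0\})/F^*$ with $[a]_\bullet\sim[b]_\circ$ iff $a\cdot b=0$. For a connected graph $X$, $\mathrm{iso}(X)=\min e(U,W)/\min\{|U|,|W|\}$, the minimum over all partitions of the vertex set into two non-empty sets $U,W$, where $e(U,W)$ is the number of edges joining a vertex of $U$ to a vertex of $W$. -}

module Defs where

open import Level using (0ℓ)
open import Data.Bool using (Bool; true; false; not; _∧_; _∨_; if_then_else_)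
open import Data.Nat as ℕ using (ℕ; zero; suc; _⊓_)
open import Data.Integer as ℤ using (ℤ; +_)
open import Data.Rational as ℚ using (ℚ; 0ℚ; _/_)
open import Data.List using (List; []; _∷_; _++_; map; filterᵇ; length; foldr; cartesianProduct; zip; concatMap)
open import Data.List.Membership.Propositional using (_∈_)
open import Data.List.Relation.Unary.Unique.Propositional using (Unique)
open import Data.Vec as Vec using (Vec; []; _∷_)
open import Data.Maybe using (Maybe; just; nothing)
open import Data.Product using (_×_; _,_; proj₁; proj₂; ∃)
open import Data.Sum using (_⊎_; inj₁; inj₂)
open import Relation.Binary.PropositionalEquality using (_≡_; _≢_)
open import Relation.Binary.Definitions using (DecidableEquality)
open import Relation.Nullary using (does)
import Algebra.Structures as AS

record FiniteField : Set₁ where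
  field
    Carrier : Set
    _+_ _*_ : Carrier → Carrier → Carrier
    -_      : Carrier → Carrier
    0# 1#   : Carrier
    isCommutativeRing : AS.IsCommutativeRing {A = Carrier} _≡_ _+_ _*_ -_ 0# 1#
    0≢1     : 0# ≢ 1#
    inverse : ∀ x → x ≢ 0# → ∃ λ y → x * y ≡ 1#
    _≟_     : DecidableEquality Carrier
    elems    : List Carrier
    complete : ∀ x → x ∈ elems
    unique   : Unique elems
  infixl 7 _*_
  infixl 6 _+_

  card : ℕ
  card = length elems

-- Finite graphs, given by a list of vertices (each listed once) and a
-- symmetric Boolean adjacency relation; and their isoperimetric constant.

record FinGraph : Set₁ where
  field
    V     : Set
    verts : List V
    adj   : V → V → Bool

-- all Boolean lists of length n (= all subsets of an n-element list)
masks : ℕ → List (List Bool)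
masks zero    = [] ∷ []
masks (suc n) = concatMap (λ m → (true ∷ m) ∷ (false ∷ m) ∷ []) (masks n)

countᵇ : {A : Set} → (A → Bool) → List A → ℕ
countᵇ p xs = length (filterᵇ p xs)

-- the cut ratio e(U,W)/min(|U|,|W|) of the partition given by a labelled
-- vertex list (label true = in U, false = in W); nothing if U or W is empty
cutRatio : {V : Set} → (V → V → Bool) → List (V × Bool) → Maybe ℚ
cutRatio {V} adj ls with countᵇ proj₂ ls ⊓ countᵇ (λ p → not (proj₂ p)) ls
... | zero  = nothing
... | suc m = just (+ e / suc m)
  where
  e : ℕ
  e = countᵇ (λ pq → proj₂ (proj₁ pq) ∧ not (proj₂ (proj₂ pq))
                       ∧ adj (proj₁ (proj₁ pq)) (proj₁ (proj₂ pq)))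
             (cartesianProduct ls ls)

catMaybes : {A : Set} → List (Maybe A) → List A
catMaybes []             = []
catMaybes (nothing ∷ xs) = catMaybes xs
catMaybes (just x ∷ xs)  = x ∷ catMaybes xs

minimumℚ : List ℚ → ℚ
minimumℚ []       = 0ℚ
minimumℚ (x ∷ xs) = foldr ℚ._⊓_ x xs

iso : FinGraph → ℚ
iso X = minimumℚ (catMaybes (map (λ m → cutRatio adj (zip verts m))
                                 (masks (length verts))))
  where open FinGraph X

module _ (F : FiniteField) where
  open FiniteField F

  isZero : Carrier → Bool
  isZero x = does (x ≟ 0#)

  allVecs : (n : ℕ) → List (Vec Carrier n)
  allVecs zero    = [] ∷ []
  allVecs (suc n) = concatMap (λ x → map (x ∷_) (allVecs n)) elems

  isNonzero : ∀ {n} → Vec Carrier n → Bool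
  isNonzero []       = false
  isNonzero (x ∷ xs) = not (isZero x) ∨ isNonzero xs

  -- the representative of a point of (F^n∖0)/F^* : first nonzero coordinate is 1
  isNormalized : ∀ {n} → Vec Carrier n → Bool
  isNormalized []       = false
  isNormalized (x ∷ xs) = if isZero x then isNormalized xs else does (x ≟ 1#)

  dot : ∀ {n} → Vec Carrier n → Vec Carrier n → Carrier
  dot a b = Vec.foldr _ _+_ 0# (Vec.zipWith _*_ a b)

  bipartite : (n : ℕ) → List (Vec Carrier n)
            → (Vec Carrier n → Vec Carrier n → Bool) → FinGraph
  bipartite n vs r = record
    { V     = Vec Carrier n ⊎ Vec Carrier n
    ; verts = map inj₁ vs ++ map inj₂ vs
    ; adj   = adj' }
    where
    adj' : Vec Carrier n ⊎ Vec Carrier n → Vec Carrier n ⊎ Vec Carrier n → Bool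
    adj' (inj₁ a) (inj₂ b) = r a b
    adj' (inj₂ b) (inj₁ a) = r a b
    adj' _        _        = false

  Um : ℕ → FinGraph
  Um n = bipartite n (filterᵇ isNonzero (allVecs n)) (λ a b → does (dot a b ≟ 1#))

  Um₀ : ℕ → FinGraph
  Um₀ n = bipartite n (filterᵇ isNormalized (allVecs n)) (λ a b → does (dot a b ≟ 0#))

ℕ→ℚ : ℕ → ℚ
ℕ→ℚ n = + n / 1

-- a / d in ℚ (with the unused convention a/0 = 0)
_÷ℕ_ : ℚ → ℕ → ℚ
a ÷ℕ zero  = 0ℚ
a ÷ℕ suc d = a ℚ.* (+ 1 / suc d)

-- x ≤ √B  (B a natural number), written without square roots
_≤√_ : ℚ → ℕ → Set
x ≤√ B = x ℚ.≤ 0ℚ ⊎ x ℚ.* x ℚ.≤ ℕ→ℚ B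

{-# OPTIONS --safe #-}
-- Lower bounds.  Write a cut as a ±1 function on each side of the bipartite graph.  If M is the adjacency
-- matrix between the two sides, M Mᵗ acts on functions of sum zero with norm at most q^(n-1) (Um) and as the
-- scalar q^(n-2) (Um₀), so Cauchy-Schwarz bounds the size of every cut from below.
--
-- Upper bounds.  The cut is given by the quadratic character χ of a field K = F[X]/(f) of degree n, carried to
-- F^n by coordinates: the sums of χ over the hyperplanes a·v = 1 all have the same absolute value |E|, and the
-- formula for M Mᵗ gives E² = q^(n-1) or q^(n-2), according to whether χ is nontrivial or trivial on F*,
-- that is, whether n is odd or even.
--
-- K is cut out of A = F[X]/(X^Q - X), Q = q^n, by a primitive idempotent of A; this avoids factoring polynomials.
module Submission where

open import Defs
open import Algebra.Bundles using (CommutativeRing)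
open import Algebra.Structures using (IsCommutativeMonoid; IsCommutativeRing)
open import Data.Bool using (Bool; true; false; not; _∧_)
open import Data.Bool.Properties using (T-≡)
open import Data.Empty using (⊥)
import Data.Integer.Properties as ℤₚ
open import Data.Integer.Tactic.RingSolver using (solve-∀)
open import Data.List as List using (List; []; _∷_; _++_; map; filterᵇ; length; concatMap; cartesianProduct; cartesianProductWith; foldr; zip)
open import Data.List.Membership.Propositional using (_∈_)
open import Data.List.Membership.Propositional.Properties using (∈-map⁺; ∈-∃++; ∈-cartesianProductWith⁺; ∈-map⁻; ∈-++⁺ˡ; ∈-++⁺ʳ; ∈-filter⁺; ∈-filter⁻)
open import Data.List.Membership.Propositional.Properties.WithK using (unique∧set⇒bag)
open import Data.List.Properties using (length-++; length-map; map-cong-local)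
open import Data.List.Relation.Binary.BagAndSetEquality using (∼bag⇒↭)
open import Data.List.Relation.Unary.All as All using (All; []; _∷_)
import Data.List.Relation.Unary.All.Properties as All
open import Data.List.Relation.Unary.AllPairs using ([]; _∷_)
open import Data.List.Relation.Unary.Any using (here; there)
open import Data.List.Relation.Unary.Unique.Propositional using (Unique)
import Data.List.Relation.Unary.Unique.Propositional.Properties as Unique
open import Data.Maybe using (Maybe; just; nothing)
open import Data.Nat as ℕ using (ℕ; suc; z≤n; s≤s; zero)
open import Data.Nat.DivMod using (m≡m%n+[m/n]*n; m/n≡1+[m∸n]/n)
import Data.Nat.Properties as ℕₚ
open import Data.Nat.Tactic.RingSolver using () renaming (solve-∀ to ℕ-solve-∀)
open import Data.Product using (∃; _,_; proj₁; proj₂; _×_; ∃₂)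
import Data.Rational.Properties as ℚₚ
open import Data.Sum as Sum using (_⊎_; inj₁; inj₂)
open import Data.Sum.Properties using (inj₁-injective; inj₂-injective) renaming (≡-dec to ⊎-≡-dec)
open import Data.Vec as Vec using (Vec; []; _∷_; replicate; _∷ʳ_)
import Data.Vec.Properties as Vecₚ
open import Function using (_∘_; mk⇔; Equivalence)
open import Level using (0ℓ)
open import Relation.Binary.Definitions using (DecidableEquality)
open import Relation.Binary.PropositionalEquality as ≡ using (_≡_; _≢_; refl; cong; cong₂; sym; module ≡-Reasoning; trans; subst; subst₂)
open import Relation.Nullary using (yes; no; contradiction; ¬_; Dec; does)
open import Relation.Nullary.Decidable using (T?)

-- The norm bound concerns functions of sum zero, but the two sides of an arbitrary cut have label
-- sums σ and τ that need not vanish or agree. Centring each side separately gives an estimate in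
-- terms of N^2 - στ instead of the size u of the smaller part. The surplus is nonnegative, and it
-- can be removed because the norm √L is at most the valency k. As √L may be irrational, the
-- argument runs on integer inequalities between squares, and the root is taken only when L is a
-- perfect square.
--
-- Equality needs ±1 functions on which M attains √L. The character sums have size q^((n-1)/2) for n
-- odd and q^(n/2-1) for n even: the former is the norm for `Um`, the latter the norm for `Um₀`,
-- where moreover χ is trivial on F* and so descends to points.
--
-- All hyperplane sums have the same size because every functional on K is a ↦ λ(ab) for some b, and
-- a change of variable by b costs only the sign χ(b). The constant coefficient λ serves in place of
-- the trace: λ(1) = 1 makes the pairing nondegenerate at once.

-- Finite listings, sums over commutative monoids, Cauchy-Schwarz over ℤ.

module FiniteSums where

  open import Data.Integer as ℤ using (ℤ; +_; 0ℤ; 1ℤ; _+_; _*_; _-_; -_)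
  open import Data.List.Relation.Binary.Permutation.Propositional using (_↭_; refl; prep; swap) renaming (trans to ↭-trans)

  private
    variable
      A B : Set

  record Listing (A : Set) : Set where
    field
      elems    : List A
      complete : ∀ x → x ∈ elems
      unique   : Unique elems

  open Listing

  unique-⊆⇒length≤ : {xs ys : List A} → Unique xs → (∀ {x} → x ∈ xs → x ∈ ys) → length xs ℕ.≤ length ys
  unique-⊆⇒length≤ {xs = []} _ _ = z≤n
  unique-⊆⇒length≤ {xs = x ∷ xs} {ys} (x∉ ∷ u) sub with ∈-∃++ (sub (here refl))
  ... | as , bs , refl = subst (suc (length xs) ℕ.≤_) (sym eq) (s≤s (unique-⊆⇒length≤ u sub'))
    where
    eq : length (as ++ x ∷ bs) ≡ suc (length (as ++ bs))
    eq = trans (length-++ as) (trans (ℕₚ.+-suc (length as) _) (cong suc (sym (length-++ as))))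
    drop : ∀ cs {z} → z ∈ cs ++ x ∷ bs → z ≢ x → z ∈ cs ++ bs
    drop [] (here e) ne = contradiction e ne
    drop [] (there p) ne = p
    drop (c ∷ cs) (here e) ne = here e
    drop (c ∷ cs) (there p) ne = there (drop cs p ne)
    sub' : ∀ {z} → z ∈ xs → z ∈ as ++ bs
    sub' p = drop as (sub (there p)) λ e → All.lookup x∉ p (sym e)

  -- A missed value y, put in front of the image, would give a duplicate-free list longer than the
  -- listing itself.
  injective⇒surjective : (L : Listing A) → DecidableEquality A → (φ : A → A) →
    (∀ {x y} → φ x ≡ φ y → x ≡ y) → ∀ y → ∃ λ x → φ x ≡ y
  injective⇒surjective {A} L _≟_ φ inj y = go (elems L) refl
    where
    search : ∀ xs → (∃ λ x → φ x ≡ y) ⊎ All (y ≢_) (map φ xs)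
    search [] = inj₂ []
    search (x ∷ xs) with φ x ≟ y | search xs
    ... | yes e | _ = inj₁ (x , e)
    ... | no _ | inj₁ r = inj₁ r
    ... | no ne | inj₂ r = inj₂ ((λ e → ne (sym e)) ∷ r)
    go : ∀ xs → xs ≡ elems L → ∃ λ x → φ x ≡ y
    go xs refl with search xs
    ... | inj₁ r = r
    ... | inj₂ r = contradiction
      (unique-⊆⇒length≤ (r ∷ Unique.map⁺ inj (unique L)) λ {z} _ → complete L z)
      (ℕₚ.<⇒≱ (s≤s (ℕₚ.≤-reflexive (sym (length-map φ (elems L))))))

  -- Two duplicate-free lists with the same members are permutations of each other; this is the
  -- source of every change of variable in a sum or product.
  bijection-↭ : (L : Listing A) (φ ψ : A → A) → (∀ x → ψ (φ x) ≡ x) → (∀ x → φ (ψ x) ≡ x) →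
    map φ (elems L) ↭ elems L
  bijection-↭ L φ ψ ψφ φψ = ∼bag⇒↭ (unique∧set⇒bag
    (Unique.map⁺ (λ {x} {y} e → trans (sym (ψφ x)) (trans (cong ψ e) (ψφ y))) (unique L)) (unique L)
    (mk⇔ (λ _ → complete L _) (λ _ → subst (_∈ map φ (elems L)) (φψ _) (∈-map⁺ φ (complete L (ψ _))))))

  -- Generic because it serves several monoids: integer sums, the product over a field in Fermat's
  -- theorem, and, through `interchange`, vector addition and the idempotents of a ring.
  module BigOp {C : Set} {_∙_ : C → C → C} {ε : C} (isCM : IsCommutativeMonoid _≡_ _∙_ ε) where

    open IsCommutativeMonoid isCM using (assoc; comm; identityˡ; identityʳ)

    ⨁ : List A → (A → C) → C
    ⨁ [] f = ε
    ⨁ (x ∷ xs) f = f x ∙ ⨁ xs f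

    interchange : ∀ a b c d → (a ∙ b) ∙ (c ∙ d) ≡ (a ∙ c) ∙ (b ∙ d)
    interchange a b c d = begin
      (a ∙ b) ∙ (c ∙ d) ≡⟨ assoc a b (c ∙ d) ⟩
      a ∙ (b ∙ (c ∙ d)) ≡⟨ cong (a ∙_) (assoc b c d) ⟨
      a ∙ ((b ∙ c) ∙ d) ≡⟨ cong (λ z → a ∙ (z ∙ d)) (comm b c) ⟩
      a ∙ ((c ∙ b) ∙ d) ≡⟨ cong (a ∙_) (assoc c b d) ⟩
      a ∙ (c ∙ (b ∙ d)) ≡⟨ assoc a c (b ∙ d) ⟨
      (a ∙ c) ∙ (b ∙ d) ∎
      where open ≡-Reasoning

    ⨁-cong∈ : ∀ (xs : List A) {f g : A → C} → (∀ {x} → x ∈ xs → f x ≡ g x) → ⨁ xs f ≡ ⨁ xs g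
    ⨁-cong∈ [] h = refl
    ⨁-cong∈ (x ∷ xs) h = cong₂ _∙_ (h (here refl)) (⨁-cong∈ xs (h ∘ there))

    ⨁-cong : ∀ (xs : List A) {f g : A → C} → (∀ x → f x ≡ g x) → ⨁ xs f ≡ ⨁ xs g
    ⨁-cong xs h = ⨁-cong∈ xs λ {x} _ → h x

    ⨁-ε : ∀ (xs : List A) → ⨁ xs (λ _ → ε) ≡ ε
    ⨁-ε [] = refl
    ⨁-ε (x ∷ xs) = trans (identityˡ _) (⨁-ε xs)

    ⨁-∙ : ∀ (xs : List A) (f g : A → C) → ⨁ xs (λ x → f x ∙ g x) ≡ ⨁ xs f ∙ ⨁ xs g
    ⨁-∙ [] f g = sym (identityˡ ε)
    ⨁-∙ (x ∷ xs) f g = trans (cong ((f x ∙ g x) ∙_) (⨁-∙ xs f g)) (interchange (f x) (g x) _ _)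

    ⨁-swap : ∀ (xs : List A) (ys : List B) (f : A → B → C) →
      ⨁ xs (λ x → ⨁ ys (f x)) ≡ ⨁ ys (λ y → ⨁ xs (λ x → f x y))
    ⨁-swap [] ys f = sym (⨁-ε ys)
    ⨁-swap (x ∷ xs) ys f = trans (cong (⨁ ys (f x) ∙_) (⨁-swap xs ys f))
      (sym (⨁-∙ ys (f x) (λ y → ⨁ xs (λ x → f x y))))

    ⨁-map : ∀ (φ : A → B) xs (f : B → C) → ⨁ (map φ xs) f ≡ ⨁ xs (f ∘ φ)
    ⨁-map φ [] f = refl
    ⨁-map φ (x ∷ xs) f = cong (f (φ x) ∙_) (⨁-map φ xs f)

    ⨁-++ : ∀ (xs ys : List A) f → ⨁ (xs ++ ys) f ≡ ⨁ xs f ∙ ⨁ ys f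
    ⨁-++ [] ys f = sym (identityˡ _)
    ⨁-++ (x ∷ xs) ys f = trans (cong (f x ∙_) (⨁-++ xs ys f)) (sym (assoc _ _ _))

    ⨁-concatMap : ∀ (φ : A → List B) xs f → ⨁ (concatMap φ xs) f ≡ ⨁ xs (λ x → ⨁ (φ x) f)
    ⨁-concatMap φ [] f = refl
    ⨁-concatMap φ (x ∷ xs) f = trans (⨁-++ (φ x) (concatMap φ xs) f) (cong (⨁ (φ x) f ∙_) (⨁-concatMap φ xs f))

    ⨁-↭ : ∀ {xs ys : List A} (f : A → C) → xs ↭ ys → ⨁ xs f ≡ ⨁ ys f
    ⨁-↭ f refl = refl
    ⨁-↭ f (prep x r) = cong (f x ∙_) (⨁-↭ f r)
    ⨁-↭ f (swap {xs} {ys} x y r) = begin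
      f x ∙ (f y ∙ ⨁ xs f) ≡⟨ assoc _ _ _ ⟨
      (f x ∙ f y) ∙ ⨁ xs f ≡⟨ cong₂ _∙_ (comm (f x) (f y)) (⨁-↭ f r) ⟩
      (f y ∙ f x) ∙ ⨁ ys f ≡⟨ assoc _ _ _ ⟩
      f y ∙ (f x ∙ ⨁ ys f) ∎
      where open ≡-Reasoning
    ⨁-↭ f (↭-trans r s) = trans (⨁-↭ f r) (⨁-↭ f s)

    ⨁-reindex : (L : Listing A) (φ ψ : A → A) → (∀ x → ψ (φ x) ≡ x) → (∀ x → φ (ψ x) ≡ x) →
      ∀ f → ⨁ (elems L) (λ x → f (φ x)) ≡ ⨁ (elems L) f
    ⨁-reindex L φ ψ ψφ φψ f = trans (sym (⨁-map φ (elems L) f)) (⨁-↭ f (bijection-↭ L φ ψ ψφ φψ))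

    ⨁-point : (L : Listing A) (x₀ : A) (f : A → C) → (∀ x → x ≢ x₀ → f x ≡ ε) → ⨁ (elems L) f ≡ f x₀
    ⨁-point L x₀ f h = go (elems L) (complete L x₀) (unique L)
      where
      none : ∀ xs → All (x₀ ≢_) xs → ⨁ xs f ≡ ε
      none [] [] = refl
      none (x ∷ xs) (n ∷ ns) = trans (cong₂ _∙_ (h x (n ∘ sym)) (none xs ns)) (identityˡ ε)
      go : ∀ xs → x₀ ∈ xs → Unique xs → ⨁ xs f ≡ f x₀
      go (x ∷ xs) (here refl) (n ∷ u) = trans (cong (f x ∙_) (none xs n)) (identityʳ _)
      go (x ∷ xs) (there p) (n ∷ u) =
        trans (cong₂ _∙_ (h x (All.lookup n p)) (go xs p u)) (identityˡ _)

  open BigOp ℤₚ.+-0-isCommutativeMonoid public using () renaming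
    ( ⨁ to ∑; ⨁-cong to ∑-cong; ⨁-cong∈ to ∑-cong∈; ⨁-ε to ∑-0; ⨁-∙ to ∑-+; ⨁-swap to ∑-swap; ⨁-map to ∑-map
    ; ⨁-++ to ∑-++; ⨁-concatMap to ∑-concatMap; ⨁-reindex to ∑-reindex; ⨁-point to ∑-point)

  ⟦_⟧ : Bool → ℤ
  ⟦ true ⟧ = 1ℤ
  ⟦ false ⟧ = 0ℤ

  ∑-*ˡ : ∀ (xs : List A) c (f : A → ℤ) → ∑ xs (λ x → c * f x) ≡ c * ∑ xs f
  ∑-*ˡ [] c f = sym (ℤₚ.*-zeroʳ c)
  ∑-*ˡ (x ∷ xs) c f = trans (cong (_+_ (c * f x)) (∑-*ˡ xs c f)) (sym (ℤₚ.*-distribˡ-+ c _ _))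

  ∑-*ʳ : ∀ (xs : List A) c (f : A → ℤ) → ∑ xs (λ x → f x * c) ≡ ∑ xs f * c
  ∑-*ʳ xs c f = trans (∑-cong xs (λ x → ℤₚ.*-comm (f x) c)) (trans (∑-*ˡ xs c f) (ℤₚ.*-comm c _))

  ∑-const : ∀ (xs : List A) c → ∑ xs (λ _ → c) ≡ + length xs * c
  ∑-const [] c = sym (ℤₚ.*-zeroˡ c)
  ∑-const (x ∷ xs) c = trans (cong (_+_ c) (∑-const xs c)) (lemma c (+ length xs))
    where
    lemma : ∀ c l → c + l * c ≡ (1ℤ + l) * c
    lemma = solve-∀

  ∑-1 : ∀ (xs : List A) → ∑ xs (λ _ → 1ℤ) ≡ + length xs
  ∑-1 xs = trans (∑-const xs 1ℤ) (ℤₚ.*-identityʳ _)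

  ∑-- : ∀ (xs : List A) (f g : A → ℤ) → ∑ xs (λ x → f x - g x) ≡ ∑ xs f - ∑ xs g
  ∑-- [] f g = refl
  ∑-- (x ∷ xs) f g = trans (cong (_+_ (f x - g x)) (∑-- xs f g)) (lemma (f x) (g x) _ _)
    where
    lemma : ∀ a b c d → (a - b) + (c - d) ≡ (a + c) - (b + d)
    lemma = solve-∀

  ∑-nonneg : ∀ (xs : List A) {f : A → ℤ} → (∀ x → 0ℤ ℤ.≤ f x) → 0ℤ ℤ.≤ ∑ xs f
  ∑-nonneg [] h = ℤₚ.≤-refl
  ∑-nonneg (x ∷ xs) h = ℤₚ.+-mono-≤ (h x) (∑-nonneg xs h)

  ∑-*-∑ : ∀ (xs : List A) (ys : List B) (f : A → ℤ) (g : B → ℤ) →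
    ∑ xs f * ∑ ys g ≡ ∑ xs (λ x → ∑ ys (λ y → f x * g y))
  ∑-*-∑ xs ys f g = trans (sym (∑-*ʳ xs (∑ ys g) f)) (∑-cong xs λ x → sym (∑-*ˡ ys (f x) g))

  ∑-filter : ∀ (p : A → Bool) xs (f : A → ℤ) → ∑ (filterᵇ p xs) f ≡ ∑ xs (λ x → ⟦ p x ⟧ * f x)
  ∑-filter p [] f = refl
  ∑-filter p (x ∷ xs) f with p x
  ... | true = cong₂ _+_ (sym (ℤₚ.*-identityˡ (f x))) (∑-filter p xs f)
  ... | false = trans (sym (ℤₚ.+-identityˡ _)) (cong₂ _+_ (sym (ℤₚ.*-zeroˡ (f x))) (∑-filter p xs f))

  countᵇ-∑ : ∀ (p : A → Bool) xs → + countᵇ p xs ≡ ∑ xs (λ x → ⟦ p x ⟧)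
  countᵇ-∑ p xs = trans (sym (∑-1 (filterᵇ p xs)))
    (trans (∑-filter p xs (λ _ → 1ℤ)) (∑-cong xs λ x → ℤₚ.*-identityʳ _))

  ∑-cartesianProduct : ∀ (xs : List A) (ys : List B) f →
    ∑ (cartesianProduct xs ys) f ≡ ∑ xs (λ x → ∑ ys (λ y → f (x , y)))
  ∑-cartesianProduct [] ys f = refl
  ∑-cartesianProduct (x ∷ xs) ys f = trans (∑-++ (map (x ,_) ys) _ f)
    (cong₂ _+_ (∑-map (x ,_) ys f) (∑-cartesianProduct xs ys f))

  0≤i*i : ∀ i → 0ℤ ℤ.≤ i * i
  0≤i*i (+ n) = subst (0ℤ ℤ.≤_) (ℤₚ.pos-* n n) (ℤ.+≤+ z≤n)
  0≤i*i (ℤ.-[1+ n ]) = ℤ.+≤+ z≤n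

  -- Lagrange's identity: 2 (∑f² ∑g² - (∑fg)²) = ∑∑ (f x g y - f y g x)².
  ∑-cauchy-schwarz : ∀ (xs : List A) (f g : A → ℤ) →
    ∑ xs (λ x → f x * g x) * ∑ xs (λ x → f x * g x) ℤ.≤ ∑ xs (λ x → f x * f x) * ∑ xs (λ x → g x * g x)
  ∑-cauchy-schwarz {A} xs f g = ℤₚ.*-cancelˡ-≤-pos _ _ (+ 2) (ℤₚ.0≤i-j⇒j≤i (subst (0ℤ ℤ.≤_) expand
      (∑-nonneg xs λ x → ∑-nonneg xs λ y → 0≤i*i (f x * g y - f y * g x))))
    where
    open ≡-Reasoning
    ff = ∑ xs (λ x → f x * f x)
    gg = ∑ xs (λ x → g x * g x)
    fg = ∑ xs (λ x → f x * g x)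
    square : ∀ a b c d → (a * d - b * c) * (a * d - b * c) ≡ ((a * a) * (d * d) + (c * c) * (b * b)) - + 2 * ((a * c) * (b * d))
    square = solve-∀
    collect : ∀ u v w → (u * v + v * u) - + 2 * (w * w) ≡ + 2 * (u * v) - + 2 * (w * w)
    collect = solve-∀
    expand : ∑ xs (λ x → ∑ xs (λ y → (f x * g y - f y * g x) * (f x * g y - f y * g x))) ≡ + 2 * (ff * gg) - + 2 * (fg * fg)
    expand = begin
      ∑ xs (λ x → ∑ xs (λ y → (f x * g y - f y * g x) * (f x * g y - f y * g x)))
        ≡⟨ ∑-cong xs (λ x → ∑-cong xs λ y → square (f x) (f y) (g x) (g y)) ⟩
      ∑ xs (λ x → ∑ xs (λ y → ((f x * f x) * (g y * g y) + (g x * g x) * (f y * f y)) - + 2 * ((f x * g x) * (f y * g y))))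
        ≡⟨ ∑-cong xs (λ x → trans (∑-- xs _ _) (cong₂ _-_ (∑-+ xs _ _) (∑-*ˡ xs (+ 2) _))) ⟩
      ∑ xs (λ x → (∑ xs (λ y → (f x * f x) * (g y * g y)) + ∑ xs (λ y → (g x * g x) * (f y * f y))) - + 2 * ∑ xs (λ y → (f x * g x) * (f y * g y)))
        ≡⟨ trans (∑-- xs _ _) (cong₂ _-_ (∑-+ xs _ _) (∑-*ˡ xs (+ 2) _)) ⟩
      (∑ xs (λ x → ∑ xs (λ y → (f x * f x) * (g y * g y))) + ∑ xs (λ x → ∑ xs (λ y → (g x * g x) * (f y * f y)))) - + 2 * ∑ xs (λ x → ∑ xs (λ y → (f x * g x) * (f y * g y)))
        ≡⟨ cong₂ _-_ (cong₂ _+_ (∑-*-∑ xs xs _ _) (∑-*-∑ xs xs _ _)) (cong (_*_ (+ 2)) (∑-*-∑ xs xs _ _)) ⟨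
      (ff * gg + gg * ff) - + 2 * (fg * fg)
        ≡⟨ collect ff gg fg ⟩
      + 2 * (ff * gg) - + 2 * (fg * fg) ∎

-- Finite fields: Fermat's theorem and the number of roots of a polynomial.

module FieldTheory where

  open FiniteSums

  module Field (F : FiniteField) where

    open FiniteField F public

    ring : CommutativeRing 0ℓ 0ℓ
    ring = record { isCommutativeRing = isCommutativeRing }

    open IsCommutativeRing isCommutativeRing public using
      ( +-assoc; +-comm; +-identityˡ; +-identityʳ; -‿inverseˡ; -‿inverseʳ; *-assoc; *-comm; *-identityˡ; *-identityʳ
      ; distribˡ; distribʳ; zeroˡ; zeroʳ; +-isCommutativeMonoid; *-isCommutativeMonoid)
    open import Algebra.Properties.CommutativeSemiring.Exp (CommutativeRing.commutativeSemiring ring) public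
      using (_^_; ^-homo-*; ^-assocʳ; ^-distrib-*)
    open import Algebra.Properties.Ring (CommutativeRing.ring ring) public
      using (-‿distribˡ-*; -‿distribʳ-*; -‿involutive; +-cancelˡ; +-cancelʳ; -0#≈0#)

    listing : Listing Carrier
    listing = record { elems = elems ; complete = complete ; unique = unique }

    card≥2 : 2 ℕ.≤ card
    card≥2 = unique-⊆⇒length≤ {xs = 0# ∷ 1# ∷ []} ((0≢1 ∷ []) ∷ [] ∷ []) (λ {x} _ → complete x)

    x-y≡0⇒x≡y : ∀ {x y} → x + (- y) ≡ 0# → x ≡ y
    x-y≡0⇒x≡y {x} {y} e = +-cancelʳ (- y) x y (trans e (sym (-‿inverseʳ y)))

    infix 8 _⁻¹[_]
    _⁻¹[_] : ∀ x → x ≢ 0# → Carrier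
    x ⁻¹[ x≢0 ] = proj₁ (inverse x x≢0)

    inverseʳ : ∀ x (x≢0 : x ≢ 0#) → x * x ⁻¹[ x≢0 ] ≡ 1#
    inverseʳ x x≢0 = proj₂ (inverse x x≢0)

    inverseˡ : ∀ x (x≢0 : x ≢ 0#) → x ⁻¹[ x≢0 ] * x ≡ 1#
    inverseˡ x x≢0 = trans (*-comm _ x) (inverseʳ x x≢0)

    y*[x*z] : ∀ {x y} → y * x ≡ 1# → ∀ z → y * (x * z) ≡ z
    y*[x*z] {x} {y} e z = trans (sym (*-assoc y x z)) (trans (cong (_* z) e) (*-identityˡ z))

    *-cancelˡ : ∀ x → x ≢ 0# → ∀ {y z} → x * y ≡ x * z → y ≡ z
    *-cancelˡ x x≢0 {y} {z} e = trans (sym (y*[x*z] (inverseˡ x x≢0) y)) (trans (cong (_ *_) e) (y*[x*z] (inverseˡ x x≢0) z))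

    noZeroDivisors : ∀ x y → x * y ≡ 0# → x ≡ 0# ⊎ y ≡ 0#
    noZeroDivisors x y e with x ≟ 0#
    ... | yes x≡0 = inj₁ x≡0
    ... | no x≢0 = inj₂ (*-cancelˡ x x≢0 (trans e (sym (zeroʳ x))))

    *-nonzero : ∀ {x y} → x ≢ 0# → y ≢ 0# → x * y ≢ 0#
    *-nonzero {x} {y} x≢0 y≢0 e with noZeroDivisors x y e
    ... | inj₁ p = x≢0 p
    ... | inj₂ p = y≢0 p

    1^n : ∀ n → 1# ^ n ≡ 1#
    1^n zero = refl
    1^n (suc n) = trans (*-identityˡ _) (1^n n)

    open BigOp *-isCommutativeMonoid using () renaming
      (⨁ to ∏; ⨁-cong to ∏-cong; ⨁-∙ to ∏-*; ⨁-reindex to ∏-reindex; ⨁-point to ∏-point)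

    -- Multiplication by a ≢ 0 permutes the factors of ∏ orOne.
    fermat : ∀ a → a ^ card ≡ a
    fermat a with a ≟ 0#
    ... | yes refl = lemma elems (complete 0#)
      where
      lemma : ∀ xs → 0# ∈ xs → 0# ^ length xs ≡ 0#
      lemma (x ∷ xs) _ = zeroˡ _
    ... | no a≢0 = *-cancelˡ P P≢0 (begin
        P * a ^ card                                ≡⟨ cong (P *_) (const elems) ⟨
        P * ∏ elems (λ _ → a)                       ≡⟨ *-comm P _ ⟩
        ∏ elems (λ _ → a) * P                       ≡⟨ ∏-* elems _ _ ⟨
        ∏ elems (λ x → a * orOne x)                 ≡⟨ ∏-cong elems split ⟩
        ∏ elems (λ x → orOne (a * x) * at0 x)       ≡⟨ ∏-* elems _ _ ⟩
        ∏ elems (λ x → orOne (a * x)) * ∏ elems at0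
          ≡⟨ cong₂ _*_ (∏-reindex listing (a *_) (a ⁻¹[ a≢0 ] *_) (y*[x*z] (inverseˡ a a≢0)) (y*[x*z] (inverseʳ a a≢0)) orOne)
               (trans (∏-point listing 0# at0 at0-≢) at0-0) ⟩
        P * a                                       ∎)
      where
      open ≡-Reasoning
      -- Replacing 0 by 1 lets the product run over the whole field, where reindexing is available.
      -- At x = 0 this costs one factor a, recorded by `at0`, so the result is a^q = a and not
      -- a^(q-1) = 1.
      orOne at0 : Carrier → Carrier
      orOne x with x ≟ 0#
      ... | yes _ = 1#
      ... | no _ = x
      at0 x with x ≟ 0#
      ... | yes _ = a
      ... | no _ = 1#
      P : Carrier
      P = ∏ elems orOne
      orOne≢0 : ∀ x → orOne x ≢ 0#
      orOne≢0 x with x ≟ 0#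
      ... | yes _ = λ e → 0≢1 (sym e)
      ... | no n = n
      P≢0 : P ≢ 0#
      P≢0 = go elems
        where
        go : ∀ xs → ∏ xs orOne ≢ 0#
        go [] e = 0≢1 (sym e)
        go (x ∷ xs) = *-nonzero (orOne≢0 x) (go xs)
      at0-≢ : ∀ x → x ≢ 0# → at0 x ≡ 1#
      at0-≢ x n with x ≟ 0#
      ... | yes e = contradiction e n
      ... | no _ = refl
      at0-0 : at0 0# ≡ a
      at0-0 with 0# ≟ 0#
      ... | yes _ = refl
      ... | no n = contradiction refl n
      split : ∀ x → a * orOne x ≡ orOne (a * x) * at0 x
      split x with x ≟ 0# | (a * x) ≟ 0#
      ... | yes _ | yes _ = *-comm a 1#
      ... | yes refl | no n = contradiction (zeroʳ a) n
      ... | no n | yes e = contradiction e (*-nonzero a≢0 n)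
      ... | no _ | no _ = sym (*-identityʳ _)
      const : ∀ xs → ∏ xs (λ _ → a) ≡ a ^ length xs
      const [] = refl
      const (x ∷ xs) = cong (a *_) (const xs)

    zeros : ∀ n → Vec Carrier n
    zeros n = replicate n 0#

    eval : ∀ {n} → Vec Carrier n → Carrier → Carrier
    eval [] x = 0#
    eval (c ∷ cs) x = c + x * eval cs x

    eval-zeros : ∀ n x → eval (zeros n) x ≡ 0#
    eval-zeros zero x = refl
    eval-zeros (suc n) x = trans (+-identityˡ _) (trans (cong (x *_) (eval-zeros n x)) (zeroʳ x))

    -- Horner's scheme: the coefficients of the quotient by X - r, constant term first, are the
    -- values at r of the successive tails.
    divide : ∀ {n} → Carrier → Vec Carrier (suc n) → Vec Carrier n
    divide {zero} r _ = []
    divide {suc n} r (c ∷ cs) = eval cs r ∷ divide r cs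

    eval-divide : ∀ {n} r (cs : Vec Carrier (suc n)) x → eval cs x ≡ (x + (- r)) * eval (divide r cs) x + eval cs r
    eval-divide {zero} r (c ∷ []) x = begin
      c + x * 0#                     ≡⟨ cong (c +_) (trans (zeroʳ x) (sym (zeroʳ r))) ⟩
      c + r * 0#                     ≡⟨ +-identityˡ _ ⟨
      0# + (c + r * 0#)              ≡⟨ cong (_+ (c + r * 0#)) (zeroʳ _) ⟨
      (x + (- r)) * 0# + (c + r * 0#) ∎
      where open ≡-Reasoning
    eval-divide {suc n} r (c ∷ cs) x = begin
      c + x * eval cs x                             ≡⟨ cong (λ z → c + x * z) (eval-divide r cs x) ⟩
      c + x * (d * u + v)                           ≡⟨ cong (c +_) (distribˡ x _ _) ⟩
      c + (x * (d * u) + x * v)                     ≡⟨ cong (λ z → c + (x * (d * u) + z * v)) split ⟩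
      c + (x * (d * u) + (d + r) * v)               ≡⟨ lemma c x d u v r ⟩
      d * (v + x * u) + (c + r * v)                 ∎
      where
      open ≡-Reasoning
      d = x + (- r)
      u = eval (divide r cs) x
      v = eval cs r
      split : x ≡ d + r
      split = sym (trans (+-assoc x (- r) r) (trans (cong (x +_) (-‿inverseˡ r)) (+-identityʳ x)))
      lemma : ∀ c x d u v r → c + (x * (d * u) + (d + r) * v) ≡ d * (v + x * u) + (c + r * v)
      lemma = solve 6 (λ c x d u v r → c :+ (x :* (d :* u) :+ (d :+ r) :* v) := d :* (v :+ x :* u) :+ (c :+ r :* v)) refl
        where open import Algebra.Solver.Ring.NaturalCoefficients.Default (CommutativeRing.commutativeSemiring ring)

    divide-zeros : ∀ {n} r (cs : Vec Carrier (suc n)) → divide r cs ≡ zeros n → eval cs r ≡ 0# → cs ≡ zeros (suc n)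
    divide-zeros {zero} r (c ∷ []) _ e = cong (_∷ []) (trans (sym (trans (cong (c +_) (zeroʳ r)) (+-identityʳ c))) e)
    divide-zeros {suc n} r (c ∷ cs) d e = cong₂ _∷_
      (trans (sym (+-identityʳ c)) (trans (cong (c +_) (sym (trans (cong (r *_) v≡0) (zeroʳ r)))) e))
      (divide-zeros r cs (cong Vec.tail d) v≡0)
      where v≡0 = cong Vec.head d

    -- Induction on the roots: after division by X - r the remaining ones are roots of the quotient,
    -- as x - r does not vanish there.
    manyRoots⇒zeros : ∀ {n} (cs : Vec Carrier n) xs → Unique xs → All (λ x → eval cs x ≡ 0#) xs →
      n ℕ.≤ length xs → cs ≡ zeros n
    manyRoots⇒zeros [] _ _ _ _ = refl
    manyRoots⇒zeros {suc n} cs (r ∷ xs) (r∉ ∷ u) (e ∷ es) (s≤s l) =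
      divide-zeros r cs (manyRoots⇒zeros (divide r cs) xs u (All.tabulate quot) l) e
      where
      quot : ∀ {x} → x ∈ xs → eval (divide r cs) x ≡ 0#
      quot {x} p with noZeroDivisors (x + (- r)) (eval (divide r cs) x)
         (trans (sym (+-identityʳ _)) (trans (cong ((x + (- r)) * eval (divide r cs) x +_) (sym e)) (trans (sym (eval-divide r cs x)) (All.lookup es p))))
      ... | inj₁ z = contradiction (sym (x-y≡0⇒x≡y z)) (All.lookup r∉ p)
      ... | inj₂ z = z

    vanishing⇒zeros : ∀ {n} (cs : Vec Carrier n) → n ℕ.≤ card → (∀ x → eval cs x ≡ 0#) → cs ≡ zeros n
    vanishing⇒zeros cs l h = manyRoots⇒zeros cs elems unique (All.tabulate λ {x} _ → h x) l

    eval-monomial : ∀ n x → eval (zeros n ∷ʳ 1#) x ≡ x ^ n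
    eval-monomial zero x = trans (cong (1# +_) (zeroʳ x)) (+-identityʳ 1#)
    eval-monomial (suc n) x = trans (+-identityˡ _) (cong (x *_) (eval-monomial n x))

    -- Otherwise X^(m+2) - X, a nonzero polynomial with m + 3 coefficients, would vanish at more
    -- than m + 2 points. It bounds the size of the constructed field and produces nonresidues.
    power-identity⇒card≤ : ∀ m → (∀ x → x ^ suc (suc m) ≡ x) → card ℕ.≤ suc (suc m)
    power-identity⇒card≤ m h = ℕₚ.≮⇒≥ λ lt → last≢0 m (cong (Vec.tail ∘ Vec.tail)
      (vanishing⇒zeros (0# ∷ (- 1#) ∷ (zeros m ∷ʳ 1#)) lt vanish))
      where
      last≢0 : ∀ m → zeros m ∷ʳ 1# ≢ zeros (suc m)
      last≢0 zero e = 0≢1 (sym (cong Vec.head e))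
      last≢0 (suc m) e = last≢0 m (cong Vec.tail e)
      open ≡-Reasoning
      vanish : ∀ x → eval (0# ∷ (- 1#) ∷ (zeros m ∷ʳ 1#)) x ≡ 0#
      vanish x = begin
        0# + x * ((- 1#) + x * eval (zeros m ∷ʳ 1#) x) ≡⟨ +-identityˡ _ ⟩
        x * ((- 1#) + x * eval (zeros m ∷ʳ 1#) x)      ≡⟨ distribˡ x _ _ ⟩
        x * (- 1#) + x * (x * eval (zeros m ∷ʳ 1#) x) ≡⟨ cong₂ _+_ (sym (-‿distribʳ-* x 1#)) (cong (λ z → x * (x * z)) (eval-monomial m x)) ⟩
        (- (x * 1#)) + x ^ suc (suc m)                 ≡⟨ cong₂ _+_ (cong -_ (*-identityʳ x)) (h x) ⟩
        (- x) + x                                      ≡⟨ -‿inverseˡ x ⟩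
        0# ∎

-- Coordinate spaces over F and additivity of the Frobenius map.

module Vectors where

  open FiniteSums
  open FieldTheory
  open import Data.Integer using (ℤ)

  module VectorSpace (F : FiniteField) where

    open Field F

    infixl 6 _⊕_
    infixr 7 _⊙_
    infix 8 ⊝_

    _⊕_ : ∀ {n} → Vec Carrier n → Vec Carrier n → Vec Carrier n
    _⊕_ = Vec.zipWith _+_

    ⊝_ : ∀ {n} → Vec Carrier n → Vec Carrier n
    ⊝_ = Vec.map -_

    _⊙_ : ∀ {n} → Carrier → Vec Carrier n → Vec Carrier n
    c ⊙ v = Vec.map (c *_) v

    _≟ᵛ_ : ∀ {n} → DecidableEquality (Vec Carrier n)
    _≟ᵛ_ = Vecₚ.≡-dec _≟_

    ⊕-assoc : ∀ {n} (u v w : Vec Carrier n) → (u ⊕ v) ⊕ w ≡ u ⊕ (v ⊕ w)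
    ⊕-assoc = Vecₚ.zipWith-assoc +-assoc

    ⊕-comm : ∀ {n} (u v : Vec Carrier n) → u ⊕ v ≡ v ⊕ u
    ⊕-comm = Vecₚ.zipWith-comm +-comm

    ⊕-identityˡ : ∀ {n} (v : Vec Carrier n) → zeros n ⊕ v ≡ v
    ⊕-identityˡ = Vecₚ.zipWith-identityˡ +-identityˡ

    ⊕-identityʳ : ∀ {n} (v : Vec Carrier n) → v ⊕ zeros n ≡ v
    ⊕-identityʳ = Vecₚ.zipWith-identityʳ +-identityʳ

    ⊝-inverseˡ : ∀ {n} (v : Vec Carrier n) → ⊝ v ⊕ v ≡ zeros n
    ⊝-inverseˡ = Vecₚ.zipWith-inverseˡ -‿inverseˡ

    ⊝-inverseʳ : ∀ {n} (v : Vec Carrier n) → v ⊕ ⊝ v ≡ zeros n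
    ⊝-inverseʳ = Vecₚ.zipWith-inverseʳ -‿inverseʳ

    ⊕-isCommutativeMonoid : ∀ {n} → IsCommutativeMonoid _≡_ _⊕_ (zeros n)
    ⊕-isCommutativeMonoid = record
      { isMonoid = record
        { isSemigroup = record { isMagma = record { isEquivalence = ≡.isEquivalence ; ∙-cong = cong₂ _⊕_ } ; assoc = ⊕-assoc }
        ; identity = ⊕-identityˡ , ⊕-identityʳ }
      ; comm = ⊕-comm }

    ⊕-interchange : ∀ {n} (a b c d : Vec Carrier n) → (a ⊕ b) ⊕ (c ⊕ d) ≡ (a ⊕ c) ⊕ (b ⊕ d)
    ⊕-interchange = BigOp.interchange ⊕-isCommutativeMonoid

    ⊙-distribˡ : ∀ {n} c (u v : Vec Carrier n) → c ⊙ (u ⊕ v) ≡ c ⊙ u ⊕ c ⊙ v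
    ⊙-distribˡ c [] [] = refl
    ⊙-distribˡ c (x ∷ u) (y ∷ v) = cong₂ _∷_ (distribˡ c x y) (⊙-distribˡ c u v)

    ⊙-distribʳ : ∀ {n} c d (v : Vec Carrier n) → (c + d) ⊙ v ≡ c ⊙ v ⊕ d ⊙ v
    ⊙-distribʳ c d [] = refl
    ⊙-distribʳ c d (x ∷ v) = cong₂ _∷_ (distribʳ x c d) (⊙-distribʳ c d v)

    ⊙-assoc : ∀ {n} c d (v : Vec Carrier n) → (c * d) ⊙ v ≡ c ⊙ d ⊙ v
    ⊙-assoc c d [] = refl
    ⊙-assoc c d (x ∷ v) = cong₂ _∷_ (*-assoc c d x) (⊙-assoc c d v)

    ⊙-identity : ∀ {n} (v : Vec Carrier n) → 1# ⊙ v ≡ v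
    ⊙-identity [] = refl
    ⊙-identity (x ∷ v) = cong₂ _∷_ (*-identityˡ x) (⊙-identity v)

    ⊙-zeroˡ : ∀ {n} (v : Vec Carrier n) → 0# ⊙ v ≡ zeros n
    ⊙-zeroˡ [] = refl
    ⊙-zeroˡ (x ∷ v) = cong₂ _∷_ (zeroˡ x) (⊙-zeroˡ v)

    ⊙-zeroʳ : ∀ {n} c → c ⊙ zeros n ≡ zeros n
    ⊙-zeroʳ {zero} c = refl
    ⊙-zeroʳ {suc n} c = cong₂ _∷_ (zeroʳ c) (⊙-zeroʳ c)

    ⊙-swap : ∀ {n} c d (v : Vec Carrier n) → c ⊙ d ⊙ v ≡ d ⊙ c ⊙ v
    ⊙-swap c d v = trans (sym (⊙-assoc c d v)) (trans (cong (_⊙ v) (*-comm c d)) (⊙-assoc d c v))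

    ⊙-cancel : ∀ {n} {c d} → c * d ≡ 1# → ∀ (v : Vec Carrier n) → c ⊙ d ⊙ v ≡ v
    ⊙-cancel {c = c} {d} e v = trans (sym (⊙-assoc c d v)) (trans (cong (_⊙ v) e) (⊙-identity v))

    ⊙-nonzero : ∀ {n} {c} {v : Vec Carrier n} → c ≢ 0# → v ≢ zeros n → c ⊙ v ≢ zeros n
    ⊙-nonzero {c = c} {v} c≢0 v≢0 e = v≢0 (trans (sym (⊙-cancel (inverseˡ c c≢0) v)) (trans (cong (_ ⊙_) e) (⊙-zeroʳ _)))

    ⊝≡-1⊙ : ∀ {n} (v : Vec Carrier n) → ⊝ v ≡ (- 1#) ⊙ v
    ⊝≡-1⊙ [] = refl
    ⊝≡-1⊙ (x ∷ v) = cong₂ _∷_ (trans (cong -_ (sym (*-identityˡ x))) (-‿distribˡ-* 1# x)) (⊝≡-1⊙ v)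

    u⊝v≡0⇒u≡v : ∀ {n} {u v : Vec Carrier n} → u ⊕ ⊝ v ≡ zeros n → u ≡ v
    u⊝v≡0⇒u≡v {u = []} {[]} _ = refl
    u⊝v≡0⇒u≡v {u = x ∷ u} {y ∷ v} e = cong₂ _∷_ (x-y≡0⇒x≡y (cong Vec.head e)) (u⊝v≡0⇒u≡v (cong Vec.tail e))

    allVecs-cartesian : ∀ n → allVecs F (suc n) ≡ cartesianProductWith _∷_ elems (allVecs F n)
    allVecs-cartesian n = go elems
      where
      go : ∀ xs → concatMap (λ x → List.map (x ∷_) (allVecs F n)) xs ≡ cartesianProductWith _∷_ xs (allVecs F n)
      go [] = refl
      go (x ∷ xs) = cong (List.map (x ∷_) (allVecs F n) ++_) (go xs)

    vecListing : ∀ n → Listing (Vec Carrier n)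
    vecListing n = record { elems = allVecs F n ; complete = comp n ; unique = uniq n }
      where
      comp : ∀ n (v : Vec Carrier n) → v ∈ allVecs F n
      comp zero [] = here refl
      comp (suc n) (x ∷ v) = subst (_ ∈_) (sym (allVecs-cartesian n)) (∈-cartesianProductWith⁺ _∷_ (complete x) (comp n v))
      uniq : ∀ n → Unique (allVecs F n)
      uniq zero = [] ∷ []
      uniq (suc n) = subst Unique (sym (allVecs-cartesian n))
        (Unique.cartesianProductWith⁺ _∷_ (λ e → cong Vec.head e , cong Vec.tail e) unique (uniq n))

    length-allVecs : ∀ n → length (allVecs F n) ≡ card ℕ.^ n
    length-allVecs zero = refl
    length-allVecs (suc n) = trans (go elems) (cong (card ℕ.*_) (length-allVecs n))
      where
      go : ∀ xs → length (concatMap (λ x → List.map (x ∷_) (allVecs F n)) xs) ≡ length xs ℕ.* length (allVecs F n)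
      go [] = refl
      go (x ∷ xs) = trans (length-++ (List.map (x ∷_) (allVecs F n))) (cong₂ ℕ._+_ (length-map (x ∷_) (allVecs F n)) (go xs))

    ∑-allVecs-suc : ∀ n (f : Vec Carrier (suc n) → ℤ) →
      ∑ (allVecs F (suc n)) f ≡ ∑ elems (λ x → ∑ (allVecs F n) (λ v → f (x ∷ v)))
    ∑-allVecs-suc n f = trans (∑-concatMap _ elems f) (∑-cong elems λ x → ∑-map (x ∷_) (allVecs F n) f)

  -- Frobenius is additive: x ↦ (x + 1)^q - x^q - 1 vanishes on F and has degree < q,
  -- so all its coefficients, the middle binomial coefficients, are zero in F.
  module Frobenius (F : FiniteField) where

    open Field F
    open VectorSpace F

    -- (x + y)^m = x^m + y · homEval (binomials m) x y
    binomials : ∀ m → Vec Carrier m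
    binomials zero = []
    -- From (x + y)(x^m + yh) = x^(m+1) + y(yh + xh + x^m): appending 0 multiplies `homEval` by y,
    -- prepending 0 multiplies it by x, and the monomial supplies x^m.
    binomials (suc m) = ((binomials m ∷ʳ 0#) ⊕ (0# ∷ binomials m)) ⊕ (zeros m ∷ʳ 1#)

    -- The coefficients live in F while x and y live in a ring A that receives F. With A = F the
    -- coefficients for m = q are identified; with A a companion ring they yield Frobenius there.
    module Expansion (A : CommutativeRing 0ℓ 0ℓ) (ι : Carrier → CommutativeRing.Carrier A)
      (ι-+ : ∀ c d → CommutativeRing._≈_ A (ι (c + d)) (CommutativeRing._+_ A (ι c) (ι d)))
      (ι-0 : CommutativeRing._≈_ A (ι 0#) (CommutativeRing.0# A))
      (ι-1 : CommutativeRing._≈_ A (ι 1#) (CommutativeRing.1# A)) where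

      open CommutativeRing A using (setoid; _≈_) renaming (Carrier to C; _+_ to _⊞_; _*_ to _⊠_; 0# to 𝟘; 1# to 𝟙)
      module A = CommutativeRing A
      open import Algebra.Properties.CommutativeSemiring.Exp A.commutativeSemiring public using () renaming (_^_ to _⋆_; ^-assocʳ to ⋆-assocʳ; ^-congˡ to ⋆-congˡ)
      open import Algebra.Solver.Ring.NaturalCoefficients.Default A.commutativeSemiring using (solve; _:+_; _:*_; _:=_; con)
      open import Relation.Binary.Reasoning.Setoid setoid

      -- The homogeneous form of degree k - 1 in which entry i is the coefficient of x^i y^(k-1-i).
      homEval : ∀ {k} → Vec Carrier k → C → C → C
      homEval [] x y = 𝟘
      homEval {suc k} (c ∷ cs) x y = ι c ⊠ (y ⋆ k) ⊞ x ⊠ homEval cs x y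

      homEval-⊕ : ∀ {k} (cs ds : Vec Carrier k) x y → homEval (cs ⊕ ds) x y ≈ homEval cs x y ⊞ homEval ds x y
      homEval-⊕ [] [] x y = A.sym (A.+-identityˡ 𝟘)
      homEval-⊕ {suc k} (c ∷ cs) (d ∷ ds) x y = begin
        ι (c + d) ⊠ (y ⋆ k) ⊞ x ⊠ homEval (cs ⊕ ds) x y
          ≈⟨ A.+-cong (A.*-congʳ (ι-+ c d)) (A.*-congˡ (homEval-⊕ cs ds x y)) ⟩
        (ι c ⊞ ι d) ⊠ (y ⋆ k) ⊞ x ⊠ (homEval cs x y ⊞ homEval ds x y)
          ≈⟨ solve 6 (λ c d p x u v → (c :+ d) :* p :+ x :* (u :+ v) := (c :* p :+ x :* u) :+ (d :* p :+ x :* v)) A.refl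
               (ι c) (ι d) (y ⋆ k) x (homEval cs x y) (homEval ds x y) ⟩
        _ ∎

      homEval-∷ʳ0 : ∀ {k} (cs : Vec Carrier k) x y → homEval (cs ∷ʳ 0#) x y ≈ y ⊠ homEval cs x y
      homEval-∷ʳ0 [] x y = begin
        ι 0# ⊠ 𝟙 ⊞ x ⊠ 𝟘 ≈⟨ A.+-cong (A.trans (A.*-identityʳ _) ι-0) (A.zeroʳ x) ⟩
        𝟘 ⊞ 𝟘            ≈⟨ A.+-identityˡ 𝟘 ⟩
        𝟘                ≈⟨ A.zeroʳ y ⟨
        y ⊠ 𝟘            ∎
      homEval-∷ʳ0 {suc k} (c ∷ cs) x y = begin
        ι c ⊠ (y ⋆ suc k) ⊞ x ⊠ homEval (cs ∷ʳ 0#) x y ≈⟨ A.+-congˡ (A.*-congˡ (homEval-∷ʳ0 cs x y)) ⟩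
        ι c ⊠ (y ⊠ (y ⋆ k)) ⊞ x ⊠ (y ⊠ homEval cs x y)
          ≈⟨ solve 5 (λ c y p x u → c :* (y :* p) :+ x :* (y :* u) := y :* (c :* p :+ x :* u)) A.refl (ι c) y (y ⋆ k) x (homEval cs x y) ⟩
        _ ∎

      homEval-0∷ : ∀ {k} (cs : Vec Carrier k) x y → homEval (0# ∷ cs) x y ≈ x ⊠ homEval cs x y
      homEval-0∷ {k} cs x y = A.trans (A.+-congʳ (A.trans (A.*-congʳ ι-0) (A.zeroˡ _))) (A.+-identityˡ _)

      homEval-zeros : ∀ k x y → homEval (zeros k) x y ≈ 𝟘
      homEval-zeros zero x y = A.refl
      homEval-zeros (suc k) x y = A.trans (homEval-0∷ (zeros k) x y) (A.trans (A.*-congˡ (homEval-zeros k x y)) (A.zeroʳ x))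

      homEval-monomial : ∀ k x y → homEval (zeros k ∷ʳ 1#) x y ≈ x ⋆ k
      homEval-monomial zero x y = A.trans (A.+-cong (A.trans (A.*-identityʳ _) ι-1) (A.zeroʳ x)) (A.+-identityʳ 𝟙)
      homEval-monomial (suc k) x y = A.trans (homEval-0∷ (zeros k ∷ʳ 1#) x y) (A.*-congˡ (homEval-monomial k x y))

      binomial-expansion : ∀ m x y → (x ⊞ y) ⋆ m ≈ (x ⋆ m) ⊞ y ⊠ homEval (binomials m) x y
      binomial-expansion zero x y = A.sym (A.trans (A.+-congˡ (A.zeroʳ y)) (A.+-identityʳ 𝟙))
      binomial-expansion (suc m) x y = begin
        (x ⊞ y) ⊠ ((x ⊞ y) ⋆ m)    ≈⟨ A.*-congˡ (binomial-expansion m x y) ⟩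
        (x ⊞ y) ⊠ ((x ⋆ m) ⊞ y ⊠ h)
          ≈⟨ solve 4 (λ x y p h → (x :+ y) :* (p :+ y :* h) := x :* p :+ y :* ((y :* h :+ x :* h) :+ p)) A.refl x y (x ⋆ m) h ⟩
        x ⊠ (x ⋆ m) ⊞ y ⊠ ((y ⊠ h ⊞ x ⊠ h) ⊞ (x ⋆ m))
          ≈⟨ A.+-congˡ (A.*-congˡ (A.+-cong (A.+-cong (homEval-∷ʳ0 b x y) (homEval-0∷ b x y)) (homEval-monomial m x y))) ⟨
        x ⊠ (x ⋆ m) ⊞ y ⊠ ((homEval (b ∷ʳ 0#) x y ⊞ homEval (0# ∷ b) x y) ⊞ homEval (zeros m ∷ʳ 1#) x y)
          ≈⟨ A.+-congˡ (A.*-congˡ (A.+-congʳ (homEval-⊕ (b ∷ʳ 0#) (0# ∷ b) x y))) ⟨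
        x ⊠ (x ⋆ m) ⊞ y ⊠ (homEval ((b ∷ʳ 0#) ⊕ (0# ∷ b)) x y ⊞ homEval (zeros m ∷ʳ 1#) x y)
          ≈⟨ A.+-congˡ (A.*-congˡ (homEval-⊕ ((b ∷ʳ 0#) ⊕ (0# ∷ b)) (zeros m ∷ʳ 1#) x y)) ⟨
        x ⊠ (x ⋆ m) ⊞ y ⊠ homEval (binomials (suc m)) x y ∎
        where
        b = binomials m
        h = homEval b x y

    module Self = Expansion ring (λ c → c) (λ c d → refl) refl refl

    homEval-1 : ∀ {k} (cs : Vec Carrier k) x → Self.homEval cs x 1# ≡ eval cs x
    homEval-1 [] x = refl
    homEval-1 {suc k} (c ∷ cs) x = cong₂ _+_ (trans (cong (c *_) (1^n k)) (*-identityʳ c)) (cong (x *_) (homEval-1 cs x))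

    eval-binomials : ∀ m x → (x + 1#) ^ m ≡ x ^ m + eval (binomials m) x
    eval-binomials m x = trans (Self.binomial-expansion m x 1#)
      (cong ((x ^ m) +_) (trans (*-identityˡ _) (homEval-1 (binomials m) x)))

    eval-⊕ : ∀ {k} (cs ds : Vec Carrier k) x → eval (cs ⊕ ds) x ≡ eval cs x + eval ds x
    eval-⊕ cs ds x = trans (sym (homEval-1 (cs ⊕ ds) x))
      (trans (Self.homEval-⊕ cs ds x 1#) (cong₂ _+_ (homEval-1 cs x) (homEval-1 ds x)))

    binomials-card : ∀ j → suc j ≡ card → binomials (suc j) ≡ 1# ∷ zeros j
    binomials-card j e = u⊝v≡0⇒u≡v (vanishing⇒zeros _ (ℕₚ.≤-reflexive e) λ x → begin
      eval (binomials (suc j) ⊕ ⊝ (1# ∷ zeros j)) x ≡⟨ eval-⊕ (binomials (suc j)) _ x ⟩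
      eval (binomials (suc j)) x + eval (⊝ (1# ∷ zeros j)) x
        ≡⟨ cong₂ _+_ (one x) (neg x) ⟩
      1# + (- 1#)                                        ≡⟨ -‿inverseʳ 1# ⟩
      0#                                                 ∎)
      where
      open ≡-Reasoning
      fermat' : ∀ x → x ^ suc j ≡ x
      fermat' x = subst (λ k → x ^ k ≡ x) (sym e) (fermat x)
      one : ∀ x → eval (binomials (suc j)) x ≡ 1#
      one x = +-cancelˡ x _ _ (begin
        x + eval (binomials (suc j)) x           ≡⟨ cong (_+ eval (binomials (suc j)) x) (fermat' x) ⟨
        x ^ suc j + eval (binomials (suc j)) x   ≡⟨ eval-binomials (suc j) x ⟨
        (x + 1#) ^ suc j                              ≡⟨ fermat' (x + 1#) ⟩
        x + 1#                                        ∎)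
      ⊝zeros : ∀ k → ⊝ (zeros k) ≡ zeros k
      ⊝zeros zero = refl
      ⊝zeros (suc k) = cong₂ _∷_ -0#≈0# (⊝zeros k)
      neg : ∀ x → eval (⊝ (1# ∷ zeros j)) x ≡ - 1#
      neg x = trans (cong (λ v → (- 1#) + x * eval v x) (⊝zeros j))
        (trans (cong (λ z → (- 1#) + x * z) (eval-zeros j x)) (trans (cong ((- 1#) +_) (zeroʳ x)) (+-identityʳ _)))

    module Additive (A : CommutativeRing 0ℓ 0ℓ) (ι : Carrier → CommutativeRing.Carrier A)
      (ι-+ : ∀ c d → CommutativeRing._≈_ A (ι (c + d)) (CommutativeRing._+_ A (ι c) (ι d)))
      (ι-0 : CommutativeRing._≈_ A (ι 0#) (CommutativeRing.0# A))
      (ι-1 : CommutativeRing._≈_ A (ι 1#) (CommutativeRing.1# A)) where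

      open Expansion A ι ι-+ ι-0 ι-1
      open CommutativeRing A using (setoid; _≈_) renaming (Carrier to C; _+_ to _⊞_; _*_ to _⊠_; 0# to 𝟘; 1# to 𝟙)
      open import Relation.Binary.Reasoning.Setoid setoid

      frobenius-suc : ∀ j → suc j ≡ card → ∀ x y → (x ⊞ y) ⋆ suc j ≈ (x ⋆ suc j) ⊞ (y ⋆ suc j)
      frobenius-suc j e x y = begin
        (x ⊞ y) ⋆ suc j                                          ≈⟨ binomial-expansion (suc j) x y ⟩
        (x ⋆ suc j) ⊞ y ⊠ homEval (binomials (suc j)) x y
          ≡⟨ cong (λ b → (x ⋆ suc j) ⊞ y ⊠ homEval b x y) (binomials-card j e) ⟩
        (x ⋆ suc j) ⊞ y ⊠ (ι 1# ⊠ (y ⋆ j) ⊞ x ⊠ homEval (zeros j) x y)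
          ≈⟨ A.+-congˡ (A.*-congˡ (A.+-cong (A.trans (A.*-congʳ ι-1) (A.*-identityˡ _)) (A.trans (A.*-congˡ (homEval-zeros j x y)) (A.zeroʳ x)))) ⟩
        (x ⋆ suc j) ⊞ y ⊠ ((y ⋆ j) ⊞ 𝟘)                          ≈⟨ A.+-congˡ (A.*-congˡ (A.+-identityʳ _)) ⟩
        (x ⋆ suc j) ⊞ (y ⋆ suc j)                                ∎

      frobenius : ∀ x y → (x ⊞ y) ⋆ card ≈ (x ⋆ card) ⊞ (y ⋆ card)
      frobenius = go card refl
        where
        go : ∀ k → k ≡ card → ∀ x y → (x ⊞ y) ⋆ k ≈ (x ⋆ k) ⊞ (y ⋆ k)
        go zero e = contradiction (subst (2 ℕ.≤_) (sym e) card≥2) λ ()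
        go (suc j) e = frobenius-suc j e

      frobenius^ : ∀ n x y → (x ⊞ y) ⋆ (card ℕ.^ n) ≈ (x ⋆ (card ℕ.^ n)) ⊞ (y ⋆ (card ℕ.^ n))
      frobenius^ zero x y = A.trans (A.*-identityʳ _) (A.+-cong (A.sym (A.*-identityʳ _)) (A.sym (A.*-identityʳ _)))
      frobenius^ (suc n) x y = begin
        (x ⊞ y) ⋆ (card ℕ.* Q)                      ≈⟨ ⋆-assocʳ (x ⊞ y) card Q ⟨
        ((x ⊞ y) ⋆ card) ⋆ Q                        ≈⟨ ⋆-congˡ Q (frobenius x y) ⟩
        ((x ⋆ card) ⊞ (y ⋆ card)) ⋆ Q               ≈⟨ frobenius^ n (x ⋆ card) (y ⋆ card) ⟩
        ((x ⋆ card) ⋆ Q) ⊞ ((y ⋆ card) ⋆ Q)         ≈⟨ A.+-cong (⋆-assocʳ x card Q) (⋆-assocʳ y card Q) ⟩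
        (x ⋆ (card ℕ.* Q)) ⊞ (y ⋆ (card ℕ.* Q))     ∎
        where Q = card ℕ.^ n

-- The quotient F[X]/(f) on coefficient vectors.

module CompanionRing where

  open FiniteSums
  open FieldTheory
  open Vectors

  module _ {A : Set} where

    lastᵛ : ∀ {n} → Vec A (suc n) → A
    lastᵛ (x ∷ []) = x
    lastᵛ (x ∷ y ∷ v) = lastᵛ (y ∷ v)

    initᵛ : ∀ {n} → Vec A (suc n) → Vec A n
    initᵛ (x ∷ []) = []
    initᵛ (x ∷ y ∷ v) = x ∷ initᵛ (y ∷ v)

    lastᵛ-∷ʳ : ∀ {n} (v : Vec A n) x → lastᵛ (v ∷ʳ x) ≡ x
    lastᵛ-∷ʳ [] x = refl
    lastᵛ-∷ʳ (y ∷ []) x = refl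
    lastᵛ-∷ʳ (y ∷ z ∷ v) x = lastᵛ-∷ʳ (z ∷ v) x

    initᵛ-∷ʳ : ∀ {n} (v : Vec A n) x → initᵛ (v ∷ʳ x) ≡ v
    initᵛ-∷ʳ [] x = refl
    initᵛ-∷ʳ (y ∷ []) x = refl
    initᵛ-∷ʳ (y ∷ z ∷ v) x = cong (y ∷_) (initᵛ-∷ʳ (z ∷ v) x)

    initᵛ∷ʳlastᵛ : ∀ {n} (v : Vec A (suc n)) → v ≡ initᵛ v ∷ʳ lastᵛ v
    initᵛ∷ʳlastᵛ (x ∷ []) = refl
    initᵛ∷ʳlastᵛ (x ∷ y ∷ v) = cong (x ∷_) (initᵛ∷ʳlastᵛ (y ∷ v))

  -- F[X] / (X^(m+1) - r(X)) on coefficient vectors: shift is multiplication by X, and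
  -- act c is the operator c(X).  All operators act c commute, and act c one ≡ c, which
  -- makes the product act a b commutative and associative.
  module Companion (F : FiniteField) (m : ℕ) (r : Vec (FiniteField.Carrier F) (suc m)) where

    open Field F
    open VectorSpace F

    V : Set
    V = Vec Carrier (suc m)

    lastᵛ-⊕ : ∀ {n} (u v : Vec Carrier (suc n)) → lastᵛ (u ⊕ v) ≡ lastᵛ u + lastᵛ v
    lastᵛ-⊕ (x ∷ []) (y ∷ []) = refl
    lastᵛ-⊕ (x ∷ x' ∷ u) (y ∷ y' ∷ v) = lastᵛ-⊕ (x' ∷ u) (y' ∷ v)

    initᵛ-⊕ : ∀ {n} (u v : Vec Carrier (suc n)) → initᵛ (u ⊕ v) ≡ initᵛ u ⊕ initᵛ v
    initᵛ-⊕ (x ∷ []) (y ∷ []) = refl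
    initᵛ-⊕ (x ∷ x' ∷ u) (y ∷ y' ∷ v) = cong (x + y ∷_) (initᵛ-⊕ (x' ∷ u) (y' ∷ v))

    lastᵛ-⊙ : ∀ {n} c (v : Vec Carrier (suc n)) → lastᵛ (c ⊙ v) ≡ c * lastᵛ v
    lastᵛ-⊙ c (y ∷ []) = refl
    lastᵛ-⊙ c (y ∷ y' ∷ v) = lastᵛ-⊙ c (y' ∷ v)

    initᵛ-⊙ : ∀ {n} c (v : Vec Carrier (suc n)) → initᵛ (c ⊙ v) ≡ c ⊙ initᵛ v
    initᵛ-⊙ c (y ∷ []) = refl
    initᵛ-⊙ c (y ∷ y' ∷ v) = cong (c * y ∷_) (initᵛ-⊙ c (y' ∷ v))

    shift : V → V
    shift v = lastᵛ v ⊙ r ⊕ (0# ∷ initᵛ v)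

    shift-⊕ : ∀ u v → shift (u ⊕ v) ≡ shift u ⊕ shift v
    shift-⊕ u v = begin
      lastᵛ (u ⊕ v) ⊙ r ⊕ (0# ∷ initᵛ (u ⊕ v))
        ≡⟨ cong₂ (λ a b → a ⊙ r ⊕ (0# ∷ b)) (lastᵛ-⊕ u v) (initᵛ-⊕ u v) ⟩
      (lastᵛ u + lastᵛ v) ⊙ r ⊕ (0# ∷ initᵛ u ⊕ initᵛ v)
        ≡⟨ cong₂ _⊕_ (⊙-distribʳ (lastᵛ u) (lastᵛ v) r) (cong (_∷ (initᵛ u ⊕ initᵛ v)) (sym (+-identityˡ 0#))) ⟩
      (lastᵛ u ⊙ r ⊕ lastᵛ v ⊙ r) ⊕ ((0# ∷ initᵛ u) ⊕ (0# ∷ initᵛ v))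
        ≡⟨ ⊕-interchange (lastᵛ u ⊙ r) (lastᵛ v ⊙ r) (0# ∷ initᵛ u) (0# ∷ initᵛ v) ⟩
      shift u ⊕ shift v ∎
      where open ≡-Reasoning

    shift-⊙ : ∀ c v → shift (c ⊙ v) ≡ c ⊙ shift v
    shift-⊙ c v = begin
      lastᵛ (c ⊙ v) ⊙ r ⊕ (0# ∷ initᵛ (c ⊙ v)) ≡⟨ cong₂ (λ a b → a ⊙ r ⊕ (0# ∷ b)) (lastᵛ-⊙ c v) (initᵛ-⊙ c v) ⟩
      (c * lastᵛ v) ⊙ r ⊕ (0# ∷ c ⊙ initᵛ v)
        ≡⟨ cong₂ _⊕_ (⊙-assoc c (lastᵛ v) r) (cong (_∷ (c ⊙ initᵛ v)) (sym (zeroʳ c))) ⟩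
      c ⊙ lastᵛ v ⊙ r ⊕ c ⊙ (0# ∷ initᵛ v)      ≡⟨ ⊙-distribˡ c (lastᵛ v ⊙ r) (0# ∷ initᵛ v) ⟨
      c ⊙ shift v ∎
      where open ≡-Reasoning

    -- Polynomials of every length act, so that relations whose degree reaches or exceeds that of
    -- the modulus, such as X^Q - X, can be written as operators.
    act : ∀ {k} → Vec Carrier k → V → V
    act [] v = zeros (suc m)
    act (c ∷ cs) v = c ⊙ v ⊕ act cs (shift v)

    act-⊕ : ∀ {k} (cs : Vec Carrier k) u v → act cs (u ⊕ v) ≡ act cs u ⊕ act cs v
    act-⊕ [] u v = sym (⊕-identityˡ _)
    act-⊕ (c ∷ cs) u v = begin
      c ⊙ (u ⊕ v) ⊕ act cs (shift (u ⊕ v))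
        ≡⟨ cong₂ _⊕_ (⊙-distribˡ c u v) (trans (cong (act cs) (shift-⊕ u v)) (act-⊕ cs (shift u) (shift v))) ⟩
      (c ⊙ u ⊕ c ⊙ v) ⊕ (act cs (shift u) ⊕ act cs (shift v)) ≡⟨ ⊕-interchange _ _ _ _ ⟩
      _ ∎
      where open ≡-Reasoning

    act-⊙ : ∀ {k} (cs : Vec Carrier k) s v → act cs (s ⊙ v) ≡ s ⊙ act cs v
    act-⊙ [] s v = sym (⊙-zeroʳ s)
    act-⊙ (c ∷ cs) s v = trans
      (cong₂ _⊕_ (⊙-swap c s v) (trans (cong (act cs) (shift-⊙ s v)) (act-⊙ cs s (shift v))))
      (sym (⊙-distribˡ s (c ⊙ v) (act cs (shift v))))

    act-zeros : ∀ {k} (cs : Vec Carrier k) → act cs (zeros (suc m)) ≡ zeros (suc m)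
    act-zeros cs = trans (cong (act cs) (sym (⊙-zeroˡ (zeros (suc m))))) (trans (act-⊙ cs 0# _) (⊙-zeroˡ _))

    ⊕-act : ∀ {k} (cs ds : Vec Carrier k) v → act (cs ⊕ ds) v ≡ act cs v ⊕ act ds v
    ⊕-act [] [] v = sym (⊕-identityˡ _)
    ⊕-act (c ∷ cs) (d ∷ ds) v = trans (cong₂ _⊕_ (⊙-distribʳ c d v) (⊕-act cs ds (shift v))) (⊕-interchange _ _ _ _)

    ⊙-act : ∀ {k} s (cs : Vec Carrier k) v → act (s ⊙ cs) v ≡ s ⊙ act cs v
    ⊙-act s [] v = sym (⊙-zeroʳ s)
    ⊙-act s (c ∷ cs) v = trans (cong₂ _⊕_ (⊙-assoc s c v) (⊙-act s cs (shift v))) (sym (⊙-distribˡ s _ _))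

    zeros-act : ∀ k v → act (zeros k) v ≡ zeros (suc m)
    zeros-act k v = trans (cong (λ w → act w v) (sym (⊙-zeroˡ (zeros k)))) (trans (⊙-act 0# (zeros k) v) (⊙-zeroˡ _))

    ⊝-act : ∀ {k} (cs : Vec Carrier k) v → act (⊝ cs) v ≡ ⊝ act cs v
    ⊝-act cs v = trans (cong (λ w → act w v) (⊝≡-1⊙ cs)) (trans (⊙-act (- 1#) cs v) (sym (⊝≡-1⊙ _)))

    act-shift : ∀ {k} (cs : Vec Carrier k) v → act cs (shift v) ≡ shift (act cs v)
    act-shift [] v = sym (trans (cong shift (sym (⊙-zeroˡ (zeros (suc m))))) (trans (shift-⊙ 0# _) (⊙-zeroˡ _)))
    act-shift (c ∷ cs) v = trans (cong₂ _⊕_ (sym (shift-⊙ c v)) (act-shift cs (shift v))) (sym (shift-⊕ _ _))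

    act-comm : ∀ {k l} (cs : Vec Carrier k) (ds : Vec Carrier l) v → act cs (act ds v) ≡ act ds (act cs v)
    act-comm [] ds v = sym (act-zeros ds)
    act-comm (c ∷ cs) ds v = begin
      c ⊙ act ds v ⊕ act cs (shift (act ds v)) ≡⟨ cong₂ _⊕_ (sym (act-⊙ ds c v)) (cong (act cs) (sym (act-shift ds v))) ⟩
      act ds (c ⊙ v) ⊕ act cs (act ds (shift v)) ≡⟨ cong (act ds (c ⊙ v) ⊕_) (act-comm cs ds (shift v)) ⟩
      act ds (c ⊙ v) ⊕ act ds (act cs (shift v)) ≡⟨ act-⊕ ds _ _ ⟨
      act ds (c ⊙ v ⊕ act cs (shift v))          ∎
      where open ≡-Reasoning

    one : V
    one = 1# ∷ zeros m

    pad : ∀ {k} n → Vec Carrier k → Vec Carrier n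
    pad zero v = []
    pad (suc n) [] = 0# ∷ pad n []
    pad (suc n) (x ∷ v) = x ∷ pad n v

    pad-id : ∀ {n} (v : Vec Carrier n) → pad n v ≡ v
    pad-id [] = refl
    pad-id (x ∷ v) = cong (x ∷_) (pad-id v)

    pad-[] : ∀ n → pad n [] ≡ zeros n
    pad-[] zero = refl
    pad-[] (suc n) = cong (0# ∷_) (pad-[] n)

    initᵛ-pad : ∀ {k} n (v : Vec Carrier k) → initᵛ (pad (suc n) v) ≡ pad n v
    initᵛ-pad zero [] = refl
    initᵛ-pad zero (x ∷ v) = refl
    initᵛ-pad (suc n) [] = cong (0# ∷_) (initᵛ-pad n [])
    initᵛ-pad (suc n) (x ∷ []) = cong (x ∷_) (initᵛ-pad n [])
    initᵛ-pad (suc n) (x ∷ y ∷ v) = cong (x ∷_) (initᵛ-pad n (y ∷ v))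

    lastᵛ-pad : ∀ {k} n (v : Vec Carrier k) → k ℕ.≤ n → lastᵛ (pad (suc n) v) ≡ 0#
    lastᵛ-pad zero [] _ = refl
    lastᵛ-pad (suc n) [] _ = lastᵛ-pad n [] z≤n
    lastᵛ-pad (suc n) (x ∷ v) (s≤s l) with v
    ... | [] = lastᵛ-pad n [] l
    ... | y ∷ w = lastᵛ-pad n (y ∷ w) l

    -- Below the degree of the modulus `shift` does not overflow: the last entry of the padded
    -- vector is 0, so `r` never enters.
    act-one-pad : ∀ {k} (cs : Vec Carrier k) → k ℕ.≤ suc m → act cs one ≡ pad (suc m) cs
    act-one-pad [] _ = sym (pad-[] (suc m))
    act-one-pad (c ∷ cs) (s≤s l) = begin
      c ⊙ one ⊕ act cs (shift one)
        ≡⟨ cong (c ⊙ one ⊕_) (trans (act-shift cs one) (cong shift (act-one-pad cs (ℕₚ.m≤n⇒m≤1+n l)))) ⟩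
      c ⊙ one ⊕ (lastᵛ (pad (suc m) cs) ⊙ r ⊕ (0# ∷ initᵛ (pad (suc m) cs)))
        ≡⟨ cong₂ (λ a b → c ⊙ one ⊕ (a ⊙ r ⊕ (0# ∷ b))) (lastᵛ-pad m cs l) (initᵛ-pad m cs) ⟩
      c ⊙ one ⊕ (0# ⊙ r ⊕ (0# ∷ pad m cs))
        ≡⟨ cong (c ⊙ one ⊕_) (trans (cong (_⊕ (0# ∷ pad m cs)) (⊙-zeroˡ r)) (⊕-identityˡ _)) ⟩
      c ⊙ one ⊕ (0# ∷ pad m cs)
        ≡⟨ cong₂ _∷_ (trans (+-identityʳ _) (*-identityʳ c)) (trans (cong (_⊕ pad m cs) (⊙-zeroʳ c)) (⊕-identityˡ _)) ⟩
      c ∷ pad m cs ∎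
      where open ≡-Reasoning

    act-one : ∀ (v : V) → act v one ≡ v
    act-one v = trans (act-one-pad v ℕₚ.≤-refl) (pad-id v)

    act-one-injective : ∀ {k} (cs : Vec Carrier k) → k ℕ.≤ suc m → act cs one ≡ zeros (suc m) → cs ≡ zeros k
    act-one-injective cs l e = go (suc m) cs l (trans (sym (act-one-pad cs l)) e)
      where
      go : ∀ {k} n (cs : Vec Carrier k) → k ℕ.≤ n → pad n cs ≡ zeros n → cs ≡ zeros k
      go n [] l e = refl
      go (suc n) (c ∷ cs) (s≤s l) e = cong₂ _∷_ (cong Vec.head e) (go n cs l (cong Vec.tail e))

    infixl 7 _⊛_
    _⊛_ : V → V → V
    a ⊛ b = act a b

    ⊛-comm : ∀ a b → a ⊛ b ≡ b ⊛ a
    ⊛-comm a b = begin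
      act a b           ≡⟨ cong (act a) (act-one b) ⟨
      act a (act b one) ≡⟨ act-comm a b one ⟩
      act b (act a one) ≡⟨ cong (act b) (act-one a) ⟩
      act b a           ∎
      where open ≡-Reasoning

    ⊛-assoc : ∀ a b c → (a ⊛ b) ⊛ c ≡ a ⊛ (b ⊛ c)
    ⊛-assoc a b c = begin
      (a ⊛ b) ⊛ c ≡⟨ ⊛-comm (a ⊛ b) c ⟩
      c ⊛ (a ⊛ b) ≡⟨ act-comm c a b ⟩
      a ⊛ (c ⊛ b) ≡⟨ cong (a ⊛_) (⊛-comm c b) ⟩
      a ⊛ (b ⊛ c) ∎
      where open ≡-Reasoning

    ⊛-identityˡ : ∀ a → one ⊛ a ≡ a
    ⊛-identityˡ a = trans (⊛-comm one a) (act-one a)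

    ⊛-isCommutativeRing : IsCommutativeRing _≡_ _⊕_ _⊛_ ⊝_ (zeros (suc m)) one
    ⊛-isCommutativeRing = record
      { isRing = record
        { +-isAbelianGroup = record
          { isGroup = record
            { isMonoid = record
              { isSemigroup = record { isMagma = record { isEquivalence = ≡.isEquivalence ; ∙-cong = cong₂ _⊕_ } ; assoc = ⊕-assoc }
              ; identity = ⊕-identityˡ , ⊕-identityʳ }
            ; inverse = ⊝-inverseˡ , ⊝-inverseʳ
            ; ⁻¹-cong = cong ⊝_ }
          ; comm = ⊕-comm }
        ; *-cong = cong₂ _⊛_
        ; *-assoc = ⊛-assoc
        ; *-identity = ⊛-identityˡ , act-one
        ; distrib = (λ a b c → act-⊕ a b c) , (λ a b c → ⊕-act b c a) }
      ; *-comm = ⊛-comm }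

    companionRing : CommutativeRing 0ℓ 0ℓ
    companionRing = record { isCommutativeRing = ⊛-isCommutativeRing }

    open import Algebra.Properties.CommutativeSemiring.Exp (CommutativeRing.commutativeSemiring companionRing) public
      using () renaming (_^_ to _⋆_; ^-homo-* to ⋆-homo-⊛; ^-assocʳ to ⋆-assocʳ; ^-distrib-* to ⋆-distrib-⊛)

    act≡⊛ : ∀ {k} (cs : Vec Carrier k) v → act cs v ≡ act cs one ⊛ v
    act≡⊛ cs v = begin
      act cs v           ≡⟨ cong (act cs) (act-one v) ⟨
      act cs (act v one) ≡⟨ act-comm cs v one ⟩
      v ⊛ act cs one     ≡⟨ ⊛-comm v _ ⟩
      act cs one ⊛ v     ∎
      where open ≡-Reasoning

    shift≡⊛ : ∀ v → shift v ≡ shift one ⊛ v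
    shift≡⊛ v = begin
      shift v           ≡⟨ cong shift (act-one v) ⟨
      shift (act v one) ≡⟨ act-shift v one ⟨
      v ⊛ shift one     ≡⟨ ⊛-comm v _ ⟩
      shift one ⊛ v     ∎
      where open ≡-Reasoning

    shift^ : ℕ → V → V
    shift^ zero v = v
    shift^ (suc k) v = shift (shift^ k v)

    shift^-shift : ∀ k v → shift^ k (shift v) ≡ shift^ (suc k) v
    shift^-shift zero v = refl
    shift^-shift (suc k) v = cong shift (shift^-shift k v)

    X : V
    X = shift one

    shift^≡⊛ : ∀ k v → shift^ k v ≡ (X ⋆ k) ⊛ v
    shift^≡⊛ zero v = sym (⊛-identityˡ v)
    shift^≡⊛ (suc k) v = begin
      shift (shift^ k v)  ≡⟨ shift≡⊛ _ ⟩
      X ⊛ shift^ k v      ≡⟨ cong (X ⊛_) (shift^≡⊛ k v) ⟩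
      X ⊛ ((X ⋆ k) ⊛ v)   ≡⟨ ⊛-assoc X (X ⋆ k) v ⟨
      (X ⋆ suc k) ⊛ v     ∎
      where open ≡-Reasoning

    act-∷ʳ : ∀ {k} (cs : Vec Carrier k) c v → act (cs ∷ʳ c) v ≡ act cs v ⊕ c ⊙ shift^ k v
    act-∷ʳ [] c v = trans (⊕-identityʳ _) (sym (⊕-identityˡ _))
    act-∷ʳ {suc k} (d ∷ cs) c v = begin
      d ⊙ v ⊕ act (cs ∷ʳ c) (shift v)                      ≡⟨ cong (d ⊙ v ⊕_) (act-∷ʳ cs c (shift v)) ⟩
      d ⊙ v ⊕ (act cs (shift v) ⊕ c ⊙ shift^ k (shift v))  ≡⟨ ⊕-assoc (d ⊙ v) _ _ ⟨
      d ⊙ v ⊕ act cs (shift v) ⊕ c ⊙ shift^ k (shift v) ≡⟨ cong (λ w → d ⊙ v ⊕ act cs (shift v) ⊕ c ⊙ w) (shift^-shift k v) ⟩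
      d ⊙ v ⊕ act cs (shift v) ⊕ c ⊙ shift^ (suc k) v      ∎
      where open ≡-Reasoning

    ⊙≡⊛ : ∀ c v → c ⊙ v ≡ (c ⊙ one) ⊛ v
    ⊙≡⊛ c v = sym (trans (⊛-comm (c ⊙ one) v) (trans (act-⊙ v c one) (cong (c ⊙_) (act-one v))))

    ⊙one-⋆ : ∀ c k → (c ⊙ one) ⋆ k ≡ (c ^ k) ⊙ one
    ⊙one-⋆ c zero = sym (⊙-identity one)
    ⊙one-⋆ c (suc k) = begin
      (c ⊙ one) ⊛ ((c ⊙ one) ⋆ k) ≡⟨ ⊙≡⊛ c _ ⟨
      c ⊙ ((c ⊙ one) ⋆ k)         ≡⟨ cong (c ⊙_) (⊙one-⋆ c k) ⟩
      c ⊙ (c ^ k) ⊙ one           ≡⟨ ⊙-assoc c (c ^ k) one ⟨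
      (c ^ suc k) ⊙ one           ∎
      where open ≡-Reasoning

    fermat^ : ∀ c n → c ^ (card ℕ.^ n) ≡ c
    fermat^ c zero = *-identityʳ c
    fermat^ c (suc n) = trans (sym (^-assocʳ c card (card ℕ.^ n))) (trans (cong (_^ (card ℕ.^ n)) (fermat c)) (fermat^ c n))

    open Frobenius.Additive F companionRing (_⊙ one) (λ c d → ⊙-distribʳ c d one) (⊙-zeroˡ one) (⊙-identity one)
      using (frobenius^)

    -- The Q-th power map is an F-algebra endomorphism, so it is the identity if it fixes the generator X.
    power-fixes-all : ∀ n → X ⋆ (card ℕ.^ n) ≡ X → ∀ a → a ⋆ (card ℕ.^ n) ≡ a
    power-fixes-all n fix a = subst (λ v → v ⋆ Q ≡ v) (act-one a) (go a)
      where
      open ≡-Reasoning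
      Q = card ℕ.^ n
      0⋆ : ∀ k → 1 ℕ.≤ k → zeros (suc m) ⋆ k ≡ zeros (suc m)
      0⋆ (suc k) _ = zeros-act (suc m) _
      go : ∀ {k} (cs : Vec Carrier k) → act cs one ⋆ Q ≡ act cs one
      go [] = 0⋆ Q (ℕₚ.m^n>0 card {{ℕ.>-nonZero (ℕₚ.≤-trans (s≤s z≤n) card≥2)}} n)
      go (c ∷ cs) = begin
        (c ⊙ one ⊕ act cs (shift one)) ⋆ Q           ≡⟨ cong (λ w → (c ⊙ one ⊕ w) ⋆ Q) step ⟩
        (c ⊙ one ⊕ X ⊛ act cs one) ⋆ Q               ≡⟨ frobenius^ n (c ⊙ one) _ ⟩
        (c ⊙ one) ⋆ Q ⊕ (X ⊛ act cs one) ⋆ Q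
          ≡⟨ cong₂ _⊕_ (trans (⊙one-⋆ c Q) (cong (_⊙ one) (fermat^ c n))) (⋆-distrib-⊛ X (act cs one) Q) ⟩
        c ⊙ one ⊕ (X ⋆ Q) ⊛ (act cs one ⋆ Q)         ≡⟨ cong (c ⊙ one ⊕_) (cong₂ _⊛_ fix (go cs)) ⟩
        c ⊙ one ⊕ X ⊛ act cs one                     ≡⟨ cong (c ⊙ one ⊕_) step ⟨
        c ⊙ one ⊕ act cs (shift one)                 ∎
        where
        step : act cs (shift one) ≡ X ⊛ act cs one
        step = trans (act-shift cs one) (shift≡⊛ _)

    companionField : (∀ a → a ≢ zeros (suc m) → ∃ λ b → a ⊛ b ≡ one) → FiniteField
    companionField inv = record
      { Carrier = V ; _+_ = _⊕_ ; _*_ = _⊛_ ; -_ = ⊝_ ; 0# = zeros (suc m) ; 1# = one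
      ; isCommutativeRing = ⊛-isCommutativeRing
      ; 0≢1 = λ e → 0≢1 (cong Vec.head e)
      ; inverse = inv
      ; _≟_ = _≟ᵛ_
      ; elems = allVecs F (suc m)
      ; complete = Listing.complete (vecListing (suc m))
      ; unique = Listing.unique (vecListing (suc m)) }

-- Extension fields of every degree, by primitive idempotents.

module ExtensionField where

  open FiniteSums
  open FieldTheory
  open Vectors
  open CompanionRing

  module Idempotents {C : Set} {_⊛_ : C → C → C} {one : C} (isCM : IsCommutativeMonoid _≡_ _⊛_ one)
    (𝟎 : C) (⊛-zeroʳ : ∀ a → a ⊛ 𝟎 ≡ 𝟎) (_≟_ : DecidableEquality C)
    (idem : C → C) (a⊛idem : ∀ a → a ⊛ idem a ≡ a) (idem-idem : ∀ a → idem a ⊛ idem a ≡ idem a) where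

    open IsCommutativeMonoid isCM using (assoc; comm)
    open BigOp isCM using (interchange)

    -- Either e kills a, or e lies below the idempotent of a, in which case a acts invertibly on the
    -- ideal of e. If this holds for all a, the ideal of e is a field.
    Splits : C → C → Set
    Splits e a = e ⊛ a ≡ 𝟎 ⊎ e ⊛ idem a ≡ e

    swapʳ : ∀ a b c → (a ⊛ b) ⊛ c ≡ (a ⊛ c) ⊛ b
    swapʳ a b c = trans (assoc a b c) (trans (cong (a ⊛_) (comm b c)) (sym (assoc a c b)))

    -- Greedy descent: e is replaced by e · idem a unless that product is 0. If it is 0, then ea =
    -- ea · idem a = 0. The condition e'e = e' says that e' lies below e, so decisions already taken
    -- for earlier a survive all later replacements.
    refine : ∀ (as : List C) e → e ≢ 𝟎 → e ⊛ e ≡ e →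
      ∃ λ e' → e' ≢ 𝟎 × e' ⊛ e' ≡ e' × e' ⊛ e ≡ e' × All (Splits e') as
    refine [] e e≢0 ee = e , e≢0 , ee , ee , []
    refine (a ∷ as) e e≢0 ee with (e ⊛ idem a) ≟ 𝟎
    ... | yes z with refine as e e≢0 ee
    ...   | e' , e'≢0 , e'e' , e'e , splits = e' , e'≢0 , e'e' , e'e , inj₁ kill ∷ splits
      where
      open ≡-Reasoning
      kill : e' ⊛ a ≡ 𝟎
      kill = begin
        e' ⊛ a                         ≡⟨ cong₂ _⊛_ e'e (a⊛idem a) ⟨
        (e' ⊛ e) ⊛ (a ⊛ idem a)        ≡⟨ interchange e' e a (idem a) ⟩
        (e' ⊛ a) ⊛ (e ⊛ idem a)        ≡⟨ cong ((e' ⊛ a) ⊛_) z ⟩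
        (e' ⊛ a) ⊛ 𝟎                   ≡⟨ ⊛-zeroʳ _ ⟩
        𝟎                              ∎
    refine (a ∷ as) e e≢0 ee | no nz with refine as (e ⊛ idem a) nz idem₁
      where
      open ≡-Reasoning
      idem₁ : (e ⊛ idem a) ⊛ (e ⊛ idem a) ≡ e ⊛ idem a
      idem₁ = trans (interchange e (idem a) e (idem a)) (cong₂ _⊛_ ee (idem-idem a))
    ...   | e' , e'≢0 , e'e' , e'e₁ , splits = e' , e'≢0 , e'e' , e'e , inj₂ e'u ∷ splits
      where
      open ≡-Reasoning
      u = idem a
      e'e : e' ⊛ e ≡ e'
      e'e = begin
        e' ⊛ e             ≡⟨ cong (_⊛ e) e'e₁ ⟨
        (e' ⊛ (e ⊛ u)) ⊛ e   ≡⟨ trans (assoc e' (e ⊛ u) e) (cong (e' ⊛_) (swapʳ e u e)) ⟩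
        e' ⊛ ((e ⊛ e) ⊛ u) ≡⟨ cong (λ w → e' ⊛ (w ⊛ u)) ee ⟩
        e' ⊛ (e ⊛ u)       ≡⟨ e'e₁ ⟩
        e'                 ∎
      e'u : e' ⊛ u ≡ e'
      e'u = begin
        e' ⊛ u             ≡⟨ cong (_⊛ u) e'e₁ ⟨
        (e' ⊛ (e ⊛ u)) ⊛ u   ≡⟨ trans (assoc e' (e ⊛ u) u) (cong (e' ⊛_) (assoc e u u)) ⟩
        e' ⊛ (e ⊛ (u ⊛ u)) ≡⟨ cong (λ w → e' ⊛ (e ⊛ w)) (idem-idem a) ⟩
        e' ⊛ (e ⊛ u)       ≡⟨ e'e₁ ⟩
        e'                 ∎

  -- F[X]/(X^(n+1) - r(X)) is a field for some r.
  HasFieldOfDegree : FiniteField → ℕ → Set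
  HasFieldOfDegree F n = ∃ λ (r : Vec (FiniteField.Carrier F) (suc n)) → let open Companion F n r in
    ∀ a → a ≢ Field.zeros F (suc n) → ∃ λ b → a ⊛ b ≡ one

  -- A = F[X]/(X^Q - X) with Q = q^(n+1) = p + 2.  Every a ∈ A satisfies a^Q = a, so a^(Q-1) is idempotent.
  -- Below the idempotent of gap n = ∏_{1≤d≤n} (X^(q^d) - X) ≠ 0 there is a primitive idempotent e;
  -- the field eA is generated by eX, has at most Q elements, and eX lies in no smaller field F_{q^d}.
  module Extension (F : FiniteField) (n p : ℕ) (Q≡ : FiniteField.card F ℕ.^ suc n ≡ suc (suc p)) where

    open Field F
    open VectorSpace F

    HasField : ℕ → Set
    HasField = HasFieldOfDegree F

    Q : ℕ
    Q = card ℕ.^ suc n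

    module A = Companion F (suc p) (0# ∷ 1# ∷ zeros p)
    open A using (V; act; shift; shift^; one; _⊛_; _⋆_; X)

    𝟎 : V
    𝟎 = zeros (suc (suc p))

    lastᵛ-zeros : ∀ k → lastᵛ (zeros (suc k)) ≡ 0#
    lastᵛ-zeros zero = refl
    lastᵛ-zeros (suc k) = lastᵛ-zeros k

    initᵛ-zeros : ∀ k → initᵛ (zeros (suc k)) ≡ zeros k
    initᵛ-zeros zero = refl
    initᵛ-zeros (suc k) = cong (0# ∷_) (initᵛ-zeros k)

    act-monomial : ∀ k v → act (zeros k ∷ʳ 1#) v ≡ shift^ k v
    act-monomial k v = trans (A.act-∷ʳ (zeros k) 1# v)
      (trans (cong₂ _⊕_ (A.zeros-act k v) (⊙-identity _)) (⊕-identityˡ _))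

    -- X^(Q-1) is the last basis vector, and one more shift overflows into the vector
    -- `0# ∷ 1# ∷ zeros p`, which is X.
    shift^Q-one : shift^ (suc (suc p)) one ≡ shift one
    shift^Q-one = trans (cong shift (trans (sym (act-monomial (suc p) one)) (A.act-one (zeros (suc p) ∷ʳ 1#)))) (trans top (sym bottom))
      where
      top : shift (zeros (suc p) ∷ʳ 1#) ≡ 0# ∷ 1# ∷ zeros p
      top = trans (cong₂ (λ a b → a ⊙ (0# ∷ 1# ∷ zeros p) ⊕ (0# ∷ b)) (lastᵛ-∷ʳ (zeros (suc p)) 1#) (initᵛ-∷ʳ (zeros (suc p)) 1#))
        (trans (cong (_⊕ 𝟎) (⊙-identity (0# ∷ 1# ∷ zeros p))) (⊕-identityʳ (0# ∷ 1# ∷ zeros p)))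
      bottom : shift one ≡ 0# ∷ 1# ∷ zeros p
      bottom = trans (cong₂ (λ a b → a ⊙ (0# ∷ 1# ∷ zeros p) ⊕ (0# ∷ 1# ∷ b)) (lastᵛ-zeros p) (initᵛ-zeros p))
        (trans (cong (_⊕ (0# ∷ 1# ∷ zeros p)) (⊙-zeroˡ (0# ∷ 1# ∷ zeros p))) (⊕-identityˡ (0# ∷ 1# ∷ zeros p)))

    X⋆≡shift^ : ∀ k → X ⋆ k ≡ shift^ k one
    X⋆≡shift^ k = sym (trans (A.shift^≡⊛ k one) (A.act-one _))

    -- Frobenius is an F-algebra endomorphism, so X^Q = X on the generator spreads to the whole of
    -- A.
    power-identity : ∀ a → a ⋆ suc (suc p) ≡ a
    power-identity a = subst (λ k → a ⋆ k ≡ a) Q≡ (A.power-fixes-all (suc n) fix a)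
      where
      fix : X ⋆ Q ≡ X
      fix = subst (λ k → X ⋆ k ≡ X) (sym Q≡) (trans (X⋆≡shift^ (suc (suc p))) shift^Q-one)

    shift^Q : ∀ v → shift^ (suc (suc p)) v ≡ shift v
    shift^Q v = trans (A.shift^≡⊛ (suc (suc p)) v) (trans (cong (_⊛ v) (power-identity X)) (sym (A.shift≡⊛ v)))

    shift-⊝ : ∀ v → shift (⊝ v) ≡ ⊝ shift v
    shift-⊝ v = trans (cong shift (⊝≡-1⊙ v)) (trans (A.shift-⊙ (- 1#) v) (sym (⊝≡-1⊙ _)))

    -- Being a polynomial of degree below k in X. Degree is a matter of having such an expression,
    -- since an element of A has no intrinsic degree while reductions are possible; `Monic` adds the
    -- leading term X^k.
    Low : ℕ → V → Set
    Low k v = ∃ λ (cs : Vec Carrier k) → v ≡ act cs one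

    Monic : ℕ → V → Set
    Monic k v = Low k (v ⊕ ⊝ shift^ k one)

    low-⊕ : ∀ {k u v} → Low k u → Low k v → Low k (u ⊕ v)
    low-⊕ (cs , refl) (ds , refl) = cs ⊕ ds , sym (A.⊕-act cs ds one)

    low-⊝ : ∀ {k u} → Low k u → Low k (⊝ u)
    low-⊝ (cs , refl) = ⊝ cs , sym (A.⊝-act cs one)

    low-suc : ∀ {k u} → Low k u → Low (suc k) u
    low-suc (cs , refl) = cs ∷ʳ 0# , sym (trans (A.act-∷ʳ cs 0# one) (trans (cong (act cs one ⊕_) (⊙-zeroˡ _)) (⊕-identityʳ _)))

    low-≤ : ∀ {k l u} → k ℕ.≤ l → Low k u → Low l u
    low-≤ {k} {l} {u} k≤l low = subst (λ j → Low j u) (ℕₚ.m∸n+n≡m k≤l) (go (l ℕ.∸ k))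
      where
      go : ∀ j → Low (j ℕ.+ k) u
      go zero = low
      go (suc j) = low-suc (go j)

    low-shift : ∀ {k u} → Low k u → Low (suc k) (shift u)
    low-shift (cs , refl) = 0# ∷ cs , sym (trans (cong (_⊕ act cs (shift one)) (⊙-zeroˡ one)) (trans (⊕-identityˡ _) (A.act-shift cs one)))

    monic⇒low : ∀ {k v} → Monic k v → Low (suc k) v
    monic⇒low {k} {v} mon = subst (Low (suc k)) cancel
      (low-⊕ (low-suc mon) (zeros k ∷ʳ 1# , sym (act-monomial k one)))
      where
      cancel : v ⊕ ⊝ shift^ k one ⊕ shift^ k one ≡ v
      cancel = trans (⊕-assoc v _ _) (trans (cong (v ⊕_) (⊝-inverseˡ _)) (⊕-identityʳ v))

    monic-⊕-low : ∀ {k u v} → Monic k v → Low k u → Monic k (v ⊕ u)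
    monic-⊕-low {k} {u} {v} mon low = subst (Low k) swap (low-⊕ mon low)
      where
      swap : v ⊕ ⊝ shift^ k one ⊕ u ≡ v ⊕ u ⊕ ⊝ shift^ k one
      swap = trans (⊕-assoc v _ _) (trans (cong (v ⊕_) (⊕-comm _ u)) (sym (⊕-assoc v u _)))

    monic-shift^ : ∀ {k v} j → Monic k v → Monic (j ℕ.+ k) (shift^ j v)
    monic-shift^ zero mon = mon
    monic-shift^ {k} {v} (suc j) mon = subst (Low (suc (j ℕ.+ k)))
      (trans (A.shift-⊕ _ _) (cong (shift (shift^ j v) ⊕_) (shift-⊝ _))) (low-shift (monic-shift^ j mon))

    -- As k < Q, the powers 1, X, ..., X^k are linearly independent in A, so the leading coefficient
    -- 1 cannot cancel.
    monic⇒≢0 : ∀ {k v} → k ℕ.< suc (suc p) → Monic k v → v ≢ 𝟎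
    monic⇒≢0 {k} lt (cs , eq) refl = 0≢1 (begin
      0#                      ≡⟨ lastᵛ-zeros k ⟨
      lastᵛ (zeros (suc k))   ≡⟨ cong lastᵛ (A.act-one-injective (cs ∷ʳ 1#) lt vanish) ⟨
      lastᵛ (cs ∷ʳ 1#)        ≡⟨ lastᵛ-∷ʳ cs 1# ⟩
      1#                      ∎)
      where
      open ≡-Reasoning
      vanish : act (cs ∷ʳ 1#) one ≡ 𝟎
      vanish = begin
        act (cs ∷ʳ 1#) one                       ≡⟨ A.act-∷ʳ cs 1# one ⟩
        act cs one ⊕ 1# ⊙ shift^ k one           ≡⟨ cong₂ _⊕_ (sym eq) (⊙-identity _) ⟩
        𝟎 ⊕ ⊝ shift^ k one ⊕ shift^ k one        ≡⟨ cong (_⊕ shift^ k one) (⊕-identityˡ _) ⟩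
        ⊝ shift^ k one ⊕ shift^ k one            ≡⟨ ⊝-inverseˡ _ ⟩
        𝟎                                        ∎

    gap : ℕ → V
    gap zero = one
    gap (suc j) = shift^ (card ℕ.^ suc j) (gap j) ⊕ ⊝ shift (gap j)

    gapDegree : ℕ → ℕ
    gapDegree zero = 0
    gapDegree (suc j) = card ℕ.^ suc j ℕ.+ gapDegree j

    instance
      card-nonZero : ℕ.NonZero card
      card-nonZero = ℕ.>-nonZero (ℕₚ.≤-trans (s≤s z≤n) card≥2)

    2≤card^suc : ∀ j → 2 ℕ.≤ card ℕ.^ suc j
    2≤card^suc j = ℕₚ.≤-trans card≥2 (ℕₚ.m≤m*n card (card ℕ.^ j) {{ℕₚ.m^n≢0 card j}})

    -- q + ... + q^j < 2q^j ≤ q^(j+1) for j ≥ 1. The product of the X^(q^d) - X over d ≤ n thus has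
    -- degree below Q and survives reduction modulo X^Q - X.
    gapDegree< : ∀ j → gapDegree j ℕ.< card ℕ.^ suc j
    gapDegree< zero = ℕₚ.≤-trans (s≤s z≤n) (2≤card^suc 0)
    gapDegree< (suc j) = begin-strict
      c ℕ.+ gapDegree j   <⟨ ℕₚ.+-monoʳ-< c (gapDegree< j) ⟩
      c ℕ.+ c             ≡⟨ cong (c ℕ.+_) (ℕₚ.+-identityʳ c) ⟨
      2 ℕ.* c             ≤⟨ ℕₚ.*-monoˡ-≤ c card≥2 ⟩
      card ℕ.* c          ∎
      where
      open ℕₚ.≤-Reasoning
      c = card ℕ.^ suc j

    gap-monic : ∀ j → Monic (gapDegree j) (gap j)
    gap-monic zero = [] , ⊝-inverseʳ one
    gap-monic (suc j) = monic-⊕-low (monic-shift^ (card ℕ.^ suc j) (gap-monic j))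
      (low-⊝ (low-≤ (ℕₚ.+-monoˡ-≤ (gapDegree j) (2≤card^suc j)) (low-shift (monic⇒low (gap-monic j)))))

    gap≢0 : gap n ≢ 𝟎
    gap≢0 = monic⇒≢0 (subst (gapDegree n ℕ.<_) Q≡ (gapDegree< n)) (gap-monic n)

    idem : V → V
    idem a = a ⋆ suc p

    a⊛idem : ∀ a → a ⊛ idem a ≡ a
    a⊛idem = power-identity

    idem-idem : ∀ a → idem a ⊛ idem a ≡ idem a
    idem-idem a = begin
      (a ⊛ (a ⋆ p)) ⊛ idem a ≡⟨ trans (A.⊛-assoc a (a ⋆ p) (idem a)) (trans (cong (a ⊛_) (A.⊛-comm (a ⋆ p) (idem a))) (sym (A.⊛-assoc a (idem a) (a ⋆ p)))) ⟩
      (a ⊛ idem a) ⊛ (a ⋆ p)   ≡⟨ cong (_⊛ (a ⋆ p)) (a⊛idem a) ⟩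
      a ⊛ (a ⋆ p)              ∎
      where open ≡-Reasoning

    ⊛-zeroʳ : ∀ a → a ⊛ 𝟎 ≡ 𝟎
    ⊛-zeroʳ a = A.act-zeros a

    ⊛-zeroˡ : ∀ a → 𝟎 ⊛ a ≡ 𝟎
    ⊛-zeroˡ a = A.zeros-act (suc (suc p)) a

    open Idempotents (CommutativeRing.*-isCommutativeMonoid A.companionRing) 𝟎 ⊛-zeroʳ _≟ᵛ_ idem a⊛idem idem-idem
      using (Splits; refine)

    module Primitive (e : V) (e≢0 : e ≢ 𝟎) (e⊛e : e ⊛ e ≡ e) (e≤gap : e ⊛ idem (gap n) ≡ e) (splits : ∀ a → Splits e a) where

      -- Linear independence of e, Xe, ..., X^(k-1)e; the largest such k is the dimension of eA.
      Independent : ℕ → Set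
      Independent k = ∀ (cs : Vec Carrier k) → act cs e ≡ 𝟎 → cs ≡ zeros k

      Relation : ℕ → Set
      Relation k = ∃ λ (cs : Vec Carrier k) → cs ≢ zeros k × act cs e ≡ 𝟎

      independent? : ∀ k → Independent k ⊎ Relation k
      independent? k with search (allVecs F k)
        where
        search : ∀ cs → All (λ c → act c e ≡ 𝟎 → c ≡ zeros k) cs ⊎ Relation k
        search [] = inj₁ []
        search (c ∷ cs) with act c e ≟ᵛ 𝟎 | c ≟ᵛ zeros k | search cs
        ... | _ | _ | inj₂ rel = inj₂ rel
        ... | yes z | no nz | _ = inj₂ (c , nz , z)
        ... | yes _ | yes z | inj₁ h = inj₁ ((λ _ → z) ∷ h)
        ... | no nz | _ | inj₁ h = inj₁ ((λ z → contradiction z nz) ∷ h)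
      ... | inj₁ h = inj₁ λ cs → All.lookup h (Listing.complete (vecListing k) cs)
      ... | inj₂ rel = inj₂ rel

      -- Upward search for the dimension of eA; the relation known at length j + k guarantees that
      -- it stops.
      first-relation : ∀ j k → Independent k → Relation (j ℕ.+ k) → ∃ λ d → Independent d × Relation (suc d)
      first-relation zero k ind (cs , nz , z) = contradiction (ind cs z) nz
      first-relation (suc j) k ind rel with independent? (suc k)
      ... | inj₁ ind' = first-relation j (suc k) ind' (subst Relation (sym (ℕₚ.+-suc j k)) rel)
      ... | inj₂ rel' = k , ind , rel'

      -- X^Q - X annihilates A. Its coefficient vector has length Q + 1 = p + 3, the starting bound
      -- of the search.
      relation-X^Q-X : Relation (suc (suc (suc p)))
      relation-X^Q-X = cs ∷ʳ 1# , (λ z → 0≢1 (trans (sym (lastᵛ-zeros (suc (suc p)))) (trans (cong lastᵛ (sym z)) (lastᵛ-∷ʳ cs 1#)))) , (begin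
        act (cs ∷ʳ 1#) e                                           ≡⟨ A.act-∷ʳ cs 1# e ⟩
        0# ⊙ e ⊕ ((- 1#) ⊙ shift e ⊕ act (zeros p) (shift (shift e))) ⊕ 1# ⊙ shift^ (suc (suc p)) e
          ≡⟨ cong₂ _⊕_ (cong₂ _⊕_ (⊙-zeroˡ e) (cong₂ _⊕_ (sym (⊝≡-1⊙ (shift e))) (A.zeros-act p _))) (trans (⊙-identity _) (shift^Q e)) ⟩
        𝟎 ⊕ (⊝ shift e ⊕ 𝟎) ⊕ shift e ≡⟨ cong (_⊕ shift e) (trans (⊕-identityˡ _) (⊕-identityʳ _)) ⟩
        ⊝ shift e ⊕ shift e           ≡⟨ ⊝-inverseˡ _ ⟩
        𝟎                             ∎)
        where
        open ≡-Reasoning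
        cs : Vec Carrier (suc (suc p))
        cs = 0# ∷ (- 1#) ∷ zeros p

      module Basis (d : ℕ) (ind : Independent (suc d)) (r : Vec Carrier (suc d)) (rel : shift^ (suc d) e ≡ act r e) where

        module K = Companion F d r

        -- The isomorphism of F[X]-modules from K = F[X]/(X^(d+1) - r) onto eA that sends 1 to e.
        φ : K.V → V
        φ c = act c e

        φ-injective : ∀ {a b} → φ a ≡ φ b → a ≡ b
        φ-injective {a} {b} h = u⊝v≡0⇒u≡v (ind (a ⊕ ⊝ b) (begin
          act (a ⊕ ⊝ b) e       ≡⟨ A.⊕-act a (⊝ b) e ⟩
          act a e ⊕ act (⊝ b) e ≡⟨ cong₂ _⊕_ h (A.⊝-act b e) ⟩
          act b e ⊕ ⊝ act b e   ≡⟨ ⊝-inverseʳ _ ⟩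
          𝟎                     ∎))
          where open ≡-Reasoning

        φ-one : φ K.one ≡ e
        φ-one = trans (cong₂ _⊕_ (⊙-identity e) (A.zeros-act d _)) (⊕-identityʳ e)

        -- An overflow in K is replaced by `r`, and `rel` makes the same replacement in eA.
        φ-shift : ∀ c → φ (K.shift c) ≡ shift (φ c)
        φ-shift c = begin
          act (lastᵛ c ⊙ r ⊕ (0# ∷ initᵛ c)) e                      ≡⟨ A.⊕-act (lastᵛ c ⊙ r) (0# ∷ initᵛ c) e ⟩
          act (lastᵛ c ⊙ r) e ⊕ (0# ⊙ e ⊕ act (initᵛ c) (shift e))
            ≡⟨ cong₂ _⊕_ (trans (A.⊙-act (lastᵛ c) r e) (cong (lastᵛ c ⊙_) (sym rel))) (trans (cong (_⊕ act (initᵛ c) (shift e)) (⊙-zeroˡ e)) (⊕-identityˡ (act (initᵛ c) (shift e)))) ⟩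
          lastᵛ c ⊙ shift^ (suc d) e ⊕ act (initᵛ c) (shift e)      ≡⟨ ⊕-comm _ _ ⟩
          act (initᵛ c) (shift e) ⊕ lastᵛ c ⊙ shift^ (suc d) e ≡⟨ cong (λ w → act (initᵛ c) (shift e) ⊕ lastᵛ c ⊙ w) (A.shift^-shift d e) ⟨
          act (initᵛ c) (shift e) ⊕ lastᵛ c ⊙ shift^ d (shift e)    ≡⟨ A.act-∷ʳ (initᵛ c) (lastᵛ c) (shift e) ⟨
          act (initᵛ c ∷ʳ lastᵛ c) (shift e)                        ≡⟨ cong (λ w → act w (shift e)) (initᵛ∷ʳlastᵛ c) ⟨
          act c (shift e)                                           ≡⟨ A.act-shift c e ⟩
          shift (act c e)                                           ∎
          where open ≡-Reasoning

        φ-act : ∀ {k} (as : Vec Carrier k) b → φ (K.act as b) ≡ act as (φ b)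
        φ-act [] b = A.zeros-act (suc d) e
        φ-act (a ∷ as) b = trans (A.⊕-act (a ⊙ b) (K.act as (K.shift b)) e)
          (cong₂ _⊕_ (A.⊙-act a b e) (trans (φ-act as (K.shift b)) (cong (act as) (φ-shift b))))

        φ-shift^ : ∀ k → φ (K.shift^ k K.one) ≡ shift^ k e
        φ-shift^ zero = φ-one
        φ-shift^ (suc k) = trans (φ-shift _) (cong shift (φ-shift^ k))

        φ-surjective : ∀ {k} (cs : Vec Carrier k) → ∃ λ b → φ b ≡ act cs e
        φ-surjective cs = K.act cs K.one , trans (φ-act cs K.one) (cong (act cs) φ-one)

        -- If e killed a(X), the entries of a would be a relation against independence. Otherwise
        -- a^(Q-1)e = e, and since p = Q - 2 the element a^p e is the inverse of ae in eA.
        invert : ∀ a → a ≢ zeros (suc d) → ∃ λ b → a K.⊛ b ≡ K.one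
        invert a a≢0 with splits (act a one)
        ... | inj₁ z = contradiction (ind a (trans (A.act≡⊛ a e) (trans (A.⊛-comm _ e) z))) a≢0
        ... | inj₂ u with φ-surjective (act a one ⋆ p)
        ...   | b , φb = b , φ-injective (begin
          φ (a K.⊛ b)                               ≡⟨ φ-act a b ⟩
          act a (φ b)                               ≡⟨ cong (act a) φb ⟩
          act a (act (act a one ⋆ p) e)             ≡⟨ A.act≡⊛ a _ ⟩
          act a one ⊛ ((act a one ⋆ p) ⊛ e)         ≡⟨ A.⊛-assoc (act a one) (act a one ⋆ p) e ⟨
          idem (act a one) ⊛ e                      ≡⟨ A.⊛-comm _ e ⟩
          e ⊛ idem (act a one)                      ≡⟨ u ⟩
          e                                         ≡⟨ φ-one ⟨
          φ K.one                                   ∎)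
          where open ≡-Reasoning

        𝕂 : FiniteField
        𝕂 = K.companionField invert

        module 𝕂 = Field 𝕂

        card-𝕂 : 𝕂.card ≡ card ℕ.^ suc d
        card-𝕂 = length-allVecs (suc d)

        X⋆≡shift^K : ∀ k → K.X K.⋆ k ≡ K.shift^ k K.one
        X⋆≡shift^K k = sym (trans (K.shift^≡⊛ k K.one) (K.act-one _))

        X-fixed : K.X K.⋆ Q ≡ K.X
        X-fixed = φ-injective (begin
          φ (K.X K.⋆ Q)          ≡⟨ cong φ (X⋆≡shift^K Q) ⟩
          φ (K.shift^ Q K.one)   ≡⟨ φ-shift^ Q ⟩
          shift^ Q e             ≡⟨ cong (λ k → shift^ k e) Q≡ ⟩
          shift^ (suc (suc p)) e ≡⟨ shift^Q e ⟩
          shift e                ≡⟨ φ-shift^ 1 ⟨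
          φ K.X                  ∎)
          where open ≡-Reasoning

        -- X^Q = X holds in K too, so all q^(d+1) elements of K are roots of X^Q - X with Q =
        -- q^(n+1).
        d≤n : d ℕ.≤ n
        d≤n = ℕₚ.≮⇒≥ λ n<d → ℕₚ.<⇒≱ (ℕₚ.^-monoʳ-< card card≥2 (s≤s n<d)) (subst (ℕ._≤ Q) card-𝕂 (subst (𝕂.card ℕ.≤_) (sym Q≡)
          (𝕂.power-identity⇒card≤ p λ a → subst (λ k → a K.⋆ k ≡ a) Q≡ (K.power-fixes-all (suc n) X-fixed a))))

        -- Fermat in K, a field with q^(d+1) elements, carried over to eA by φ.
        X-frobenius : shift^ (card ℕ.^ suc d) e ≡ shift e
        X-frobenius = begin
          shift^ (card ℕ.^ suc d) e            ≡⟨ φ-shift^ (card ℕ.^ suc d) ⟨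
          φ (K.shift^ (card ℕ.^ suc d) K.one)  ≡⟨ cong φ (X⋆≡shift^K (card ℕ.^ suc d)) ⟨
          φ (K.X K.⋆ (card ℕ.^ suc d))         ≡⟨ cong (λ k → φ (K.X K.⋆ k)) card-𝕂 ⟨
          φ (K.X K.⋆ 𝕂.card)                   ≡⟨ cong φ (𝕂.fermat K.X) ⟩
          φ K.X                                ≡⟨ φ-shift^ 1 ⟩
          shift e                              ∎
          where open ≡-Reasoning

        act-shift^ : ∀ k v → v ⊛ shift^ k e ≡ shift^ k (v ⊛ e)
        act-shift^ zero v = refl
        act-shift^ (suc k) v = trans (A.act-shift v _) (cong shift (act-shift^ k v))

        e⊛gap : ∀ j → e ⊛ gap (suc j) ≡ shift^ (card ℕ.^ suc j) (e ⊛ gap j) ⊕ ⊝ shift (e ⊛ gap j)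
        e⊛gap j = trans (A.act-⊕ e _ _) (cong₂ _⊕_ (commute (card ℕ.^ suc j) (gap j))
          (trans (cong (act e) (⊝≡-1⊙ _)) (trans (A.act-⊙ e (- 1#) _) (trans (sym (⊝≡-1⊙ _)) (cong ⊝_ (A.act-shift e (gap j)))))))
          where
          commute : ∀ k v → e ⊛ shift^ k v ≡ shift^ k (e ⊛ v)
          commute zero v = refl
          commute (suc k) v = trans (A.act-shift e _) (cong shift (commute k v))

        -- The factor X^(q^(d+1)) - X of the product kills e by `X-frobenius`, and further factors
        -- keep the product at 0.
        gap-dies : ∀ j → e ⊛ gap (suc (j ℕ.+ d)) ≡ 𝟎
        gap-dies zero = begin
          e ⊛ gap (suc d)                                       ≡⟨ e⊛gap d ⟩
          shift^ (card ℕ.^ suc d) (e ⊛ gap d) ⊕ ⊝ shift (e ⊛ gap d)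
            ≡⟨ cong (λ w → shift^ (card ℕ.^ suc d) w ⊕ ⊝ shift w) (A.⊛-comm e (gap d)) ⟩
          shift^ (card ℕ.^ suc d) (gap d ⊛ e) ⊕ ⊝ shift (gap d ⊛ e)
            ≡⟨ cong₂ (λ a b → a ⊕ ⊝ b) (trans (sym (act-shift^ (card ℕ.^ suc d) (gap d))) (cong (gap d ⊛_) X-frobenius)) (sym (A.act-shift (gap d) e)) ⟩
          gap d ⊛ shift e ⊕ ⊝ (gap d ⊛ shift e)                 ≡⟨ ⊝-inverseʳ _ ⟩
          𝟎                                                     ∎
          where open ≡-Reasoning
        gap-dies (suc j) = trans (e⊛gap (suc (j ℕ.+ d)))
          (trans (cong (λ w → shift^ (card ℕ.^ suc (suc (j ℕ.+ d))) w ⊕ ⊝ shift w) (gap-dies j))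
          (trans (cong₂ (λ a b → a ⊕ ⊝ b) (shift^-𝟎 (card ℕ.^ suc (suc (j ℕ.+ d)))) (shift^-𝟎 1)) (⊝-inverseʳ 𝟎)))
          where
          shift^-𝟎 : ∀ k → shift^ k 𝟎 ≡ 𝟎
          shift^-𝟎 k = trans (A.shift^≡⊛ k 𝟎) (⊛-zeroʳ (X ⋆ k))

        -- For d < n that factor occurs in `gap n`, while e lies below the idempotent of `gap n`;
        -- this would force e = 0.
        d≮n : ¬ d ℕ.< n
        d≮n d<n = e≢0 (begin
          e                                      ≡⟨ e≤gap ⟨
          e ⊛ (gap n ⊛ (gap n ⋆ p))              ≡⟨ A.⊛-assoc e (gap n) (gap n ⋆ p) ⟨
          (e ⊛ gap n) ⊛ (gap n ⋆ p) ≡⟨ cong (_⊛ (gap n ⋆ p)) (subst (λ k → e ⊛ gap k ≡ 𝟎) n≡ (gap-dies (n ℕ.∸ suc d))) ⟩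
          𝟎 ⊛ (gap n ⋆ p)                        ≡⟨ ⊛-zeroˡ (gap n ⋆ p) ⟩
          𝟎                                      ∎)
          where
          open ≡-Reasoning
          n≡ : suc (n ℕ.∸ suc d ℕ.+ d) ≡ n
          n≡ = trans (sym (ℕₚ.+-suc (n ℕ.∸ suc d) d)) (ℕₚ.m∸n+n≡m d<n)

        d≡n : d ≡ n
        d≡n = ℕₚ.≤-antisym d≤n (ℕₚ.≮⇒≥ d≮n)

      -- The last coefficient of the relation is invertible: were it 0, the relation would be one of
      -- length d and contradict independence.
      generator : ∀ d → Independent d → Relation (suc d) → ∃ λ (r : Vec Carrier d) → shift^ d e ≡ act r e
      generator d ind (cs , cs≢0 , z) = ⊝ (l⁻¹ ⊙ i) , (begin
        s                          ≡⟨ ⊕-identityʳ s ⟨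
        s ⊕ 𝟎                      ≡⟨ cong (s ⊕_) (⊝-inverseʳ (l⁻¹ ⊙ w)) ⟨
        s ⊕ (l⁻¹ ⊙ w ⊕ ⊝ (l⁻¹ ⊙ w)) ≡⟨ ⊕-assoc s _ _ ⟨
        s ⊕ l⁻¹ ⊙ w ⊕ ⊝ (l⁻¹ ⊙ w)  ≡⟨ cong (_⊕ ⊝ (l⁻¹ ⊙ w)) sum0 ⟩
        𝟎 ⊕ ⊝ (l⁻¹ ⊙ w)            ≡⟨ ⊕-identityˡ _ ⟩
        ⊝ (l⁻¹ ⊙ w)                ≡⟨ cong ⊝_ (A.⊙-act l⁻¹ i e) ⟨
        ⊝ act (l⁻¹ ⊙ i) e          ≡⟨ A.⊝-act (l⁻¹ ⊙ i) e ⟨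
        act (⊝ (l⁻¹ ⊙ i)) e        ∎)
        where
        open ≡-Reasoning
        i = initᵛ cs
        l = lastᵛ cs
        w = act i e
        s = shift^ d e
        split : w ⊕ l ⊙ s ≡ 𝟎
        split = trans (sym (A.act-∷ʳ i l e)) (trans (cong (λ v → act v e) (sym (initᵛ∷ʳlastᵛ cs))) z)
        zeros-∷ʳ : ∀ k → zeros k ∷ʳ 0# ≡ zeros (suc k)
        zeros-∷ʳ zero = refl
        zeros-∷ʳ (suc k) = cong (0# ∷_) (zeros-∷ʳ k)
        l≢0 : l ≢ 0#
        l≢0 l≡0 = cs≢0 (trans (initᵛ∷ʳlastᵛ cs) (trans (cong₂ _∷ʳ_ (ind i w≡0) l≡0) (zeros-∷ʳ d)))
          where
          w≡0 : w ≡ 𝟎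
          w≡0 = trans (sym (⊕-identityʳ w)) (trans (cong (w ⊕_) (sym (trans (cong (_⊙ s) l≡0) (⊙-zeroˡ s)))) split)
        l⁻¹ = l ⁻¹[ l≢0 ]
        sum0 : s ⊕ l⁻¹ ⊙ w ≡ 𝟎
        sum0 = begin
          s ⊕ l⁻¹ ⊙ w             ≡⟨ ⊕-comm s _ ⟩
          l⁻¹ ⊙ w ⊕ s             ≡⟨ cong (l⁻¹ ⊙ w ⊕_) (⊙-cancel (inverseˡ l l≢0) s) ⟨
          l⁻¹ ⊙ w ⊕ l⁻¹ ⊙ l ⊙ s   ≡⟨ ⊙-distribˡ l⁻¹ w (l ⊙ s) ⟨
          l⁻¹ ⊙ (w ⊕ l ⊙ s)       ≡⟨ cong (l⁻¹ ⊙_) split ⟩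
          l⁻¹ ⊙ 𝟎                 ≡⟨ ⊙-zeroʳ l⁻¹ ⟩
          𝟎                       ∎

      extension : HasField n
      extension = build (first-relation (suc (suc (suc p))) 0 (λ { [] _ → refl })
          (subst Relation (sym (ℕₚ.+-identityʳ (suc (suc (suc p))))) relation-X^Q-X))
        where
        build : (∃ λ d → Independent d × Relation (suc d)) → HasField n
        -- Dimension 0 would mean that e is the value of the empty polynomial, that is e = 0.
        build (zero , ind , rel) = contradiction (generator zero ind rel) λ { ([] , e≡0) → e≢0 e≡0 }
        build (suc d , ind , rel) = subst HasField (Basis.d≡n d ind r₀ eq) (r₀ , Basis.invert d ind r₀ eq)
          where
          r₀ = proj₁ (generator (suc d) ind rel)
          eq = proj₂ (generator (suc d) ind rel)

    extension : HasField n
    extension = build (refine (allVecs F (suc (suc p))) (idem (gap n)) idem≢0 (idem-idem (gap n)))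
      where
      idem≢0 : idem (gap n) ≢ 𝟎
      idem≢0 z = gap≢0 (trans (sym (a⊛idem (gap n))) (trans (cong (gap n ⊛_) z) (⊛-zeroʳ (gap n))))
      build : (∃ λ e' → e' ≢ 𝟎 × e' ⊛ e' ≡ e' × e' ⊛ idem (gap n) ≡ e' × All (Splits e') (allVecs F (suc (suc p)))) → HasField n
      build (e , e≢0 , ee , e≤gap , splits) =
        Primitive.extension e e≢0 ee e≤gap λ a → All.lookup splits (Listing.complete (vecListing (suc (suc p))) a)

  extensionField : (F : FiniteField) (n : ℕ) → HasFieldOfDegree F n
  extensionField F n = Extension.extension F n (q ℕ.^ suc n ℕ.∸ 2) (sym (ℕₚ.m+[n∸m]≡n (ℕₚ.≤-trans card≥2
      (ℕₚ.m≤m*n q (q ℕ.^ n) {{ℕₚ.m^n≢0 q n {{ℕ.>-nonZero (ℕₚ.≤-trans (s≤s z≤n) card≥2)}}}}))))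
    where
    open Field F using (card≥2)
    q = FiniteField.card F

-- The isoperimetric constant as a minimum over vertex labellings.

module Isoperimetry where

  open FiniteSums
  open import Data.Integer using (+_; _+_)
  open import Data.Rational as ℚ using (ℚ)

  minimumℚ-≤ : ∀ {x xs} → x ∈ xs → minimumℚ xs ℚ.≤ x
  minimumℚ-≤ {x} {y ∷ ys} = go ys
    where
    go : ∀ zs → x ∈ y ∷ zs → foldr ℚ._⊓_ y zs ℚ.≤ x
    go [] (here refl) = ℚₚ.≤-refl
    go (z ∷ zs) (here e) = ℚₚ.≤-trans (ℚₚ.p⊓q≤q z _) (go zs (here e))
    go (z ∷ zs) (there (here refl)) = ℚₚ.p⊓q≤p z _
    go (z ∷ zs) (there (there p)) = ℚₚ.≤-trans (ℚₚ.p⊓q≤q z _) (go zs (there p))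

  -- The member x excludes the empty list, on which `minimumℚ` takes its default value 0.
  minimumℚ-∈ : ∀ {x xs} → x ∈ xs → minimumℚ xs ∈ xs
  minimumℚ-∈ {xs = y ∷ ys} _ = go ys
    where
    go : ∀ zs → foldr ℚ._⊓_ y zs ∈ y ∷ zs
    go [] = here refl
    go (z ∷ zs) with ℚₚ.⊓-sel z (foldr ℚ._⊓_ y zs) | go zs
    ... | inj₁ e | _ = there (here e)
    ... | inj₂ e | here p = here (trans e p)
    ... | inj₂ e | there p = there (there (subst (_∈ zs) (sym e) p))

  ∈-catMaybes⁺ : ∀ {A : Set} {x : A} {xs} → just x ∈ xs → x ∈ catMaybes xs
  ∈-catMaybes⁺ {xs = just _ ∷ xs} (here refl) = here refl
  ∈-catMaybes⁺ {xs = just _ ∷ xs} (there p) = there (∈-catMaybes⁺ p)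
  ∈-catMaybes⁺ {xs = nothing ∷ xs} (there p) = ∈-catMaybes⁺ p

  ∈-catMaybes⁻ : ∀ {A : Set} {x : A} xs → x ∈ catMaybes xs → just x ∈ xs
  ∈-catMaybes⁻ (nothing ∷ xs) p = there (∈-catMaybes⁻ xs p)
  ∈-catMaybes⁻ (just _ ∷ xs) (here refl) = here refl
  ∈-catMaybes⁻ (just _ ∷ xs) (there p) = there (∈-catMaybes⁻ xs p)

  extend : List Bool → List (List Bool)
  extend m = (true ∷ m) ∷ (false ∷ m) ∷ []

  ∈-masks⁺ : ∀ m → m ∈ masks (length m)
  ∈-masks⁺ [] = here refl
  ∈-masks⁺ (b ∷ m) = go (masks (length m)) (∈-masks⁺ m)
    where
    pick : ∀ b → b ∷ m ∈ extend m
    pick true = here refl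
    pick false = there (here refl)
    go : ∀ ms → m ∈ ms → b ∷ m ∈ concatMap extend ms
    go (x ∷ ms) (here refl) = ∈-++⁺ˡ (pick b)
    go (x ∷ ms) (there p) = ∈-++⁺ʳ (extend x) (go ms p)

  ∈-masks⁻ : ∀ n {m} → m ∈ masks n → length m ≡ n
  ∈-masks⁻ zero (here refl) = refl
  ∈-masks⁻ (suc n) = go (masks n) (∈-masks⁻ n)
    where
    go : ∀ ms → (∀ {m} → m ∈ ms → length m ≡ n) → ∀ {m} → m ∈ concatMap extend ms → length m ≡ suc n
    go (x ∷ ms) h (here refl) = cong suc (h (here refl))
    go (x ∷ ms) h (there (here refl)) = cong suc (h (here refl))
    go (x ∷ ms) h (there (there p)) = go ms (h ∘ there) p

  zip-map : ∀ {A : Set} (φ : A → Bool) xs → zip xs (map φ xs) ≡ map (λ x → x , φ x) xs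
  zip-map φ [] = refl
  zip-map φ (x ∷ xs) = cong (_ ∷_) (zip-map φ xs)

  -- Since vertices are listed once, a positional mask is the table of a function; cuts can then be
  -- treated as labellings of the vertex set.
  mask-function : ∀ {A : Set} → DecidableEquality A → ∀ xs → Unique xs → ∀ m → length m ≡ length xs →
    ∃ λ (φ : A → Bool) → map φ xs ≡ m
  mask-function _≟_ [] _ [] _ = (λ _ → true) , refl
  mask-function {A} _≟_ (x ∷ xs) (x∉ ∷ u) (b ∷ m) e with mask-function _≟_ xs u m (ℕₚ.suc-injective e)
  ... | φ , eq = ψ , cong₂ _∷_ ψ-x (trans (map-cong-local (All.map ψ-≢ x∉)) eq)
    where
    ψ : A → Bool
    ψ y with x ≟ y
    ... | yes _ = b
    ... | no _ = φ y
    ψ-x : ψ x ≡ b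
    ψ-x with x ≟ x
    ... | yes _ = refl
    ... | no n = contradiction refl n
    ψ-≢ : ∀ {y} → x ≢ y → ψ y ≡ φ y
    ψ-≢ {y} n with x ≟ y
    ... | yes e = contradiction e n
    ... | no _ = refl

  module Cuts (X : FinGraph) where

    open FinGraph X

    labelled : (V → Bool) → List (V × Bool)
    labelled φ = map (λ v → v , φ v) verts

    side smaller crossing : (V → Bool) → ℕ
    side φ = countᵇ proj₂ (labelled φ)
    smaller φ = side φ ℕ.⊓ countᵇ (λ p → not (proj₂ p)) (labelled φ)
    crossing φ = countᵇ (λ pq → proj₂ (proj₁ pq) ∧ not (proj₂ (proj₂ pq)) ∧ adj (proj₁ (proj₁ pq)) (proj₁ (proj₂ pq)))
                   (cartesianProduct (labelled φ) (labelled φ))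

    cutRatio-suc : ∀ φ m → smaller φ ≡ suc m → cutRatio adj (labelled φ) ≡ just (+ crossing φ ℚ./ suc m)
    cutRatio-suc φ m e with smaller φ
    cutRatio-suc φ m refl | .(suc m) = refl

    cutRatio-just : ∀ φ {x} → cutRatio adj (labelled φ) ≡ just x → ∃ λ m → smaller φ ≡ suc m × x ≡ + crossing φ ℚ./ suc m
    cutRatio-just φ e with smaller φ
    cutRatio-just φ refl | suc m = m , refl , refl

    ratios : List (Maybe ℚ)
    ratios = map (λ m → cutRatio adj (zip verts m)) (masks (length verts))

    ratio-∈ : ∀ φ m → smaller φ ≡ suc m → + crossing φ ℚ./ suc m ∈ catMaybes ratios
    ratio-∈ φ m e = ∈-catMaybes⁺ (subst (_∈ ratios)
      (trans (cong (cutRatio adj) (zip-map φ verts)) (cutRatio-suc φ m e))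
      (∈-map⁺ (λ m → cutRatio adj (zip verts m))
        (subst (λ l → map φ verts ∈ masks l) (length-map φ verts) (∈-masks⁺ (map φ verts)))))

    iso-≤ : ∀ φ m → smaller φ ≡ suc m → iso X ℚ.≤ + crossing φ ℚ./ suc m
    iso-≤ φ m e = minimumℚ-≤ (ratio-∈ φ m e)

    -- Lower bounds are proved at the minimising cut itself. The given cut φ₀ with nonempty sides
    -- shows that the list of ratios is not empty.
    iso-attained : DecidableEquality V → Unique verts → (∃₂ λ φ m → smaller φ ≡ suc m) →
      ∃₂ λ φ m → smaller φ ≡ suc m × iso X ≡ + crossing φ ℚ./ suc m
    iso-attained dec u (φ₀ , m₀ , e₀) = from-mask (∈-map⁻ (λ m → cutRatio adj (zip verts m))
        (∈-catMaybes⁻ ratios (minimumℚ-∈ (ratio-∈ φ₀ m₀ e₀))))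
      where
      from-function : ∀ {x mask} → just x ≡ cutRatio adj (zip verts mask) → (∃ λ φ → map φ verts ≡ mask) →
        ∃₂ λ φ m → smaller φ ≡ suc m × x ≡ + crossing φ ℚ./ suc m
      from-function eq (φ , refl) = φ , cutRatio-just φ (trans (cong (cutRatio adj) (sym (zip-map φ verts))) (sym eq))
      from-mask : ∀ {x} → (∃ λ mask → mask ∈ masks (length verts) × just x ≡ cutRatio adj (zip verts mask)) →
        ∃₂ λ φ m → smaller φ ≡ suc m × x ≡ + crossing φ ℚ./ suc m
      from-mask (mask , mask∈ , eq) = from-function eq (mask-function dec verts u mask (∈-masks⁻ (length verts) mask∈))

-- From a norm estimate to a cut estimate, over the integers.

module SpectralBound where

  open FiniteSums
  open Isoperimetry
  open import Data.Integer as ℤ using (ℤ; +_; 0ℤ; _+_; _*_; _-_; -_)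

  0≤* : ∀ {i j} → 0ℤ ℤ.≤ i → 0ℤ ℤ.≤ j → 0ℤ ℤ.≤ i * j
  0≤* {+ m} {+ n} _ _ = subst (0ℤ ℤ.≤_) (ℤₚ.pos-* m n) (ℤ.+≤+ z≤n)

  0≤n* : ∀ n {j} → 0ℤ ℤ.≤ j → 0ℤ ℤ.≤ + n * j
  0≤n* n = 0≤* {+ n} (ℤ.+≤+ z≤n)

  0≤+ : ∀ {i j} → 0ℤ ℤ.≤ i → 0ℤ ℤ.≤ j → 0ℤ ℤ.≤ i + j
  0≤+ = ℤₚ.+-mono-≤

  0≤-by : ∀ {i j d} → 0ℤ ℤ.≤ d → d ≡ j - i → i ℤ.≤ j
  0≤-by p e = ℤₚ.0≤i-j⇒j≤i (subst (0ℤ ℤ.≤_) e p)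

  ≤⇒0≤ : ∀ {i j} → i ℤ.≤ j → 0ℤ ℤ.≤ j - i
  ≤⇒0≤ = ℤₚ.i≤j⇒0≤j-i

  0<* : ∀ {i j} → 0ℤ ℤ.< i → 0ℤ ℤ.< j → 0ℤ ℤ.< i * j
  0<* {+ suc m} {+ suc n} _ _ = ℤ.+<+ (s≤s z≤n)
  0<* {+ zero} (ℤ.+<+ ()) _
  0<* {+ suc m} {+ zero} _ (ℤ.+<+ ())

  square-cancel-≤ : ∀ {a b} → 0ℤ ℤ.≤ b → a * a ℤ.≤ b * b → a ℤ.≤ b
  square-cancel-≤ {a} {b} 0≤b h = ℤₚ.≮⇒≥ λ b<a → ℤₚ.<-irrefl refl (ℤₚ.<-≤-trans (ℤₚ.<-≤-trans
      (0<* (0<- b<a) (ℤₚ.<-≤-trans (ℤₚ.≤-<-trans 0≤b b<a) (0≤-by 0≤b (cancel a b)))) (ℤₚ.≤-reflexive (factor a b)))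
      (ℤₚ.i≤j⇒i-j≤0 h))
    where
    0<- : ∀ {i j} → i ℤ.< j → 0ℤ ℤ.< j - i
    0<- {i} {j} i<j = subst (ℤ._< j - i) (ℤₚ.+-inverseʳ i) (ℤₚ.+-monoˡ-< (- i) i<j)
    cancel : ∀ a b → b ≡ (a + b) - a
    cancel = solve-∀
    factor : ∀ a b → (a - b) * (a + b) ≡ a * a - b * b
    factor = solve-∀

  0≤*⁻ : ∀ c {i} → 0ℤ ℤ.< c → 0ℤ ℤ.≤ c * i → 0ℤ ℤ.≤ i
  0≤*⁻ (+ suc c) {i} _ h = ℤₚ.*-cancelˡ-≤-pos 0ℤ i (+ suc c) (subst (ℤ._≤ + suc c * i) (sym (ℤₚ.*-zeroʳ (+ suc c))) h)
  0≤*⁻ (+ zero) (ℤ.+<+ ()) _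

  -- If (X + kY)² ≤ L (Z + Y)² and X² > L Z², then kX ≥ LZ because k² ≥ L, and expanding the
  -- squares gives a contradiction.
  absorb : ∀ k L X Y Z → 0ℤ ℤ.≤ k → 0ℤ ℤ.≤ L → L ℤ.≤ k * k → 0ℤ ℤ.≤ Y → 0ℤ ℤ.≤ Z →
    (X + k * Y) * (X + k * Y) ℤ.≤ L * ((Z + Y) * (Z + Y)) → X ℤ.≤ 0ℤ ⊎ X * X ℤ.≤ L * (Z * Z)
  absorb k L X Y Z 0≤k 0≤L L≤k² 0≤Y 0≤Z h with X ℤ.≤? 0ℤ | X * X ℤ.≤? L * (Z * Z)
  ... | yes p | _ = inj₁ p
  ... | no _ | yes p = inj₂ p
  ... | no X≰0 | no ≰ = contradiction X²≤ ≰
    where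
    0≤X : 0ℤ ℤ.≤ X
    0≤X = ℤₚ.<⇒≤ (ℤₚ.≰⇒> X≰0)
    X²> : L * (Z * Z) ℤ.< X * X
    X²> = ℤₚ.≰⇒> ≰
    0≤X²- : 0ℤ ℤ.≤ X * X - L * (Z * Z)
    0≤X²- = ≤⇒0≤ (ℤₚ.<⇒≤ X²>)
    id₁ : ∀ k L X Z → (X * X) * (k * k - L) + L * (X * X - L * (Z * Z)) ≡ (k * X) * (k * X) - (L * Z) * (L * Z)
    id₁ = solve-∀
    LZ≤kX : L * Z ℤ.≤ k * X
    LZ≤kX = square-cancel-≤ (0≤* 0≤k 0≤X) (0≤-by (0≤+ (0≤* (0≤i*i X) (≤⇒0≤ L≤k²)) (0≤* 0≤L 0≤X²-)) (id₁ k L X Z))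
    id₂ : ∀ k L X Y Z → (L * ((Z + Y) * (Z + Y)) - (X + k * Y) * (X + k * Y)) + (+ 2 * Y * (k * X - L * Z) + (k * k - L) * (Y * Y)) ≡ L * (Z * Z) - X * X
    id₂ = solve-∀
    X²≤ : X * X ℤ.≤ L * (Z * Z)
    X²≤ = 0≤-by (0≤+ (≤⇒0≤ h) (0≤+ (0≤* (0≤n* 2 0≤Y) (≤⇒0≤ LZ≤kX)) (0≤* (≤⇒0≤ L≤k²) (0≤i*i Y)))) (id₂ k L X Y Z)

  module CutAlgebra (k L N σ τ B e : ℤ) (0≤k : 0ℤ ℤ.≤ k) (0≤L : 0ℤ ℤ.≤ L) (L≤k² : L ℤ.≤ k * k) (0<N : 0ℤ ℤ.< N)
    (2e≡ : + 2 * e ≡ k * N - B)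
    (P²≤ : (N * B - k * (σ * τ)) * (N * B - k * (σ * τ)) ℤ.≤ L * ((N * N - σ * σ) * (N * N - τ * τ))) where

    P : ℤ
    P = N * B - k * (σ * τ)

    0≤N : 0ℤ ℤ.≤ N
    0≤N = ℤₚ.<⇒≤ 0<N

    -- Here 4P = X + kY and 4(N^2 - στ) = Z + Y, with X = 4N(ku - 2e) and Z = 4Nu. The hypothesis on
    -- P gives (X + kY)^2 ≤ L(Z + Y)^2; `absorb` strips off Y, the contribution of the imbalance of
    -- the cut, and division by (4N)^2 leaves the claim.
    cut-bound : ∀ u w → 0ℤ ℤ.≤ u → u ℤ.≤ w → + 2 * u ≡ (N + σ) + (N + τ) ⊎ + 2 * u ≡ (N - σ) + (N - τ) → u + w ≡ + 2 * N →
      k * u - + 2 * e ℤ.≤ 0ℤ ⊎ (k * u - + 2 * e) * (k * u - + 2 * e) ℤ.≤ L * (u * u)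
    cut-bound u w 0≤u u≤w 2u≡ u+w≡ = Sum.map nonpos small (absorb k L X Y Z 0≤k 0≤L L≤k² 0≤Y 0≤Z bound)
      where
      S d X Y Z x : ℤ
      S = + 4 * (N * N) - (σ + τ) * (σ + τ)
      d = (σ - τ) * (σ - τ)
      Z = + 4 * (N * u)
      Y = (S + d) - Z
      X = + 4 * P - k * Y
      x = k * u - + 2 * e
      S≡ : S ≡ + 4 * (u * w)
      S≡ = begin
        + 4 * (N * N) - (σ + τ) * (σ + τ)       ≡⟨ by-side 2u≡ ⟩
        (+ 2 * u) * (+ 2 * (+ 2 * N) - + 2 * u) ≡⟨ cong (λ z → (+ 2 * u) * (+ 2 * z - + 2 * u)) u+w≡ ⟨
        (+ 2 * u) * (+ 2 * (u + w) - + 2 * u)   ≡⟨ id₃ u w ⟩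
        + 4 * (u * w)                           ∎
        where
        open ≡-Reasoning
        id₃ : ∀ u w → (+ 2 * u) * (+ 2 * (u + w) - + 2 * u) ≡ + 4 * (u * w)
        id₃ = solve-∀
        plus : ∀ N σ τ → + 4 * (N * N) - (σ + τ) * (σ + τ) ≡ ((N + σ) + (N + τ)) * (+ 2 * (+ 2 * N) - ((N + σ) + (N + τ)))
        plus = solve-∀
        minus : ∀ N σ τ → + 4 * (N * N) - (σ + τ) * (σ + τ) ≡ ((N - σ) + (N - τ)) * (+ 2 * (+ 2 * N) - ((N - σ) + (N - τ)))
        minus = solve-∀
        by-side : + 2 * u ≡ (N + σ) + (N + τ) ⊎ + 2 * u ≡ (N - σ) + (N - τ) →
          + 4 * (N * N) - (σ + τ) * (σ + τ) ≡ (+ 2 * u) * (+ 2 * (+ 2 * N) - + 2 * u)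
        by-side (inj₁ h) = trans (plus N σ τ) (cong (λ z → z * (+ 2 * (+ 2 * N) - z)) (sym h))
        by-side (inj₂ h) = trans (minus N σ τ) (cong (λ z → z * (+ 2 * (+ 2 * N) - z)) (sym h))
      0≤Z : 0ℤ ℤ.≤ Z
      0≤Z = 0≤n* 4 (0≤* 0≤N 0≤u)
      0≤S : 0ℤ ℤ.≤ S
      0≤S = subst (0ℤ ℤ.≤_) (sym S≡) (0≤n* 4 (0≤* 0≤u (ℤₚ.≤-trans 0≤u u≤w)))
      -- By u + w = 2N and S = 4uw, Y equals 2u(w - u) + (σ - τ)^2; this is where u must be the
      -- smaller part.
      0≤Y : 0ℤ ℤ.≤ Y
      0≤Y = subst (0ℤ ℤ.≤_) eq (0≤+ (0≤* (0≤n* 2 0≤u) (≤⇒0≤ u≤w)) (0≤i*i (σ - τ)))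
        where
        id₄ : ∀ u w d → (+ 2 * u) * (w - u) + d ≡ (+ 4 * (u * w) + d) - + 2 * ((u + w) * u)
        id₄ = solve-∀
        id₅ : ∀ N u → + 2 * ((+ 2 * N) * u) ≡ + 4 * (N * u)
        id₅ = solve-∀
        eq : (+ 2 * u) * (w - u) + d ≡ Y
        eq = trans (id₄ u w d) (cong₂ (λ a b → (a + d) - b) (sym S≡) (trans (cong (λ z → + 2 * (z * u)) u+w≡) (id₅ N u)))
      -- (N^2 - στ)^2 exceeds (N^2 - σ^2)(N^2 - τ^2) by N^2(σ - τ)^2. Sixteen times this excess is
      -- split into the nonnegative terms 4(σ^2 - τ^2)^2 and 4S(σ - τ)^2.
      bound : (X + k * Y) * (X + k * Y) ℤ.≤ L * ((Z + Y) * (Z + Y))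
      bound = 0≤-by (0≤+ (0≤n* 16 (≤⇒0≤ P²≤))
          (0≤* 0≤L (0≤+ (0≤n* 4 (0≤i*i (σ * σ - τ * τ))) (0≤* (0≤n* 4 0≤S) (0≤i*i (σ - τ))))))
          (id₆ k L N σ τ P Y Z)
        where
        id₆ : ∀ k L N σ τ P Y Z → + 16 * (L * ((N * N - σ * σ) * (N * N - τ * τ)) - P * P)
           + L * (+ 4 * ((σ * σ - τ * τ) * (σ * σ - τ * τ)) + + 4 * (+ 4 * (N * N) - (σ + τ) * (σ + τ)) * ((σ - τ) * (σ - τ)))
           ≡ L * ((Z + (((+ 4 * (N * N) - (σ + τ) * (σ + τ)) + (σ - τ) * (σ - τ)) - Z)) * (Z + (((+ 4 * (N * N) - (σ + τ) * (σ + τ)) + (σ - τ) * (σ - τ)) - Z)))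
             - ((+ 4 * P - k * Y) + k * Y) * ((+ 4 * P - k * Y) + k * Y)
        id₆ = solve-∀
      X≡ : (+ 4 * N) * x ≡ X
      X≡ = trans (cong (λ z → (+ 4 * N) * (k * u - z)) 2e≡) (id₇ k N u B σ τ)
        where
        id₇ : ∀ k N u B σ τ → (+ 4 * N) * (k * u - (k * N - B)) ≡
          + 4 * (N * B - k * (σ * τ)) - k * (((+ 4 * (N * N) - (σ + τ) * (σ + τ)) + (σ - τ) * (σ - τ)) - + 4 * (N * u))
        id₇ = solve-∀
      0<4N : 0ℤ ℤ.< + 4 * N
      0<4N = 0<* {+ 4} (ℤ.+<+ (s≤s z≤n)) 0<N
      nonpos : X ℤ.≤ 0ℤ → x ℤ.≤ 0ℤ
      nonpos h = 0≤-by (0≤*⁻ (+ 4 * N) 0<4N (subst (0ℤ ℤ.≤_) eq (≤⇒0≤ h))) refl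
        where
        neg : ∀ c x → 0ℤ - c * x ≡ c * (0ℤ - x)
        neg = solve-∀
        eq : 0ℤ - X ≡ (+ 4 * N) * (0ℤ - x)
        eq = trans (cong (λ z → 0ℤ - z) (sym X≡)) (neg (+ 4 * N) x)
      small : X * X ℤ.≤ L * (Z * Z) → x * x ℤ.≤ L * (u * u)
      small h = ℤₚ.0≤i-j⇒j≤i (0≤*⁻ ((+ 4 * N) * (+ 4 * N)) (0<* 0<4N 0<4N) (subst (0ℤ ℤ.≤_) eq (≤⇒0≤ h)))
        where
        id₈ : ∀ L N u x → L * ((+ 4 * (N * u)) * (+ 4 * (N * u))) - ((+ 4 * N) * x) * ((+ 4 * N) * x) ≡ ((+ 4 * N) * (+ 4 * N)) * (L * (u * u) - x * x)
        id₈ = solve-∀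
        eq : L * (Z * Z) - X * X ≡ ((+ 4 * N) * (+ 4 * N)) * (L * (u * u) - x * x)
        eq = trans (cong (λ z → L * (Z * Z) - z * z) (sym X≡)) (id₈ L N u x)

-- Cuts of a bipartite regular graph as pairs of sign functions.

module BipartiteCuts where

  open FiniteSums
  open Isoperimetry
  open SpectralBound
  open import Data.Integer as ℤ using (ℤ; +_; 0ℤ; 1ℤ; _+_; _*_; _-_; -_)

  sgn : Bool → ℤ
  sgn true = 1ℤ
  sgn false = - 1ℤ

  sgn² : ∀ b → sgn b * sgn b ≡ 1ℤ
  sgn² true = refl
  sgn² false = refl

  2⟦⟧ : ∀ b → + 2 * ⟦ b ⟧ ≡ 1ℤ + sgn b
  2⟦⟧ true = refl
  2⟦⟧ false = refl

  2⟦not⟧ : ∀ b → + 2 * ⟦ not b ⟧ ≡ 1ℤ - sgn b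
  2⟦not⟧ true = refl
  2⟦not⟧ false = refl

  -- An edge is cut when the product of its two signs is -1. Both orientations occur because
  -- `crossing` counts ordered pairs from U to W, and either endpoint may lie in U.
  ⟦separated⟧ : ∀ x y ρ → + 2 * (⟦ x ∧ not y ∧ ρ ⟧ + ⟦ y ∧ not x ∧ ρ ⟧) ≡ ⟦ ρ ⟧ - ⟦ ρ ⟧ * (sgn x * sgn y)
  ⟦separated⟧ true true true = refl
  ⟦separated⟧ true true false = refl
  ⟦separated⟧ true false true = refl
  ⟦separated⟧ true false false = refl
  ⟦separated⟧ false true true = refl
  ⟦separated⟧ false true false = refl
  ⟦separated⟧ false false true = refl
  ⟦separated⟧ false false false = refl

  ⟦∧false⟧ : ∀ x y → ⟦ x ∧ not y ∧ false ⟧ ≡ 0ℤ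
  ⟦∧false⟧ true true = refl
  ⟦∧false⟧ true false = refl
  ⟦∧false⟧ false y = refl

  module BipartiteGraph (F : FiniteField) (n : ℕ) (vs : List (Vec (FiniteField.Carrier F) n))
    (r : Vec (FiniteField.Carrier F) n → Vec (FiniteField.Carrier F) n → Bool) where

    W : Set
    W = Vec (FiniteField.Carrier F) n

    X : FinGraph
    X = bipartite F n vs r

    open FinGraph X using (V; adj)
    open Cuts X public

    N : ℤ
    N = + length vs

    ∑-labelled : ∀ φ (h : V × Bool → ℤ) →
      ∑ (labelled φ) h ≡ ∑ vs (λ a → h (inj₁ a , φ (inj₁ a))) + ∑ vs (λ b → h (inj₂ b , φ (inj₂ b)))
    ∑-labelled φ h = trans (∑-map (λ v → v , φ v) (map inj₁ vs ++ map inj₂ vs) h)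
      (trans (∑-++ (map inj₁ vs) (map inj₂ vs) (λ v → h (v , φ v)))
        (cong₂ _+_ (∑-map inj₁ vs (λ v → h (v , φ v))) (∑-map inj₂ vs (λ v → h (v , φ v)))))

    module Cut (φ : V → Bool) where

      s t : W → ℤ
      s a = sgn (φ (inj₁ a))
      t b = sgn (φ (inj₂ b))

      σ τ B : ℤ
      σ = ∑ vs s
      τ = ∑ vs t
      B = ∑ vs (λ a → ∑ vs (λ b → ⟦ r a b ⟧ * (s a * t b)))

      other : ℕ
      other = countᵇ (λ p → not (proj₂ p)) (labelled φ)

      2*∑ : ∀ (p : Bool → Bool) (h : Bool → ℤ) → (∀ b → + 2 * ⟦ p b ⟧ ≡ h b) →
        + 2 * + countᵇ (p ∘ proj₂) (labelled φ) ≡ ∑ vs (λ a → h (φ (inj₁ a))) + ∑ vs (λ b → h (φ (inj₂ b)))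
      2*∑ p h e = trans (cong (+ 2 *_) (countᵇ-∑ (p ∘ proj₂) (labelled φ)))
        (trans (sym (∑-*ˡ (labelled φ) (+ 2) (⟦_⟧ ∘ p ∘ proj₂)))
        (trans (∑-cong (labelled φ) (e ∘ proj₂)) (∑-labelled φ (h ∘ proj₂))))

      2side : + 2 * + side φ ≡ (N + σ) + (N + τ)
      2side = trans (2*∑ (λ b → b) (λ b → 1ℤ + sgn b) 2⟦⟧) (cong₂ _+_ (half s) (half t))
        where
        half : ∀ (u : W → ℤ) → ∑ vs (λ a → 1ℤ + u a) ≡ N + ∑ vs u
        half u = trans (∑-+ vs (λ _ → 1ℤ) u) (cong (_+ ∑ vs u) (∑-1 vs))

      2other : + 2 * + other ≡ (N - σ) + (N - τ)
      2other = trans (2*∑ not (λ b → 1ℤ - sgn b) 2⟦not⟧) (cong₂ _+_ (half s) (half t))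
        where
        half : ∀ (u : W → ℤ) → ∑ vs (λ a → 1ℤ - u a) ≡ N - ∑ vs u
        half u = trans (∑-- vs (λ _ → 1ℤ) u) (cong (_- ∑ vs u) (∑-1 vs))

      crossing≡ : + crossing φ ≡
        ∑ vs (λ a → ∑ vs (λ b → ⟦ φ (inj₁ a) ∧ not (φ (inj₂ b)) ∧ r a b ⟧ + ⟦ φ (inj₂ b) ∧ not (φ (inj₁ a)) ∧ r a b ⟧))
      crossing≡ = begin
        + crossing φ
          ≡⟨ countᵇ-∑ _ (cartesianProduct (labelled φ) (labelled φ)) ⟩
        ∑ (cartesianProduct (labelled φ) (labelled φ)) (λ pq → E (proj₁ pq) (proj₂ pq))
          ≡⟨ ∑-cartesianProduct (labelled φ) (labelled φ) (λ pq → E (proj₁ pq) (proj₂ pq)) ⟩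
        ∑ (labelled φ) (λ x → ∑ (labelled φ) (E x))
          ≡⟨ ∑-cong (labelled φ) (λ x → ∑-labelled φ (E x)) ⟩
        ∑ (labelled φ) (λ x → ∑ vs (λ a → E x (L a)) + ∑ vs (λ b → E x (R b)))
          ≡⟨ ∑-labelled φ _ ⟩
        ∑ vs (λ a → ∑ vs (λ a' → E (L a) (L a')) + ∑ vs (λ b → E (L a) (R b)))
          + ∑ vs (λ b → ∑ vs (λ a → E (R b) (L a)) + ∑ vs (λ b' → E (R b) (R b')))
          ≡⟨ cong₂ _+_
               (∑-cong vs λ a → trans (cong (_+ ∑ vs (λ b → E (L a) (R b))) (zero-sum λ a' → ⟦∧false⟧ (φ (inj₁ a)) (φ (inj₁ a')))) (ℤₚ.+-identityˡ _))
               (∑-cong vs λ b → trans (cong (_+_ (∑ vs (λ a → E (R b) (L a)))) (zero-sum λ b' → ⟦∧false⟧ (φ (inj₂ b)) (φ (inj₂ b')))) (ℤₚ.+-identityʳ _)) ⟩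
        ∑ vs (λ a → ∑ vs (λ b → E (L a) (R b))) + ∑ vs (λ b → ∑ vs (λ a → E (R b) (L a)))
          ≡⟨ cong (_+_ (∑ vs (λ a → ∑ vs (λ b → E (L a) (R b))))) (∑-swap vs vs (λ b a → E (R b) (L a))) ⟩
        ∑ vs (λ a → ∑ vs (λ b → E (L a) (R b))) + ∑ vs (λ a → ∑ vs (λ b → E (R b) (L a)))
          ≡⟨ ∑-+ vs _ _ ⟨
        ∑ vs (λ a → ∑ vs (λ b → E (L a) (R b)) + ∑ vs (λ b → E (R b) (L a)))
          ≡⟨ ∑-cong vs (λ a → ∑-+ vs _ _) ⟨
        ∑ vs (λ a → ∑ vs (λ b → E (L a) (R b) + E (R b) (L a))) ∎
        where
        open ≡-Reasoning
        E : V × Bool → V × Bool → ℤ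
        E x y = ⟦ proj₂ x ∧ not (proj₂ y) ∧ adj (proj₁ x) (proj₁ y) ⟧
        L R : W → V × Bool
        L a = inj₁ a , φ (inj₁ a)
        R b = inj₂ b , φ (inj₂ b)
        zero-sum : ∀ {h : W → ℤ} → (∀ a → h a ≡ 0ℤ) → ∑ vs h ≡ 0ℤ
        zero-sum e = trans (∑-cong vs e) (∑-0 vs)

      -- kN is the number of all edges, and B is the number of uncut edges minus that of cut ones.
      2crossing : ∀ k → (∀ {a} → a ∈ vs → ∑ vs (λ b → ⟦ r a b ⟧) ≡ k) → + 2 * + crossing φ ≡ k * N - B
      2crossing k reg = begin
        + 2 * + crossing φ
          ≡⟨ cong (+ 2 *_) crossing≡ ⟩
        + 2 * ∑ vs (λ a → ∑ vs (λ b → ⟦ φ (inj₁ a) ∧ not (φ (inj₂ b)) ∧ r a b ⟧ + ⟦ φ (inj₂ b) ∧ not (φ (inj₁ a)) ∧ r a b ⟧))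
          ≡⟨ ∑-*ˡ vs (+ 2) _ ⟨
        ∑ vs (λ a → + 2 * ∑ vs (λ b → ⟦ φ (inj₁ a) ∧ not (φ (inj₂ b)) ∧ r a b ⟧ + ⟦ φ (inj₂ b) ∧ not (φ (inj₁ a)) ∧ r a b ⟧))
          ≡⟨ ∑-cong vs (λ a → trans (sym (∑-*ˡ vs (+ 2) _)) (∑-cong vs λ b → ⟦separated⟧ (φ (inj₁ a)) (φ (inj₂ b)) (r a b))) ⟩
        ∑ vs (λ a → ∑ vs (λ b → ⟦ r a b ⟧ - ⟦ r a b ⟧ * (s a * t b)))
          ≡⟨ ∑-cong vs (λ a → ∑-- vs (λ b → ⟦ r a b ⟧) _) ⟩
        ∑ vs (λ a → ∑ vs (λ b → ⟦ r a b ⟧) - ∑ vs (λ b → ⟦ r a b ⟧ * (s a * t b)))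
          ≡⟨ ∑-- vs _ _ ⟩
        ∑ vs (λ a → ∑ vs (λ b → ⟦ r a b ⟧)) - B
          ≡⟨ cong (_- B) (trans (∑-cong∈ vs reg) (trans (∑-const vs k) (ℤₚ.*-comm N k))) ⟩
        k * N - B ∎
        where open ≡-Reasoning

      balanced : σ + τ ≡ 0ℤ → smaller φ ≡ length vs
      balanced σ+τ≡0 = trans (cong₂ ℕ._⊓_ side≡ other≡) (ℕₚ.⊓-idem (length vs))
        where
        plus : ∀ N σ τ → (N + σ) + (N + τ) ≡ + 2 * N + (σ + τ)
        plus = solve-∀
        minus : ∀ N σ τ → (N - σ) + (N - τ) ≡ + 2 * N - (σ + τ)
        minus = solve-∀
        side≡ : side φ ≡ length vs
        side≡ = ℤₚ.+-injective (ℤₚ.*-cancelˡ-≡ (+ 2) (+ side φ) N (trans 2side (trans (plus N σ τ)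
          (trans (cong (_+_ (+ 2 * N)) σ+τ≡0) (ℤₚ.+-identityʳ _)))))
        other≡ : other ≡ length vs
        other≡ = ℤₚ.+-injective (ℤₚ.*-cancelˡ-≡ (+ 2) (+ other) N (trans 2other (trans (minus N σ τ)
          (trans (cong (_-_ (+ 2 * N)) σ+τ≡0) (ℤₚ.+-identityʳ _)))))

    module Regular (k : ℕ) (0<N : 0ℤ ℤ.< N)
      (regˡ : ∀ {b} → b ∈ vs → ∑ vs (λ a → ⟦ r a b ⟧) ≡ + k) (regʳ : ∀ {a} → a ∈ vs → ∑ vs (λ b → ⟦ r a b ⟧) ≡ + k) where

      ∑∑-regular : ∀ (h : W → ℤ) → ∑ vs (λ b → ∑ vs (λ a → ⟦ r a b ⟧ * h a)) ≡ + k * ∑ vs h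
      ∑∑-regular h = begin
        ∑ vs (λ b → ∑ vs (λ a → ⟦ r a b ⟧ * h a))   ≡⟨ ∑-swap vs vs _ ⟩
        ∑ vs (λ a → ∑ vs (λ b → ⟦ r a b ⟧ * h a)) ≡⟨ ∑-cong∈ vs (λ {a} a∈ → trans (∑-*ʳ vs (h a) _) (cong (_* h a) (regʳ a∈))) ⟩
        ∑ vs (λ a → + k * h a)                      ≡⟨ ∑-*ˡ vs (+ k) h ⟩
        + k * ∑ vs h                                ∎
        where open ≡-Reasoning

      -- f and g are a pair of singular vectors of M with entries ±1 and singular value ℓ. Such a
      -- pair makes a balanced cut with B = ℓN, hence of ratio (k - ℓ)/2.
      module Eigencut (f g : W → Bool) (ℓ : ℕ) (0<ℓ : 0 ℕ.< ℓ) (∑f≡0 : ∑ vs (sgn ∘ f) ≡ 0ℤ)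
        (eigen : ∀ {b} → b ∈ vs → ∑ vs (λ a → ⟦ r a b ⟧ * sgn (f a)) ≡ + ℓ * sgn (g b)) where

        φ : V → Bool
        φ = Sum.[ f , g ]′

        open Cut φ

        τ≡0 : τ ≡ 0ℤ
        -- ℓτ is the sum of all entries of the image of f, which regularity turns into kσ = 0.
        τ≡0 = ℤₚ.*-cancelˡ-≡ (+ ℓ) τ 0ℤ {{ℤ.≢-nonZero λ e → ℕₚ.<⇒≢ 0<ℓ (sym (ℤₚ.+-injective e))}} (begin
          + ℓ * τ                                         ≡⟨ ∑-*ˡ vs (+ ℓ) t ⟨
          ∑ vs (λ b → + ℓ * t b)                          ≡⟨ ∑-cong∈ vs eigen ⟨
          ∑ vs (λ b → ∑ vs (λ a → ⟦ r a b ⟧ * s a))       ≡⟨ ∑∑-regular s ⟩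
          + k * σ                                         ≡⟨ cong (+ k *_) ∑f≡0 ⟩
          + k * 0ℤ                                        ≡⟨ ℤₚ.*-zeroʳ (+ k) ⟩
          0ℤ                                              ≡⟨ ℤₚ.*-zeroʳ (+ ℓ) ⟨
          + ℓ * 0ℤ                                        ∎)
          where open ≡-Reasoning

        smaller≡ : smaller φ ≡ length vs
        smaller≡ = balanced (trans (cong₂ _+_ ∑f≡0 τ≡0) refl)

        B≡ : B ≡ + ℓ * N
        B≡ = begin
          ∑ vs (λ a → ∑ vs (λ b → ⟦ r a b ⟧ * (s a * t b)))   ≡⟨ ∑-swap vs vs _ ⟩
          ∑ vs (λ b → ∑ vs (λ a → ⟦ r a b ⟧ * (s a * t b)))
            ≡⟨ ∑-cong vs (λ b → trans (∑-cong vs λ a → sym (ℤₚ.*-assoc ⟦ r a b ⟧ (s a) (t b))) (∑-*ʳ vs (t b) _)) ⟩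
          ∑ vs (λ b → ∑ vs (λ a → ⟦ r a b ⟧ * s a) * t b)     ≡⟨ ∑-cong∈ vs (λ {b} b∈ → cong (_* t b) (eigen b∈)) ⟩
          ∑ vs (λ b → + ℓ * t b * t b)
            ≡⟨ ∑-cong vs (λ b → trans (ℤₚ.*-assoc (+ ℓ) (t b) (t b)) (trans (cong (+ ℓ *_) (sgn² (g b))) (ℤₚ.*-identityʳ (+ ℓ)))) ⟩
          ∑ vs (λ b → + ℓ)                                    ≡⟨ trans (∑-const vs (+ ℓ)) (ℤₚ.*-comm N (+ ℓ)) ⟩
          + ℓ * N                                             ∎
          where open ≡-Reasoning

        2crossing≡ : + 2 * + crossing φ ≡ + k * N - + ℓ * N
        2crossing≡ = trans (2crossing (+ k) regʳ) (cong (λ z → + k * N - z) B≡)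

      -- A cut with two nonempty sides, needed to know that the minimum defining `iso` is attained.
      bipartition : V → Bool
      bipartition = Sum.[ (λ _ → true) , (λ _ → false) ]′

      smaller-bipartition : smaller bipartition ≡ length vs
      smaller-bipartition = Cut.balanced bipartition (trans (cong₂ _+_ (∑-const vs 1ℤ) (∑-const vs (- 1ℤ))) (cancel N))
        where
        cancel : ∀ N → N * 1ℤ + N * (- 1ℤ) ≡ 0ℤ
        cancel = solve-∀

      module Spectral (L : ℕ) (L≤k² : L ℕ.≤ k ℕ.* k)
        (spectral : ∀ G → ∑ vs G ≡ 0ℤ →
          ∑ vs (λ b → ∑ vs (λ a → ⟦ r a b ⟧ * G a) * ∑ vs (λ a → ⟦ r a b ⟧ * G a)) ℤ.≤ + L * ∑ vs (λ a → G a * G a)) where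

        module _ (φ : V → Bool) where

          open Cut φ

          -- N times the projection onto functions of sum zero, which avoids division.
          centred : (W → ℤ) → W → ℤ
          centred u a = N * u a - ∑ vs u

          ∑-centred : ∀ u → ∑ vs (centred u) ≡ 0ℤ
          ∑-centred u = trans (∑-- vs _ _) (trans (cong₂ _-_ (∑-*ˡ vs N u) (∑-const vs (∑ vs u))) (ℤₚ.+-inverseʳ (N * ∑ vs u)))

          ∑-centred² : ∀ u → (∀ a → u a * u a ≡ 1ℤ) → ∑ vs (λ a → centred u a * centred u a) ≡ N * (N * N - ∑ vs u * ∑ vs u)
          ∑-centred² u u² = begin
            ∑ vs (λ a → (N * u a - c) * (N * u a - c))
              ≡⟨ ∑-cong vs (λ a → trans (expand N (u a) c) (cong (λ z → N * N * z + (c * c - + 2 * N * c * u a)) (u² a))) ⟩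
            ∑ vs (λ a → N * N * 1ℤ + (c * c - + 2 * N * c * u a))
              ≡⟨ trans (∑-+ vs _ _) (cong₂ _+_ (∑-const vs _) (trans (∑-- vs _ _) (cong₂ _-_ (∑-const vs _) (∑-*ˡ vs (+ 2 * N * c) u)))) ⟩
            N * (N * N * 1ℤ) + (N * (c * c) - + 2 * N * c * c)
              ≡⟨ collect N c ⟩
            N * (N * N - c * c) ∎
            where
            open ≡-Reasoning
            c = ∑ vs u
            expand : ∀ N x c → (N * x - c) * (N * x - c) ≡ N * N * (x * x) + (c * c - + 2 * N * c * x)
            expand = solve-∀
            collect : ∀ N c → N * (N * N * 1ℤ) + (N * (c * c) - + 2 * N * c * c) ≡ N * (N * N - c * c)
            collect = solve-∀

          push : W → ℤ
          push b = ∑ vs (λ a → ⟦ r a b ⟧ * centred s a)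

          P : ℤ
          P = N * B - + k * (σ * τ)

          -- By regularity M multiplies constants by k, so the constant parts of the two centred
          -- functions contribute only multiples of kστ.
          ∑-centred-push : ∑ vs (λ b → centred t b * push b) ≡ N * P
          ∑-centred-push = begin
            ∑ vs (λ b → (N * t b - τ) * push b)
              ≡⟨ ∑-cong vs (λ b → distrib N (t b) τ (push b)) ⟩
            ∑ vs (λ b → N * (t b * push b) - τ * push b)
              ≡⟨ trans (∑-- vs _ _) (cong₂ _-_ (∑-*ˡ vs N _) (∑-*ˡ vs τ push)) ⟩
            N * ∑ vs (λ b → t b * push b) - τ * ∑ vs push
              ≡⟨ cong₂ (λ x y → N * x - τ * y) ∑tpush (trans (∑∑-regular (centred s)) (cong (+ k *_) (∑-centred s))) ⟩
            N * (N * B - σ * (+ k * τ)) - τ * (+ k * 0ℤ)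
              ≡⟨ collect N B σ (+ k) τ ⟩
            N * P ∎
            where
            open ≡-Reasoning
            distrib : ∀ N x c y → (N * x - c) * y ≡ N * (x * y) - c * y
            distrib = solve-∀
            collect : ∀ N B σ k τ → N * (N * B - σ * (k * τ)) - τ * (k * 0ℤ) ≡ N * (N * B - k * (σ * τ))
            collect = solve-∀
            split : ∀ t ρ N s σ → t * (ρ * (N * s - σ)) ≡ N * (ρ * (s * t)) - (ρ * t) * σ
            split = solve-∀
            ∑tpush : ∑ vs (λ b → t b * push b) ≡ N * B - σ * (+ k * τ)
            ∑tpush = begin
              ∑ vs (λ b → t b * push b)
                ≡⟨ ∑-cong vs (λ b → trans (sym (∑-*ˡ vs (t b) _)) (∑-cong vs λ a → split (t b) ⟦ r a b ⟧ N (s a) σ)) ⟩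
              ∑ vs (λ b → ∑ vs (λ a → N * (⟦ r a b ⟧ * (s a * t b)) - (⟦ r a b ⟧ * t b) * σ))
                ≡⟨ ∑-swap vs vs _ ⟩
              ∑ vs (λ a → ∑ vs (λ b → N * (⟦ r a b ⟧ * (s a * t b)) - (⟦ r a b ⟧ * t b) * σ))
                ≡⟨ ∑-cong vs (λ a → trans (∑-- vs _ _) (cong₂ _-_ (∑-*ˡ vs N _) (∑-*ʳ vs σ _))) ⟩
              ∑ vs (λ a → N * ∑ vs (λ b → ⟦ r a b ⟧ * (s a * t b)) - ∑ vs (λ b → ⟦ r a b ⟧ * t b) * σ)
                ≡⟨ trans (∑-- vs _ _) (cong₂ _-_ (∑-*ˡ vs N _) (∑-*ʳ vs σ _)) ⟩
              N * B - ∑ vs (λ a → ∑ vs (λ b → ⟦ r a b ⟧ * t b)) * σ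
                ≡⟨ cong (λ z → N * B - z) (trans (cong (_* σ) regular-t) (ℤₚ.*-comm (+ k * τ) σ)) ⟩
              N * B - σ * (+ k * τ) ∎
              where
              regular-t : ∑ vs (λ a → ∑ vs (λ b → ⟦ r a b ⟧ * t b)) ≡ + k * τ
              regular-t = trans (∑-swap vs vs _) (trans
                (∑-cong∈ vs (λ {b} b∈ → trans (∑-*ʳ vs (t b) _) (cong (_* t b) (regˡ b∈)))) (∑-*ˡ vs (+ k) t))

          -- Cauchy-Schwarz for the centred t and the image of the centred s, then the norm estimate
          -- for that image; the common factor N^2 is cancelled at the end.
          P²≤ : P * P ℤ.≤ + L * ((N * N - σ * σ) * (N * N - τ * τ))
          P²≤ = ℤₚ.0≤i-j⇒j≤i (0≤*⁻ (N * N) (0<* 0<N 0<N) (subst (0ℤ ℤ.≤_) (regroup N P x y (+ L)) (≤⇒0≤ NP²≤)))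
            where
            x = N * N - σ * σ
            y = N * N - τ * τ
            regroup : ∀ N P x y L → (N * y) * (L * (N * x)) - (N * P) * (N * P) ≡ (N * N) * (L * (x * y) - P * P)
            regroup = solve-∀
            0≤∑² : 0ℤ ℤ.≤ ∑ vs (λ b → centred t b * centred t b)
            0≤∑² = ∑-nonneg vs (λ b → 0≤i*i (centred t b))
            NP²≤ : (N * P) * (N * P) ℤ.≤ (N * y) * (+ L * (N * x))
            NP²≤ = begin
              (N * P) * (N * P)
                ≡⟨ cong₂ _*_ ∑-centred-push ∑-centred-push ⟨
              ∑ vs (λ b → centred t b * push b) * ∑ vs (λ b → centred t b * push b)
                ≤⟨ ∑-cauchy-schwarz vs (centred t) push ⟩
              ∑ vs (λ b → centred t b * centred t b) * ∑ vs (λ b → push b * push b)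
                ≤⟨ ℤₚ.*-monoˡ-≤-nonNeg _ {{ℤ.nonNegative 0≤∑²}} (spectral (centred s) (∑-centred s)) ⟩
              ∑ vs (λ b → centred t b * centred t b) * (+ L * ∑ vs (λ a → centred s a * centred s a))
                ≡⟨ cong₂ (λ p q → p * (+ L * q)) (∑-centred² t λ b → sgn² (φ (inj₂ b))) (∑-centred² s λ a → sgn² (φ (inj₁ a))) ⟩
              (N * y) * (+ L * (N * x)) ∎
              where open ℤₚ.≤-Reasoning

          open CutAlgebra (+ k) (+ L) N σ τ B (+ crossing φ) (ℤ.+≤+ z≤n) (ℤ.+≤+ z≤n)
            (subst (+ L ℤ.≤_) (ℤₚ.pos-* k k) (ℤ.+≤+ L≤k²)) 0<N (2crossing (+ k) regʳ) P²≤ using (cut-bound)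

          Bound : ℕ → Set
          Bound m = let x = + k * + m - + 2 * + crossing φ in x ℤ.≤ 0ℤ ⊎ x * x ℤ.≤ + L * (+ m * + m)

          spectral-cut-bound : Bound (smaller φ)
          spectral-cut-bound = Sum.[ side≤other , other≤side ]′ (ℕₚ.≤-total (side φ) other)
            where
            sum : ∀ N σ τ → ((N + σ) + (N + τ)) + ((N - σ) + (N - τ)) ≡ + 2 * (+ 2 * N)
            sum = solve-∀
            total : + side φ + + other ≡ + 2 * N
            total = ℤₚ.*-cancelˡ-≡ (+ 2) (+ side φ + + other) (+ 2 * N)
              (trans (ℤₚ.*-distribˡ-+ (+ 2) (+ side φ) (+ other)) (trans (cong₂ _+_ 2side 2other) (sum N σ τ)))
            side≤other : side φ ℕ.≤ other → Bound (smaller φ)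
            side≤other le = subst Bound (sym (ℕₚ.m≤n⇒m⊓n≡m le))
              (cut-bound (+ side φ) (+ other) (ℤ.+≤+ z≤n) (ℤ.+≤+ le) (inj₁ 2side) total)
            other≤side : other ℕ.≤ side φ → Bound (smaller φ)
            other≤side le = subst Bound (sym (ℕₚ.m≥n⇒m⊓n≡n le))
              (cut-bound (+ other) (+ side φ) (ℤ.+≤+ z≤n) (ℤ.+≤+ le) (inj₂ 2other) (trans (ℤₚ.+-comm (+ other) (+ side φ)) total))

-- Translation of integer inequalities into ℚ and into `≤√`.

module RationalBounds where

  open import Data.Integer as ℤ using (ℤ; +_; 0ℤ; 1ℤ)
  open import Data.Rational as ℚ using (ℚ; 0ℚ; 1ℚ; ½; _+_; _*_; _-_; -_; toℚᵘ)
  open import Data.Rational.Solver using (module +-*-Solver)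
  open import Data.Rational.Unnormalised as ℚᵘ using (ℚᵘ; mkℚᵘ; *≡*; *≤*)
  import Data.Rational.Unnormalised.Properties as ℚᵘₚ

  ι : ℤ → ℚ
  ι i = i ℚ./ 1

  toℚᵘ-/ : ∀ i d → toℚᵘ (i ℚ./ suc d) ℚᵘ.≃ mkℚᵘ i d
  toℚᵘ-/ i d = ℚₚ.toℚᵘ-fromℚᵘ (mkℚᵘ i d)

  -- Checked on unnormalised fractions, where equality is a cross-multiplied identity in ℤ.
  ι-+ : ∀ i j → ι (i ℤ.+ j) ≡ ι i + ι j
  ι-+ i j = ℚₚ.toℚᵘ-injective (ℚᵘₚ.≃-trans (toℚᵘ-/ (i ℤ.+ j) 0) (ℚᵘₚ.≃-sym (ℚᵘₚ.≃-trans (ℚₚ.toℚᵘ-homo-+ (ι i) (ι j))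
    (ℚᵘₚ.≃-trans (ℚᵘₚ.+-cong (toℚᵘ-/ i 0) (toℚᵘ-/ j 0)) (*≡* (lemma i j))))))
    where
    lemma : ∀ i j → (i ℤ.* 1ℤ ℤ.+ j ℤ.* 1ℤ) ℤ.* 1ℤ ≡ (i ℤ.+ j) ℤ.* (1ℤ ℤ.* 1ℤ)
    lemma = solve-∀

  ι-* : ∀ i j → ι (i ℤ.* j) ≡ ι i * ι j
  ι-* i j = ℚₚ.toℚᵘ-injective (ℚᵘₚ.≃-trans (toℚᵘ-/ (i ℤ.* j) 0) (ℚᵘₚ.≃-sym (ℚᵘₚ.≃-trans (ℚₚ.toℚᵘ-homo-* (ι i) (ι j))
    (ℚᵘₚ.≃-trans (ℚᵘₚ.*-cong (toℚᵘ-/ i 0) (toℚᵘ-/ j 0)) (*≡* (lemma i j))))))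
    where
    lemma : ∀ i j → (i ℤ.* j) ℤ.* 1ℤ ≡ (i ℤ.* j) ℤ.* (1ℤ ℤ.* 1ℤ)
    lemma = solve-∀

  ι-neg : ∀ i → ι (ℤ.- i) ≡ - ι i
  ι-neg i = ℚₚ.toℚᵘ-injective (ℚᵘₚ.≃-trans (toℚᵘ-/ (ℤ.- i) 0)
    (ℚᵘₚ.≃-sym (ℚᵘₚ.≃-trans (ℚₚ.toℚᵘ-homo‿- (ι i)) (ℚᵘₚ.-‿cong (toℚᵘ-/ i 0)))))

  ι-- : ∀ i j → ι (i ℤ.- j) ≡ ι i - ι j
  ι-- i j = trans (ι-+ i (ℤ.- j)) (cong (λ z → ι i + z) (ι-neg j))

  ι-mono-≤ : ∀ {i j} → i ℤ.≤ j → ι i ℚ.≤ ι j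
  ι-mono-≤ {i} {j} h = ℚₚ.toℚᵘ-cancel-≤ (ℚᵘₚ.≤-respˡ-≃ (ℚᵘₚ.≃-sym (toℚᵘ-/ i 0)) (ℚᵘₚ.≤-respʳ-≃ (ℚᵘₚ.≃-sym (toℚᵘ-/ j 0))
    (*≤* (ℤₚ.*-monoʳ-≤-nonNeg 1ℤ h))))

  /-* : ∀ i d → (i ℚ./ suc d) * ι (+ suc d) ≡ ι i
  /-* i d = ℚₚ.toℚᵘ-injective (ℚᵘₚ.≃-trans (ℚₚ.toℚᵘ-homo-* (i ℚ./ suc d) (ι (+ suc d)))
    (ℚᵘₚ.≃-trans (ℚᵘₚ.*-cong (toℚᵘ-/ i d) (toℚᵘ-/ (+ suc d) 0)) (ℚᵘₚ.≃-trans (*≡* (lemma i (+ suc d))) (ℚᵘₚ.≃-sym (toℚᵘ-/ i 0)))))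
    where
    lemma : ∀ i d → (i ℤ.* d) ℤ.* 1ℤ ≡ i ℤ.* (d ℤ.* 1ℤ)
    lemma = solve-∀

  ι-positive : ∀ d → ℚ.Positive (ι (+ suc d))
  ι-positive d = ℚₚ.normalize-pos (suc d) 1

  ι-cancelʳ-≡ : ∀ d {x y} → x * ι (+ suc d) ≡ y * ι (+ suc d) → x ≡ y
  ι-cancelʳ-≡ d {x} {y} e = ℚₚ.≤-antisym
    (ℚₚ.*-cancelʳ-≤-pos (ι (+ suc d)) {{ι-positive d}} (ℚₚ.≤-reflexive e))
    (ℚₚ.*-cancelʳ-≤-pos (ι (+ suc d)) {{ι-positive d}} (ℚₚ.≤-reflexive (sym e)))

  ratio-≤√ : ∀ k L e d → let X = (+ k) ℤ.* (+ suc d) ℤ.- + 2 ℤ.* + e ; c = + e ℚ./ suc d in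
    X ℤ.≤ 0ℤ ⊎ X ℤ.* X ℤ.≤ + L ℤ.* (+ suc d ℤ.* + suc d) → (ℕ→ℚ k - (c + c)) ≤√ L
  ratio-≤√ k L e d = λ { (inj₁ h) → inj₁ (nonpos h) ; (inj₂ h) → inj₂ (small h) }
    where
    M c y : ℚ
    M = ι (+ suc d)
    c = + e ℚ./ suc d
    y = ℕ→ℚ k - (c + c)
    X : ℤ
    X = (+ k) ℤ.* (+ suc d) ℤ.- + 2 ℤ.* + e
    instance
      M-pos : ℚ.Positive M
      M-pos = ι-positive d
    open +-*-Solver
    yM : y * M ≡ ι X
    yM = begin
      (ℕ→ℚ k - (c + c)) * M ≡⟨ solve 3 (λ k c M → (k :- (c :+ c)) :* M := k :* M :- (c :* M :+ c :* M)) refl (ℕ→ℚ k) c M ⟩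
      ℕ→ℚ k * M - (c * M + c * M)                 ≡⟨ cong (λ z → ℕ→ℚ k * M - (z + z)) (/-* (+ e) d) ⟩
      ℕ→ℚ k * M - (ι (+ e) + ι (+ e))             ≡⟨ cong₂ _-_ (sym (ι-* (+ k) (+ suc d))) (sym (ι-+ (+ e) (+ e))) ⟩
      ι ((+ k) ℤ.* (+ suc d)) - ι (+ e ℤ.+ + e)   ≡⟨ ι-- ((+ k) ℤ.* (+ suc d)) (+ e ℤ.+ + e) ⟨
      ι ((+ k) ℤ.* (+ suc d) ℤ.- (+ e ℤ.+ + e))   ≡⟨ cong (λ z → ι ((+ k) ℤ.* (+ suc d) ℤ.- z)) (double (+ e)) ⟩
      ι X                                         ∎
      where
      open ≡-Reasoning
      double : ∀ i → i ℤ.+ i ≡ + 2 ℤ.* i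
      double = solve-∀
    nonpos : X ℤ.≤ 0ℤ → y ℚ.≤ 0ℚ
    nonpos h = ℚₚ.*-cancelʳ-≤-pos M (subst₂ ℚ._≤_ (sym yM) (sym (ℚₚ.*-zeroˡ M)) (ι-mono-≤ h))
    small : X ℤ.* X ℤ.≤ + L ℤ.* (+ suc d ℤ.* + suc d) → y * y ℚ.≤ ℕ→ℚ L
    small h = ℚₚ.*-cancelʳ-≤-pos M (ℚₚ.*-cancelʳ-≤-pos M (subst₂ ℚ._≤_ lhs rhs (ι-mono-≤ h)))
      where
      lhs : ι (X ℤ.* X) ≡ y * y * M * M
      lhs = trans (ι-* X X) (trans (cong₂ _*_ (sym yM) (sym yM))
        (solve 2 (λ y M → (y :* M) :* (y :* M) := y :* y :* M :* M) refl y M))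
      rhs : ι (+ L ℤ.* (+ suc d ℤ.* + suc d)) ≡ ℕ→ℚ L * M * M
      rhs = trans (ι-* (+ L) _) (trans (cong (ℕ→ℚ L *_) (ι-* (+ suc d) (+ suc d))) (sym (ℚₚ.*-assoc (ℕ→ℚ L) M M)))

  ½-ratio : ∀ k ℓ e d → + 2 ℤ.* + e ≡ (+ k) ℤ.* (+ suc d) ℤ.- (+ ℓ) ℤ.* (+ suc d) → + e ℚ./ suc d ≡ ½ * (ℕ→ℚ k - ℕ→ℚ ℓ)
  ½-ratio k ℓ e d h = ι-cancelʳ-≡ d (begin
      (+ e ℚ./ suc d) * M             ≡⟨ /-* (+ e) d ⟩
      ι (+ e)                         ≡⟨ solve 1 (λ x → x := con ½ :* (con (ι (+ 2)) :* x)) refl (ι (+ e)) ⟩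
      ½ * (ι (+ 2) * ι (+ e)) ≡⟨ cong (½ *_) (trans (sym (ι-* (+ 2) (+ e))) (trans (cong ι h) (ι-- ((+ k) ℤ.* (+ suc d)) ((+ ℓ) ℤ.* (+ suc d))))) ⟩
      ½ * (ι ((+ k) ℤ.* (+ suc d)) - ι ((+ ℓ) ℤ.* (+ suc d))) ≡⟨ cong₂ (λ a b → ½ * (a - b)) (ι-* (+ k) (+ suc d)) (ι-* (+ ℓ) (+ suc d)) ⟩
      ½ * (ℕ→ℚ k * M - ℕ→ℚ ℓ * M) ≡⟨ solve 3 (λ k l M → con ½ :* (k :* M :- l :* M) := con ½ :* (k :- l) :* M) refl (ℕ→ℚ k) (ℕ→ℚ ℓ) M ⟩
      ½ * (ℕ→ℚ k - ℕ→ℚ ℓ) * M         ∎)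
    where
    open ≡-Reasoning
    open +-*-Solver
    M : ℚ
    M = ι (+ suc d)

  -- Where the bound on the norm is a perfect square the lower bound becomes rational and can meet
  -- the upper one.
  ≤√-square : ∀ ℓ {x} → x ≤√ (ℓ ℕ.* ℓ) → x ℚ.≤ ℕ→ℚ ℓ
  ≤√-square ℓ (inj₁ h) = ℚₚ.≤-trans h (ι-mono-≤ {0ℤ} {+ ℓ} (ℤ.+≤+ z≤n))
  ≤√-square ℓ {x} (inj₂ h) = ℚₚ.≮⇒≥ λ ℓ<x → ℚₚ.<-irrefl refl (ℚₚ.<-≤-trans (square< ℓ<x) (subst (x * x ℚ.≤_) (trans (cong ι (ℤₚ.pos-* ℓ ℓ)) (ι-* (+ ℓ) (+ ℓ))) h))
    where
    square< : ℕ→ℚ ℓ ℚ.< x → ℕ→ℚ ℓ * ℕ→ℚ ℓ ℚ.< x * x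
    square< ℓ<x = ℚₚ.≤-<-trans
      (ℚₚ.*-monoˡ-≤-nonNeg (ℕ→ℚ ℓ) {{ℚ.nonNegative 0≤ℓ}} (ℚₚ.<⇒≤ ℓ<x))
      (ℚₚ.*-monoˡ-<-pos x {{ℚ.positive (ℚₚ.≤-<-trans 0≤ℓ ℓ<x)}} ℓ<x)
      where
      0≤ℓ : 0ℚ ℚ.≤ ℕ→ℚ ℓ
      0≤ℓ = ι-mono-≤ {0ℤ} {+ ℓ} (ℤ.+≤+ z≤n)

  k-2c≤ℓ⇒½≤c : ∀ k ℓ c → k - (c + c) ℚ.≤ ℓ → ½ * (k - ℓ) ℚ.≤ c
  k-2c≤ℓ⇒½≤c k ℓ c h = subst₂ ℚ._≤_
      (solve 3 (λ k l c → con ½ :* ((k :- (c :+ c)) :+ ((c :+ c) :- l)) := con ½ :* (k :- l)) refl k ℓ c)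
      (solve 2 (λ l c → con ½ :* (l :+ ((c :+ c) :- l)) := c) refl ℓ c)
      (ℚₚ.*-monoˡ-≤-nonNeg ½ (ℚₚ.+-monoˡ-≤ ((c + c) - ℓ) h))
    where open +-*-Solver

  -- Positivity of d keeps clear of the convention that division by 0 gives 0.
  ÷ℕ-exact : ∀ a d k → k ℕ.* d ℕ.+ 1 ≡ a → 0 ℕ.< d → (ℕ→ℚ a - 1ℚ) ÷ℕ d ≡ ℕ→ℚ k
  ÷ℕ-exact a (suc d) k e _ = begin
      (ℕ→ℚ a - 1ℚ) * (+ 1 ℚ./ suc d)                    ≡⟨ cong (λ z → (z - 1ℚ) * c) a≡ ⟩
      (ℕ→ℚ k * M + 1ℚ - 1ℚ) * c ≡⟨ solve 3 (λ k M c → (k :* M :+ con 1ℚ :- con 1ℚ) :* c := k :* (c :* M)) refl (ℕ→ℚ k) M c ⟩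
      ℕ→ℚ k * (c * M)                                   ≡⟨ cong (ℕ→ℚ k *_) (/-* (+ 1) d) ⟩
      ℕ→ℚ k * 1ℚ                                        ≡⟨ ℚₚ.*-identityʳ (ℕ→ℚ k) ⟩
      ℕ→ℚ k                                             ∎
    where
    open ≡-Reasoning
    open +-*-Solver
    M c : ℚ
    M = ι (+ suc d)
    c = + 1 ℚ./ suc d
    a≡ : ℕ→ℚ a ≡ ℕ→ℚ k * M + 1ℚ
    a≡ = trans (cong ℕ→ℚ (sym e)) (trans (cong ι (ℤₚ.pos-+ (k ℕ.* suc d) 1)) (trans (ι-+ (+ (k ℕ.* suc d)) 1ℤ)
      (cong (_+ 1ℚ) (trans (cong ι (ℤₚ.pos-* k (suc d))) (ι-* (+ k) (+ suc d))))))

-- Upper and lower bounds for `iso` of a regular bipartite graph.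

module IsoBounds where

  open FiniteSums
  open Isoperimetry
  open BipartiteCuts
  open RationalBounds
  open import Data.Integer as ℤ using (ℤ; +_; 0ℤ)
  open import Data.Rational as ℚ using (ℚ; ½)

  module Bounds (F : FiniteField) (n : ℕ) (vs : List (Vec (FiniteField.Carrier F) n))
    (r : Vec (FiniteField.Carrier F) n → Vec (FiniteField.Carrier F) n → Bool) (vs-unique : Unique vs) where

    open BipartiteGraph F n vs r

    verts-unique : Unique (FinGraph.verts X)
    verts-unique = Unique.++⁺ (Unique.map⁺ inj₁-injective vs-unique) (Unique.map⁺ inj₂-injective vs-unique)
      λ (p , q) → disjoint (∈-map⁻ inj₁ p) (∈-map⁻ inj₂ q)
      where
      disjoint : ∀ {A B : Set} {v} {P : A → Set} {Q : B → Set} → (∃ λ a → P a × v ≡ inj₁ a) → (∃ λ b → Q b × v ≡ inj₂ b) → ⊥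
      disjoint (_ , _ , refl) (_ , _ , ())

    length-suc : 0ℤ ℤ.< N → ∃ λ m → length vs ≡ suc m
    length-suc h = go (length vs) h
      where
      go : ∀ l → 0ℤ ℤ.< + l → ∃ λ m → l ≡ suc m
      go zero (ℤ.+<+ ())
      go (suc m) _ = m , refl

    module RegularBounds (k : ℕ) (0<N : 0ℤ ℤ.< N)
      (regˡ : ∀ {b} → b ∈ vs → ∑ vs (λ a → ⟦ r a b ⟧) ≡ + k) (regʳ : ∀ {a} → a ∈ vs → ∑ vs (λ b → ⟦ r a b ⟧) ≡ + k) where

      open Regular k 0<N regˡ regʳ

      iso-≤½ : ∀ (f g : W → Bool) ℓ → 0 ℕ.< ℓ → ∑ vs (sgn ∘ f) ≡ 0ℤ →
        (∀ {b} → b ∈ vs → ∑ vs (λ a → ⟦ r a b ⟧ ℤ.* sgn (f a)) ≡ + ℓ ℤ.* sgn (g b)) →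
        iso X ℚ.≤ ½ ℚ.* (ℕ→ℚ k ℚ.- ℕ→ℚ ℓ)
      iso-≤½ f g ℓ 0<ℓ ∑f≡0 eigen = go (length-suc 0<N)
        where
        open Eigencut f g ℓ 0<ℓ ∑f≡0 eigen
        go : (∃ λ m → length vs ≡ suc m) → iso X ℚ.≤ ½ ℚ.* (ℕ→ℚ k ℚ.- ℕ→ℚ ℓ)
        go (m , e) = ℚₚ.≤-trans (iso-≤ φ m (trans smaller≡ e))
          (ℚₚ.≤-reflexive (½-ratio k ℓ (crossing φ) m
            (trans 2crossing≡ (cong (λ l → (+ k) ℤ.* (+ l) ℤ.- (+ ℓ) ℤ.* (+ l)) e))))

      iso-≤√ : ∀ L → L ℕ.≤ k ℕ.* k →
        (∀ G → ∑ vs G ≡ 0ℤ → ∑ vs (λ b → ∑ vs (λ a → ⟦ r a b ⟧ ℤ.* G a) ℤ.* ∑ vs (λ a → ⟦ r a b ⟧ ℤ.* G a)) ℤ.≤ + L ℤ.* ∑ vs (λ a → G a ℤ.* G a)) →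
        (ℕ→ℚ k ℚ.- (iso X ℚ.+ iso X)) ≤√ L
      iso-≤√ L L≤k² spectral = finish (iso-attained (⊎-≡-dec dec dec) verts-unique (first (length-suc 0<N)))
        where
        open Spectral L L≤k² spectral
        dec = Vecₚ.≡-dec (FiniteField._≟_ F)
        first : (∃ λ m → length vs ≡ suc m) → ∃₂ λ φ m → smaller φ ≡ suc m
        first (m , e) = bipartition , m , trans smaller-bipartition e
        finish : (∃₂ λ φ m → smaller φ ≡ suc m × iso X ≡ + crossing φ ℚ./ suc m) → (ℕ→ℚ k ℚ.- (iso X ℚ.+ iso X)) ≤√ L
        finish (φ , m , e , iso≡) = subst (λ c → (ℕ→ℚ k ℚ.- (c ℚ.+ c)) ≤√ L) (sym iso≡)
          (ratio-≤√ k L (crossing φ) m (subst (Bound φ) e (spectral-cut-bound φ)))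

-- Counting solutions of linear equations, and the matrix M Mᵗ.

module Counting where

  open FiniteSums
  open FieldTheory
  open Vectors
  open import Data.Integer as ℤ using (ℤ; +_; 0ℤ; 1ℤ; _+_; _*_; _-_; -_)

  ⟦yes⟧ : ∀ {P : Set} (d : Dec P) → P → ⟦ does d ⟧ ≡ 1ℤ
  ⟦yes⟧ (yes _) _ = refl
  ⟦yes⟧ (no n) p = contradiction p n

  ⟦no⟧ : ∀ {P : Set} (d : Dec P) → ¬ P → ⟦ does d ⟧ ≡ 0ℤ
  ⟦no⟧ (yes p) n = contradiction p n
  ⟦no⟧ (no _) _ = refl

  ⟦⇔⟧ : ∀ {P Q : Set} (d : Dec P) (e : Dec Q) → (P → Q) → (Q → P) → ⟦ does d ⟧ ≡ ⟦ does e ⟧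
  ⟦⇔⟧ (yes p) (yes q) f g = refl
  ⟦⇔⟧ (yes p) (no n) f g = contradiction (f p) n
  ⟦⇔⟧ (no n) (yes q) f g = contradiction (g q) n
  ⟦⇔⟧ (no _) (no _) f g = refl

  ⟦⟧² : ∀ b → ⟦ b ⟧ * ⟦ b ⟧ ≡ ⟦ b ⟧
  ⟦⟧² true = refl
  ⟦⟧² false = refl

  module _ {A B : Set} (xs : List A) (ys : List B) where

    -- The squared norm of the image of G, rewritten as a quadratic form in G whose kernel counts
    -- common neighbours.
    ∑-square : ∀ (w : A → B → ℤ) (G : A → ℤ) →
      ∑ ys (λ b → ∑ xs (λ a → w a b * G a) * ∑ xs (λ a → w a b * G a))
        ≡ ∑ xs (λ a → ∑ xs (λ a' → G a * G a' * ∑ ys (λ b → w a b * w a' b)))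
    ∑-square w G = begin
      ∑ ys (λ b → ∑ xs (λ a → w a b * G a) * ∑ xs (λ a → w a b * G a))
        ≡⟨ ∑-cong ys (λ b → ∑-*-∑ xs xs _ _) ⟩
      ∑ ys (λ b → ∑ xs (λ a → ∑ xs (λ a' → w a b * G a * (w a' b * G a'))))
        ≡⟨ ∑-swap ys xs _ ⟩
      ∑ xs (λ a → ∑ ys (λ b → ∑ xs (λ a' → w a b * G a * (w a' b * G a'))))
        ≡⟨ ∑-cong xs (λ a → ∑-swap ys xs _) ⟩
      ∑ xs (λ a → ∑ xs (λ a' → ∑ ys (λ b → w a b * G a * (w a' b * G a'))))
        ≡⟨ ∑-cong xs (λ a → ∑-cong xs λ a' → trans (∑-cong ys λ b → shuffle (w a b) (G a) (w a' b) (G a')) (∑-*ˡ ys (G a * G a') _)) ⟩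
      ∑ xs (λ a → ∑ xs (λ a' → G a * G a' * ∑ ys (λ b → w a b * w a' b))) ∎
      where
      open ≡-Reasoning
      shuffle : ∀ w g w' g' → w * g * (w' * g') ≡ g * g' * (w * w')
      shuffle = solve-∀

  module Count (F : FiniteField) where

    module 𝔽 = Field F
    open Field F using (Carrier; 0#; 1#; _≟_; elems; card; zeros; listing; _⁻¹[_])
    open VectorSpace F

    q : ℤ
    q = + card

    infix 4 _≐_
    _≐_ : Carrier → Carrier → ℤ
    x ≐ y = ⟦ does (x ≟ y) ⟧

    isZeroᵛ : ∀ {n} → Vec Carrier n → ℤ
    isZeroᵛ v = ⟦ does (v ≟ᵛ zeros _) ⟧

    ∑ᵛ : ∀ n → (Vec Carrier n → ℤ) → ℤ
    ∑ᵛ n = ∑ (allVecs F n)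

    ∑ᶠ : (Carrier → ℤ) → ℤ
    ∑ᶠ = ∑ elems

    ∑ᶠ-const : ∀ c → ∑ᶠ (λ _ → c) ≡ q * c
    ∑ᶠ-const = ∑-const elems

    ∑ᵛ-const : ∀ n c → ∑ᵛ n (λ _ → c) ≡ + (card ℕ.^ n) * c
    ∑ᵛ-const n c = trans (∑-const (allVecs F n) c) (cong (λ l → + l * c) (length-allVecs n))

    -- Rescaling usually makes all nonzero scalars contribute the same amount c; the counts below
    -- are separated in this way.
    ∑ᶠ-split : ∀ (h : Carrier → ℤ) c → (∀ t → t ≢ 0# → h t ≡ c) → ∑ᶠ h ≡ h 0# + (q - 1ℤ) * c
    ∑ᶠ-split h c e = begin
      ∑ᶠ h                                     ≡⟨ ∑-cong elems pointwise ⟩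
      ∑ᶠ (λ t → c + (t ≐ 0#) * (h 0# - c))     ≡⟨ ∑-+ elems (λ _ → c) _ ⟩
      ∑ᶠ (λ _ → c) + ∑ᶠ (λ t → (t ≐ 0#) * (h 0# - c))
        ≡⟨ cong₂ _+_ (∑ᶠ-const c) (∑-point listing 0# _ λ t t≢0 → cong (_* (h 0# - c)) (⟦no⟧ (t ≟ 0#) t≢0)) ⟩
      q * c + (0# ≐ 0#) * (h 0# - c)           ≡⟨ cong (λ z → q * c + z * (h 0# - c)) (⟦yes⟧ (0# ≟ 0#) refl) ⟩
      q * c + 1ℤ * (h 0# - c)                  ≡⟨ collect q c (h 0#) ⟩
      h 0# + (q - 1ℤ) * c                      ∎
      where
      open ≡-Reasoning
      collect : ∀ q c x → q * c + 1ℤ * (x - c) ≡ x + (q - 1ℤ) * c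
      collect = solve-∀
      at0 : ∀ c x → x ≡ c + 1ℤ * (x - c)
      at0 = solve-∀
      off0 : ∀ c x → c ≡ c + 0ℤ * (x - c)
      off0 = solve-∀
      pointwise : ∀ t → h t ≡ c + (t ≐ 0#) * (h 0# - c)
      pointwise t with t ≟ 0#
      ... | yes refl = at0 c (h 0#)
      ... | no t≢0 = trans (e t t≢0) (off0 c (h 0#))

    dot-comm : ∀ {n} (a b : Vec Carrier n) → dot F a b ≡ dot F b a
    dot-comm [] [] = refl
    dot-comm (x ∷ a) (y ∷ b) = cong₂ 𝔽._+_ (𝔽.*-comm x y) (dot-comm a b)

    dot-⊕ : ∀ {n} (a a' b : Vec Carrier n) → dot F (a ⊕ a') b ≡ dot F a b 𝔽.+ dot F a' b
    dot-⊕ [] [] [] = sym (𝔽.+-identityˡ 0#)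
    dot-⊕ (x ∷ a) (x' ∷ a') (y ∷ b) = trans (cong₂ 𝔽._+_ (𝔽.distribʳ y x x') (dot-⊕ a a' b))
      (BigOp.interchange 𝔽.+-isCommutativeMonoid (x 𝔽.* y) (x' 𝔽.* y) (dot F a b) (dot F a' b))

    dot-⊙ : ∀ {n} c (a b : Vec Carrier n) → dot F (c ⊙ a) b ≡ c 𝔽.* dot F a b
    dot-⊙ c [] [] = sym (𝔽.zeroʳ c)
    dot-⊙ c (x ∷ a) (y ∷ b) = trans (cong₂ 𝔽._+_ (𝔽.*-assoc c x y) (dot-⊙ c a b)) (sym (𝔽.distribˡ c _ _))

    dot-⊙ʳ : ∀ {n} c (a b : Vec Carrier n) → dot F a (c ⊙ b) ≡ c 𝔽.* dot F a b
    dot-⊙ʳ c a b = trans (dot-comm a (c ⊙ b)) (trans (dot-⊙ c b a) (cong (c 𝔽.*_) (dot-comm b a)))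

    dot-zerosˡ : ∀ {n} (b : Vec Carrier n) → dot F (zeros n) b ≡ 0#
    dot-zerosˡ {n} b = trans (cong (λ a → dot F a b) (sym (⊙-zeroˡ (zeros n)))) (trans (dot-⊙ 0# (zeros n) b) (𝔽.zeroˡ _))

    dot-zerosʳ : ∀ {n} (a : Vec Carrier n) → dot F a (zeros n) ≡ 0#
    dot-zerosʳ a = trans (dot-comm a _) (dot-zerosˡ a)

    ∑ᵛ-scale : ∀ {n} c → c ≢ 0# → (f : Vec Carrier n → ℤ) → ∑ᵛ n (λ v → f (c ⊙ v)) ≡ ∑ᵛ n f
    ∑ᵛ-scale {n} c c≢0 = ∑-reindex (vecListing n) (c ⊙_) (c ⁻¹[ c≢0 ] ⊙_) (⊙-cancel (𝔽.inverseˡ c c≢0)) (⊙-cancel (𝔽.inverseʳ c c≢0))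

    ∑ᶠ-scale : ∀ c → c ≢ 0# → (f : Carrier → ℤ) → ∑ᶠ (λ t → f (c 𝔽.* t)) ≡ ∑ᶠ f
    ∑ᶠ-scale c c≢0 = ∑-reindex listing (c 𝔽.*_) (c ⁻¹[ c≢0 ] 𝔽.*_) (𝔽.y*[x*z] (𝔽.inverseˡ c c≢0)) (𝔽.y*[x*z] (𝔽.inverseʳ c c≢0))

    ∑ᶠ-affine : ∀ x d s → x ≢ 0# → ∑ᶠ (λ y → x 𝔽.* y 𝔽.+ d ≐ s) ≡ 1ℤ
    ∑ᶠ-affine x d s x≢0 = trans (∑-point listing y₀ (λ y → x 𝔽.* y 𝔽.+ d ≐ s)
        λ y y≢ → ⟦no⟧ ((x 𝔽.* y 𝔽.+ d) ≟ s) λ e → y≢ (𝔽.*-cancelˡ x x≢0 (𝔽.+-cancelʳ d _ _ (trans e (sym root)))))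
        (⟦yes⟧ ((x 𝔽.* y₀ 𝔽.+ d) ≟ s) root)
      where
      y₀ : Carrier
      y₀ = x ⁻¹[ x≢0 ] 𝔽.* (s 𝔽.+ 𝔽.- d)
      root : x 𝔽.* y₀ 𝔽.+ d ≡ s
      root = trans (cong (𝔽._+ d) (𝔽.y*[x*z] (𝔽.inverseʳ x x≢0) _)) (trans (𝔽.+-assoc s _ d)
        (trans (cong (s 𝔽.+_) (𝔽.-‿inverseˡ d)) (𝔽.+-identityʳ s)))

    -- The equation is solved for the coordinate of b that faces the first nonzero entry of a; all
    -- the other coordinates are free.
    hyperplane : ∀ m (a : Vec Carrier (suc m)) s → a ≢ zeros (suc m) → ∑ᵛ (suc m) (λ b → dot F a b ≐ s) ≡ + (card ℕ.^ m)
    hyperplane m (x ∷ a) s a≢0 with x ≟ 0#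
    ... | no x≢0 = begin
      ∑ᵛ (suc m) (λ b → dot F (x ∷ a) b ≐ s)                      ≡⟨ ∑-allVecs-suc m _ ⟩
      ∑ᶠ (λ y → ∑ᵛ m (λ b → x 𝔽.* y 𝔽.+ dot F a b ≐ s))          ≡⟨ ∑-swap elems (allVecs F m) _ ⟩
      ∑ᵛ m (λ b → ∑ᶠ (λ y → x 𝔽.* y 𝔽.+ dot F a b ≐ s)) ≡⟨ ∑-cong (allVecs F m) (λ b → ∑ᶠ-affine x (dot F a b) s x≢0) ⟩
      ∑ᵛ m (λ b → 1ℤ)                                             ≡⟨ trans (∑ᵛ-const m 1ℤ) (ℤₚ.*-identityʳ _) ⟩
      + (card ℕ.^ m)                                              ∎
      where open ≡-Reasoning
    hyperplane zero (x ∷ []) s a≢0 | yes refl = contradiction refl a≢0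
    hyperplane (suc m) (x ∷ a) s a≢0 | yes refl = begin
      ∑ᵛ (suc (suc m)) (λ b → dot F (0# ∷ a) b ≐ s)               ≡⟨ ∑-allVecs-suc (suc m) _ ⟩
      ∑ᶠ (λ y → ∑ᵛ (suc m) (λ b → 0# 𝔽.* y 𝔽.+ dot F a b ≐ s))
        ≡⟨ ∑-cong elems (λ y → ∑-cong (allVecs F (suc m)) λ b → cong (_≐ s) (trans (cong (𝔽._+ dot F a b) (𝔽.zeroˡ y)) (𝔽.+-identityˡ _))) ⟩
      ∑ᶠ (λ y → ∑ᵛ (suc m) (λ b → dot F a b ≐ s)) ≡⟨ ∑-cong elems (λ _ → hyperplane m a s (λ e → a≢0 (cong (0# ∷_) e))) ⟩
      ∑ᶠ (λ y → + (card ℕ.^ m))                                   ≡⟨ ∑ᶠ-const _ ⟩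
      q * + (card ℕ.^ m)                                          ≡⟨ ℤₚ.pos-* card (card ℕ.^ m) ⟨
      + (card ℕ.^ suc m)                                          ∎
      where open ≡-Reasoning

    q-1≢0 : q - 1ℤ ≢ 0ℤ
    q-1≢0 e = ℕₚ.<⇒≢ (𝔽.card≥2) (sym (ℤₚ.+-injective (ℤₚ.i-j≡0⇒i≡j q 1ℤ e)))

    q≢0 : q ≢ 0ℤ
    q≢0 e = ℕₚ.<⇒≢ (ℕₚ.<-trans (s≤s z≤n) 𝔽.card≥2) (sym (ℤₚ.+-injective e))

    cancel-q-1 : ∀ {x y} → (q - 1ℤ) * x ≡ (q - 1ℤ) * y → x ≡ y
    cancel-q-1 {x} {y} = ℤₚ.*-cancelˡ-≡ (q - 1ℤ) x y {{ℤ.≢-nonZero q-1≢0}}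

    cancel-q : ∀ {x y} → q * x ≡ q * y → x ≡ y
    cancel-q {x} {y} = ℤₚ.*-cancelˡ-≡ q x y {{ℤ.≢-nonZero q≢0}}

    -- One linear condition on (s, t) leaves a line of q pairs, except that x = y = 0 leaves all
    -- q^2.
    ∑ᶠ-linear : ∀ x y → ∑ᶠ (λ s → ∑ᶠ (λ t → s 𝔽.* x 𝔽.+ t 𝔽.* y ≐ 0#)) ≡ q + (q * q - q) * ((x ≐ 0#) * (y ≐ 0#))
    ∑ᶠ-linear x y with x ≟ 0# | y ≟ 0#
    ... | yes refl | yes refl = trans (∑-cong elems λ s → ∑-cong elems λ t → ⟦yes⟧ ((s 𝔽.* 0# 𝔽.+ t 𝔽.* 0#) ≟ 0#) (trans (cong₂ 𝔽._+_ (𝔽.zeroʳ s) (𝔽.zeroʳ t)) (𝔽.+-identityˡ 0#)))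
        (trans (∑-cong elems λ _ → ∑ᶠ-const 1ℤ) (trans (∑ᶠ-const (q * 1ℤ)) (both q)))
      where
      both : ∀ q → q * (q * 1ℤ) ≡ q + (q * q - q) * (1ℤ * 1ℤ)
      both = solve-∀
    ... | no x≢0 | d = begin
      ∑ᶠ (λ s → ∑ᶠ (λ t → s 𝔽.* x 𝔽.+ t 𝔽.* y ≐ 0#))   ≡⟨ ∑-swap elems elems _ ⟩
      ∑ᶠ (λ t → ∑ᶠ (λ s → s 𝔽.* x 𝔽.+ t 𝔽.* y ≐ 0#))
        ≡⟨ ∑-cong elems (λ t → trans (∑-cong elems λ s → cong (λ z → z 𝔽.+ t 𝔽.* y ≐ 0#) (𝔽.*-comm s x)) (∑ᶠ-affine x (t 𝔽.* y) 0# x≢0)) ⟩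
      ∑ᶠ (λ t → 1ℤ)                                     ≡⟨ ∑ᶠ-const 1ℤ ⟩
      q * 1ℤ                                            ≡⟨ one q ⟦ does d ⟧ ⟩
      q + (q * q - q) * (0ℤ * ⟦ does d ⟧)               ∎
      where
      open ≡-Reasoning
      one : ∀ q z → q * 1ℤ ≡ q + (q * q - q) * (0ℤ * z)
      one = solve-∀
    ... | yes refl | no y≢0 = begin
      ∑ᶠ (λ s → ∑ᶠ (λ t → s 𝔽.* 0# 𝔽.+ t 𝔽.* y ≐ 0#))
        ≡⟨ ∑-cong elems (λ s → trans (∑-cong elems λ t → cong (_≐ 0#) (trans (𝔽.+-comm _ _) (cong (𝔽._+ (s 𝔽.* 0#)) (𝔽.*-comm t y)))) (∑ᶠ-affine y (s 𝔽.* 0#) 0# y≢0)) ⟩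
      ∑ᶠ (λ s → 1ℤ)                                     ≡⟨ ∑ᶠ-const 1ℤ ⟩
      q * 1ℤ                                            ≡⟨ one q ⟩
      q + (q * q - q) * (1ℤ * 0ℤ)                       ∎
      where
      open ≡-Reasoning
      one : ∀ q → q * 1ℤ ≡ q + (q * q - q) * (1ℤ * 0ℤ)
      one = solve-∀

    -- For a ≢ 0 this is the indicator of a' lying on the line Fa. As a sum over scalars it can be
    -- exchanged with other sums.
    multiples : ∀ {n} → Vec Carrier n → Vec Carrier n → ℤ
    multiples a a' = ∑ᶠ (λ s → ⟦ does (a' ≟ᵛ (s ⊙ a)) ⟧)

    relations : ∀ {n} → Vec Carrier n → Vec Carrier n → ℤ
    relations a a' = ∑ᶠ (λ s → ∑ᶠ (λ t → isZeroᵛ (s ⊙ a ⊕ t ⊙ a')))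

    -- t = 0 forces s = 0. For t ≢ 0 the substitution of -ts for s turns the relation into a' = sa.
    relations≡ : ∀ {n} (a a' : Vec Carrier n) → a ≢ zeros n → relations a a' ≡ 1ℤ + (q - 1ℤ) * multiples a a'
    relations≡ {n} a a' a≢0 = trans (∑-swap elems elems _)
      (trans (∑ᶠ-split (λ t → ∑ᶠ (λ s → isZeroᵛ (s ⊙ a ⊕ t ⊙ a'))) (multiples a a') off0)
        (cong (_+ (q - 1ℤ) * multiples a a') at0))
      where
      open ≡-Reasoning
      at0 : ∑ᶠ (λ s → isZeroᵛ (s ⊙ a ⊕ 0# ⊙ a')) ≡ 1ℤ
      at0 = trans (∑-cong elems λ s → cong isZeroᵛ (trans (cong (s ⊙ a ⊕_) (⊙-zeroˡ a')) (⊕-identityʳ (s ⊙ a))))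
        (trans (∑-point listing 0# (λ s → isZeroᵛ (s ⊙ a)) λ s s≢0 → ⟦no⟧ ((s ⊙ a) ≟ᵛ zeros n) (⊙-nonzero s≢0 a≢0))
          (⟦yes⟧ ((0# ⊙ a) ≟ᵛ zeros n) (⊙-zeroˡ a)))
      neg : ∀ t s → ((𝔽.- t) 𝔽.* s) ⊙ a ≡ ⊝ (t ⊙ (s ⊙ a))
      neg t s = begin
        ((𝔽.- t) 𝔽.* s) ⊙ a       ≡⟨ cong (_⊙ a) (sym (𝔽.-‿distribˡ-* t s)) ⟩
        (𝔽.- (t 𝔽.* s)) ⊙ a       ≡⟨ cong (λ z → (𝔽.- z) ⊙ a) (sym (𝔽.*-identityˡ _)) ⟩
        (𝔽.- (1# 𝔽.* (t 𝔽.* s))) ⊙ a ≡⟨ cong (_⊙ a) (𝔽.-‿distribˡ-* 1# _) ⟩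
        ((𝔽.- 1#) 𝔽.* (t 𝔽.* s)) ⊙ a ≡⟨ ⊙-assoc (𝔽.- 1#) (t 𝔽.* s) a ⟩
        (𝔽.- 1#) ⊙ (t 𝔽.* s) ⊙ a  ≡⟨ ⊝≡-1⊙ _ ⟨
        ⊝ ((t 𝔽.* s) ⊙ a)         ≡⟨ cong ⊝_ (⊙-assoc t s a) ⟩
        ⊝ (t ⊙ s ⊙ a)             ∎
      -t≢0 : ∀ t → t ≢ 0# → 𝔽.- t ≢ 0#
      -t≢0 t t≢0 e = t≢0 (trans (sym (𝔽.-‿involutive t)) (trans (cong 𝔽.-_ e) 𝔽.-0#≈0#))
      off0 : ∀ t → t ≢ 0# → ∑ᶠ (λ s → isZeroᵛ (s ⊙ a ⊕ t ⊙ a')) ≡ multiples a a'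
      off0 t t≢0 = trans (sym (∑ᶠ-scale (𝔽.- t) (-t≢0 t t≢0) (λ s → isZeroᵛ (s ⊙ a ⊕ t ⊙ a'))))
        (∑-cong elems λ s → trans (cong (λ v → isZeroᵛ (v ⊕ t ⊙ a')) (neg t s)) (⟦⇔⟧ ((⊝ (t ⊙ s ⊙ a) ⊕ t ⊙ a') ≟ᵛ zeros n) (a' ≟ᵛ (s ⊙ a)) (to s) (from s)))
        where
        to : ∀ s → ⊝ (t ⊙ s ⊙ a) ⊕ t ⊙ a' ≡ zeros n → a' ≡ s ⊙ a
        to s e = trans (sym (⊙-cancel (𝔽.inverseˡ t t≢0) a')) (trans (cong (t ⁻¹[ t≢0 ] ⊙_) (u⊝v≡0⇒u≡v (trans (⊕-comm _ _) e)))
          (⊙-cancel (𝔽.inverseˡ t t≢0) (s ⊙ a)))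
        from : ∀ s → a' ≡ s ⊙ a → ⊝ (t ⊙ s ⊙ a) ⊕ t ⊙ a' ≡ zeros n
        from s refl = ⊝-inverseˡ (t ⊙ s ⊙ a)

    module Dimension (m : ℕ) where

      n : ℕ
      n = suc (suc m)

      vecs : List (Vec Carrier n)
      vecs = allVecs F n

      p p' : ℤ
      p = + (card ℕ.^ suc m)
      p' = + (card ℕ.^ m)

      p≡ : p ≡ q * p'
      p≡ = ℤₚ.pos-* card (card ℕ.^ m)

      qⁿ≡ : + (card ℕ.^ n) ≡ q * p
      qⁿ≡ = ℤₚ.pos-* card (card ℕ.^ suc m)

      kernel : ∀ (a : Vec Carrier n) → ∑ᵛ n (λ b → dot F a b ≐ 0#) ≡ p + (q - 1ℤ) * p * isZeroᵛ a
      kernel a with a ≟ᵛ zeros n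
      ... | yes refl = trans (∑-cong (allVecs F n) λ b → ⟦yes⟧ (dot F (zeros n) b ≟ 0#) (dot-zerosˡ b))
          (trans (∑ᵛ-const n 1ℤ) (trans (cong (_* 1ℤ) qⁿ≡) (lemma q p)))
        where
        lemma : ∀ q p → q * p * 1ℤ ≡ p + (q - 1ℤ) * p * 1ℤ
        lemma = solve-∀
      ... | no a≢0 = trans (hyperplane (suc m) a 0# a≢0) (lemma q p)
        where
        lemma : ∀ q p → p ≡ p + (q - 1ℤ) * p * 0ℤ
        lemma = solve-∀

      -- The entries of M Mᵗ for the two adjacency relations, with b running over all of F^n, zero
      -- included.
      c₀ c₁ : Vec Carrier n → Vec Carrier n → ℤ
      c₀ a a' = ∑ᵛ n (λ b → (dot F a b ≐ 0#) * (dot F a' b ≐ 0#))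
      c₁ a a' = ∑ᵛ n (λ b → (dot F a b ≐ 1#) * (dot F a' b ≐ 1#))

      -- Count triples (b, s, t) with (s a + t a')·b = 0 in two ways.
      c₀-relations : ∀ a a' → c₀ a a' ≡ p' * relations a a'
      c₀-relations a a' = cancel-q-1 (cancel-q (begin
          q * ((q - 1ℤ) * c₀ a a')             ≡⟨ first q p (c₀ a a') ⟩
          (q * p * q + (q * q - q) * c₀ a a') - q * (q * p)    ≡⟨ cong (_- q * (q * p)) (trans (sym side₁) side₂) ⟩
          (q * (q * p) + (q - 1ℤ) * p * relations a a') - q * (q * p)
            ≡⟨ cong (λ z → (q * (q * p) + (q - 1ℤ) * z * relations a a') - q * (q * p)) p≡ ⟩
          (q * (q * p) + (q - 1ℤ) * (q * p') * relations a a') - q * (q * p) ≡⟨ last q p p' (relations a a') ⟩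
          q * ((q - 1ℤ) * (p' * relations a a')) ∎))
        where
        open ≡-Reasoning
        first : ∀ q p c → q * ((q - 1ℤ) * c) ≡ (q * p * q + (q * q - q) * c) - q * (q * p)
        first = solve-∀
        last : ∀ q p p' r → (q * (q * p) + (q - 1ℤ) * (q * p') * r) - q * (q * p) ≡ q * ((q - 1ℤ) * (p' * r))
        last = solve-∀
        triples : ℤ
        triples = ∑ᵛ n (λ b → ∑ᶠ (λ s → ∑ᶠ (λ t → s 𝔽.* dot F a b 𝔽.+ t 𝔽.* dot F a' b ≐ 0#)))
        side₁ : triples ≡ q * p * q + (q * q - q) * c₀ a a'
        side₁ = begin
          triples ≡⟨ ∑-cong (allVecs F n) (λ b → ∑ᶠ-linear (dot F a b) (dot F a' b)) ⟩
          ∑ᵛ n (λ b → q + (q * q - q) * ((dot F a b ≐ 0#) * (dot F a' b ≐ 0#))) ≡⟨ ∑-+ (allVecs F n) (λ _ → q) _ ⟩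
          ∑ᵛ n (λ b → q) + ∑ᵛ n (λ b → (q * q - q) * ((dot F a b ≐ 0#) * (dot F a' b ≐ 0#))) ≡⟨ cong₂ _+_ (trans (∑ᵛ-const n q) (cong (_* q) qⁿ≡)) (∑-*ˡ (allVecs F n) (q * q - q) _) ⟩
          q * p * q + (q * q - q) * c₀ a a'                                                ∎
        side₂ : triples ≡ q * (q * p) + (q - 1ℤ) * p * relations a a'
        side₂ = begin
          triples
            ≡⟨ trans (∑-swap (allVecs F n) elems _) (∑-cong elems λ s → ∑-swap (allVecs F n) elems _) ⟩
          ∑ᶠ (λ s → ∑ᶠ (λ t → ∑ᵛ n (λ b → s 𝔽.* dot F a b 𝔽.+ t 𝔽.* dot F a' b ≐ 0#)))
            ≡⟨ ∑-cong elems (λ s → ∑-cong elems λ t → trans (∑-cong (allVecs F n) λ b → cong (_≐ 0#)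
                 (sym (trans (dot-⊕ (s ⊙ a) (t ⊙ a') b) (cong₂ 𝔽._+_ (dot-⊙ s a b) (dot-⊙ t a' b))))) (kernel (s ⊙ a ⊕ t ⊙ a'))) ⟩
          ∑ᶠ (λ s → ∑ᶠ (λ t → p + (q - 1ℤ) * p * isZeroᵛ (s ⊙ a ⊕ t ⊙ a')))
            ≡⟨ ∑-cong elems (λ s → trans (∑-+ elems (λ _ → p) _) (cong₂ _+_ (∑ᶠ-const p) (∑-*ˡ elems ((q - 1ℤ) * p) _))) ⟩
          ∑ᶠ (λ s → q * p + (q - 1ℤ) * p * ∑ᶠ (λ t → isZeroᵛ (s ⊙ a ⊕ t ⊙ a')))
            ≡⟨ trans (∑-+ elems (λ _ → q * p) _) (cong₂ _+_ (∑ᶠ-const (q * p)) (∑-*ˡ elems ((q - 1ℤ) * p) _)) ⟩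
          q * (q * p) + (q - 1ℤ) * p * relations a a' ∎

      c₀≡ : ∀ a a' → a ≢ zeros n → c₀ a a' ≡ p' * (1ℤ + (q - 1ℤ) * multiples a a')
      c₀≡ a a' a≢0 = trans (c₀-relations a a') (cong (p' *_) (relations≡ a a' a≢0))

      -- Σₛ #{b : a·b = s = a'·b} counts the b orthogonal to a - a'.
      c₁≡ : ∀ a a' → a ≢ zeros n → c₁ a a' ≡ (p' + p * ⟦ does (a ≟ᵛ a') ⟧) - p' * multiples a a'
      c₁≡ a a' a≢0 = cancel-q-1 (begin
          (q - 1ℤ) * c₁ a a'                                ≡⟨ first (q - 1ℤ) (c₁ a a') (c₀ a a') ⟩
          (c₀ a a' + (q - 1ℤ) * c₁ a a') - c₀ a a'          ≡⟨ cong₂ _-_ (trans (sym side₁) side₂) (c₀≡ a a' a≢0) ⟩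
          (p + (q - 1ℤ) * p * i) - p' * (1ℤ + (q - 1ℤ) * κ)
            ≡⟨ cong (λ z → (z + (q - 1ℤ) * p * i) - p' * (1ℤ + (q - 1ℤ) * κ)) p≡ ⟩
          (q * p' + (q - 1ℤ) * p * i) - p' * (1ℤ + (q - 1ℤ) * κ) ≡⟨ last q p p' i κ ⟩
          (q - 1ℤ) * ((p' + p * i) - p' * κ)                ∎)
        where
        open ≡-Reasoning
        i = ⟦ does (a ≟ᵛ a') ⟧
        κ = multiples a a'
        first : ∀ d x y → d * x ≡ (y + d * x) - y
        first = solve-∀
        last : ∀ q p p' i κ → (q * p' + (q - 1ℤ) * p * i) - p' * (1ℤ + (q - 1ℤ) * κ) ≡ (q - 1ℤ) * ((p' + p * i) - p' * κ)
        last = solve-∀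
        C : Carrier → ℤ
        C s = ∑ᵛ n (λ b → (dot F a b ≐ s) * (dot F a' b ≐ s))
        rescale : ∀ s → s ≢ 0# → ∀ v b → (dot F v (s ⊙ b) ≐ s) ≡ (dot F v b ≐ 1#)
        rescale s s≢0 v b = ⟦⇔⟧ (dot F v (s ⊙ b) ≟ s) (dot F v b ≟ 1#)
          (λ e → 𝔽.*-cancelˡ s s≢0 (trans (sym (dot-⊙ʳ s v b)) (trans e (sym (𝔽.*-identityʳ s)))))
          (λ e → trans (dot-⊙ʳ s v b) (trans (cong (s 𝔽.*_) e) (𝔽.*-identityʳ s)))
        side₁ : ∑ᶠ C ≡ c₀ a a' + (q - 1ℤ) * c₁ a a'
        side₁ = ∑ᶠ-split C (c₁ a a') λ s s≢0 → trans (sym (∑ᵛ-scale s s≢0 (λ b → (dot F a b ≐ s) * (dot F a' b ≐ s))))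
          (∑-cong (allVecs F n) λ b → cong₂ _*_ (rescale s s≢0 a b) (rescale s s≢0 a' b))
        diagonal : ∀ x y → ∑ᶠ (λ s → (x ≐ s) * (y ≐ s)) ≡ (x 𝔽.+ 𝔽.- y ≐ 0#)
        diagonal x y = trans (∑-point listing x _ λ s s≢x → trans (cong (_* (y ≐ s)) (⟦no⟧ (x ≟ s) (s≢x ∘ sym))) (ℤₚ.*-zeroˡ (y ≐ s)))
          (trans (cong (_* (y ≐ x)) (⟦yes⟧ (x ≟ x) refl)) (trans (ℤₚ.*-identityˡ _) (⟦⇔⟧ (y ≟ x) ((x 𝔽.+ 𝔽.- y) ≟ 0#)
            (λ { refl → 𝔽.-‿inverseʳ y }) (λ e → sym (𝔽.x-y≡0⇒x≡y e)))))
        dot-⊝ : ∀ b → dot F (⊝ a') b ≡ 𝔽.- dot F a' b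
        dot-⊝ b = trans (cong (λ v → dot F v b) (⊝≡-1⊙ a')) (trans (dot-⊙ (𝔽.- 1#) a' b)
          (trans (sym (𝔽.-‿distribˡ-* 1# _)) (cong 𝔽.-_ (𝔽.*-identityˡ _))))
        side₂ : ∑ᶠ C ≡ p + (q - 1ℤ) * p * i
        side₂ = begin
          ∑ᶠ C                                                              ≡⟨ ∑-swap elems (allVecs F n) _ ⟩
          ∑ᵛ n (λ b → ∑ᶠ (λ s → (dot F a b ≐ s) * (dot F a' b ≐ s)))
            ≡⟨ ∑-cong (allVecs F n) (λ b → trans (diagonal (dot F a b) (dot F a' b))
                 (cong (_≐ 0#) (sym (trans (dot-⊕ a (⊝ a') b) (cong (dot F a b 𝔽.+_) (dot-⊝ b)))))) ⟩
          ∑ᵛ n (λ b → dot F (a ⊕ ⊝ a') b ≐ 0#)                              ≡⟨ kernel (a ⊕ ⊝ a') ⟩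
          p + (q - 1ℤ) * p * isZeroᵛ (a ⊕ ⊝ a')
            ≡⟨ cong (λ z → p + (q - 1ℤ) * p * z) (⟦⇔⟧ ((a ⊕ ⊝ a') ≟ᵛ zeros n) (a ≟ᵛ a') u⊝v≡0⇒u≡v (λ { refl → ⊝-inverseʳ a })) ⟩
          p + (q - 1ℤ) * p * i                                              ∎

      module Form (G : Vec Carrier n → ℤ) (G0 : G (zeros n) ≡ 0ℤ) where

        -- `square` and `lines` are the quadratic forms of the identity and of the matrix
        -- `multiples`; the square of `total` is that of the all-ones matrix. Together they span
        -- both products M Mᵗ.
        total square lines : ℤ
        total = ∑ᵛ n G
        square = ∑ᵛ n (λ a → G a * G a)
        lines = ∑ᵛ n (λ a → ∑ᶠ (λ s → G a * G (s ⊙ a)))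

        R₀ R₁ : Vec Carrier n → ℤ
        R₀ b = ∑ᵛ n (λ a → (dot F a b ≐ 0#) * G a)
        R₁ b = ∑ᵛ n (λ a → (dot F a b ≐ 1#) * G a)

        -- The entries of M Mᵗ are known only for a ≢ 0; functions with G(0) = 0 do not see the
        -- rest.
        off-zero : ∀ {h h' : ℤ} a a' → (a ≢ zeros n → h ≡ h') → G a * G a' * h ≡ G a * G a' * h'
        off-zero {h} {h'} a a' e with a ≟ᵛ zeros n
        ... | no a≢0 = cong (G a * G a' *_) (e a≢0)
        ... | yes refl = trans (vanish h) (sym (vanish h'))
          where
          vanish : ∀ x → G a * G a' * x ≡ 0ℤ
          vanish x = trans (cong (λ z → z * G a' * x) G0) (lemma (G a') x)
            where
            lemma : ∀ g x → 0ℤ * g * x ≡ 0ℤ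
            lemma = solve-∀

        ∑∑-total : ∀ c → ∑ᵛ n (λ a → ∑ᵛ n (λ a' → c * (G a * G a'))) ≡ c * (total * total)
        ∑∑-total c = trans (∑-cong vecs λ a → ∑-*ˡ vecs c _) (trans (∑-*ˡ vecs c _) (cong (c *_) (sym (∑-*-∑ vecs vecs G G))))

        ∑∑-diagonal : ∀ c → ∑ᵛ n (λ a → ∑ᵛ n (λ a' → c * (G a * G a' * ⟦ does (a ≟ᵛ a') ⟧))) ≡ c * square
        ∑∑-diagonal c = trans (∑-cong vecs λ a → trans (∑-*ˡ vecs c _) (cong (c *_) (point a))) (∑-*ˡ vecs c _)
          where
          point : ∀ a → ∑ᵛ n (λ a' → G a * G a' * ⟦ does (a ≟ᵛ a') ⟧) ≡ G a * G a
          point a = trans (∑-point (vecListing n) a _ λ a' a'≢a →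
              trans (cong (G a * G a' *_) (⟦no⟧ (a ≟ᵛ a') (a'≢a ∘ sym))) (ℤₚ.*-zeroʳ (G a * G a')))
            (trans (cong (G a * G a *_) (⟦yes⟧ (a ≟ᵛ a) refl)) (ℤₚ.*-identityʳ _))

        ∑∑-lines : ∀ c → ∑ᵛ n (λ a → ∑ᵛ n (λ a' → c * (G a * G a' * multiples a a'))) ≡ c * lines
        ∑∑-lines c = trans (∑-cong vecs λ a → trans (∑-*ˡ vecs c _) (cong (c *_) (point a))) (∑-*ˡ vecs c _)
          where
          open ≡-Reasoning
          point : ∀ a → ∑ᵛ n (λ a' → G a * G a' * multiples a a') ≡ ∑ᶠ (λ s → G a * G (s ⊙ a))
          point a = begin
            ∑ᵛ n (λ a' → G a * G a' * multiples a a') ≡⟨ ∑-cong vecs (λ a' → ∑-*ˡ elems (G a * G a') _) ⟨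
            ∑ᵛ n (λ a' → ∑ᶠ (λ s → G a * G a' * ⟦ does (a' ≟ᵛ (s ⊙ a)) ⟧))         ≡⟨ ∑-swap vecs elems _ ⟩
            ∑ᶠ (λ s → ∑ᵛ n (λ a' → G a * G a' * ⟦ does (a' ≟ᵛ (s ⊙ a)) ⟧))
              ≡⟨ ∑-cong elems (λ s → trans (∑-point (vecListing n) (s ⊙ a) _ λ a' a'≢ →
                   trans (cong (G a * G a' *_) (⟦no⟧ (a' ≟ᵛ (s ⊙ a)) a'≢)) (ℤₚ.*-zeroʳ (G a * G a')))
                   (trans (cong (G a * G (s ⊙ a) *_) (⟦yes⟧ ((s ⊙ a) ≟ᵛ (s ⊙ a)) refl)) (ℤₚ.*-identityʳ _))) ⟩
            ∑ᶠ (λ s → G a * G (s ⊙ a)) ∎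

        -- The matrix identity M Mᵗ = p'J + pI - p'Λ, with J all ones and Λ the matrix `multiples`,
        -- evaluated on G.
        form₁ : ∑ᵛ n (λ b → R₁ b * R₁ b) ≡ (p' * (total * total) + p * square) - p' * lines
        form₁ = begin
          ∑ᵛ n (λ b → R₁ b * R₁ b)
            ≡⟨ ∑-square vecs vecs (λ a b → dot F a b ≐ 1#) G ⟩
          ∑ᵛ n (λ a → ∑ᵛ n (λ a' → G a * G a' * c₁ a a'))
            ≡⟨ ∑-cong vecs (λ a → ∑-cong vecs λ a' → trans (off-zero a a' (c₁≡ a a')) (expand (G a * G a') p' p ⟦ does (a ≟ᵛ a') ⟧ (multiples a a'))) ⟩
          ∑ᵛ n (λ a → ∑ᵛ n (λ a' → (p' * (G a * G a') + p * (G a * G a' * ⟦ does (a ≟ᵛ a') ⟧)) - p' * (G a * G a' * multiples a a')))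
            ≡⟨ ∑-cong vecs (λ a → trans (∑-- vecs _ _) (cong (_- ∑ᵛ n (λ a' → p' * (G a * G a' * multiples a a'))) (∑-+ vecs _ _))) ⟩
          ∑ᵛ n (λ a → (∑ᵛ n (λ a' → p' * (G a * G a')) + ∑ᵛ n (λ a' → p * (G a * G a' * ⟦ does (a ≟ᵛ a') ⟧))) - ∑ᵛ n (λ a' → p' * (G a * G a' * multiples a a')))
            ≡⟨ trans (∑-- vecs _ _) (cong₂ _-_ (trans (∑-+ vecs _ _) (cong₂ _+_ (∑∑-total p') (∑∑-diagonal p))) (∑∑-lines p')) ⟩
          (p' * (total * total) + p * square) - p' * lines ∎
          where
          open ≡-Reasoning
          expand : ∀ g p' p i κ → g * ((p' + p * i) - p' * κ) ≡ (p' * g + p * (g * i)) - p' * (g * κ)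
          expand = solve-∀

        form₀ : ∑ᵛ n (λ b → R₀ b * R₀ b) ≡ p' * (total * total) + (p' * (q - 1ℤ)) * lines
        form₀ = begin
          ∑ᵛ n (λ b → R₀ b * R₀ b)
            ≡⟨ ∑-square vecs vecs (λ a b → dot F a b ≐ 0#) G ⟩
          ∑ᵛ n (λ a → ∑ᵛ n (λ a' → G a * G a' * c₀ a a'))
            ≡⟨ ∑-cong vecs (λ a → ∑-cong vecs λ a' → trans (off-zero a a' (c₀≡ a a')) (expand (G a * G a') p' (q - 1ℤ) (multiples a a'))) ⟩
          ∑ᵛ n (λ a → ∑ᵛ n (λ a' → p' * (G a * G a') + (p' * (q - 1ℤ)) * (G a * G a' * multiples a a')))
            ≡⟨ ∑-cong vecs (λ a → ∑-+ vecs _ _) ⟩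
          ∑ᵛ n (λ a → ∑ᵛ n (λ a' → p' * (G a * G a')) + ∑ᵛ n (λ a' → (p' * (q - 1ℤ)) * (G a * G a' * multiples a a')))
            ≡⟨ trans (∑-+ vecs _ _) (cong₂ _+_ (∑∑-total p') (∑∑-lines (p' * (q - 1ℤ)))) ⟩
          p' * (total * total) + (p' * (q - 1ℤ)) * lines ∎
          where
          open ≡-Reasoning
          expand : ∀ g p' d κ → g * (p' * (1ℤ + d * κ)) ≡ p' * g + (p' * d) * (g * κ)
          expand = solve-∀

        -- Averaging over scalars: (q - 1) · `lines` is the sum over a of the square of the sum of G
        -- over the multiples of a.
        0≤lines : 0ℤ ℤ.≤ lines
        0≤lines = ℤₚ.*-cancelˡ-≤-pos 0ℤ lines (q - 1ℤ) {{ℤ.positive 0<q-1}} (subst₂ ℤ._≤_ (sym (ℤₚ.*-zeroʳ (q - 1ℤ))) squares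
            (∑-nonneg vecs λ a → 0≤i*i (∑ᶠ (λ s → G (s ⊙ a)))))
          where
          open ≡-Reasoning
          0<q-1 : 0ℤ ℤ.< q - 1ℤ
          0<q-1 = subst (ℤ._< q - 1ℤ) (ℤₚ.+-inverseʳ 1ℤ) (ℤₚ.+-monoˡ-< (- 1ℤ) (ℤ.+<+ 𝔽.card≥2))
          inner : Carrier → ℤ
          inner s = ∑ᵛ n (λ a → ∑ᶠ (λ s' → G (s ⊙ a) * G (s' ⊙ a)))
          inner-0 : inner 0# ≡ 0ℤ
          inner-0 = trans (∑-cong vecs λ a → trans (∑-cong elems λ s' →
              trans (cong (_* G (s' ⊙ a)) (trans (cong G (⊙-zeroˡ a)) G0)) (ℤₚ.*-zeroˡ (G (s' ⊙ a)))) (∑-0 elems)) (∑-0 vecs)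
          inner-s : ∀ s → s ≢ 0# → inner s ≡ lines
          inner-s s s≢0 = trans (∑-cong vecs λ a → trans (sym (∑ᶠ-scale s s≢0 (λ s' → G (s ⊙ a) * G (s' ⊙ a))))
              (∑-cong elems λ s' → cong (λ v → G (s ⊙ a) * G v) (trans (cong (_⊙ a) (𝔽.*-comm s s')) (⊙-assoc s' s a))))
            (∑ᵛ-scale s s≢0 (λ a → ∑ᶠ (λ s' → G a * G (s' ⊙ a))))
          squares : ∑ᵛ n (λ a → ∑ᶠ (λ s → G (s ⊙ a)) * ∑ᶠ (λ s → G (s ⊙ a))) ≡ (q - 1ℤ) * lines
          squares = begin
            ∑ᵛ n (λ a → ∑ᶠ (λ s → G (s ⊙ a)) * ∑ᶠ (λ s → G (s ⊙ a))) ≡⟨ ∑-cong vecs (λ a → ∑-*-∑ elems elems _ _) ⟩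
            ∑ᵛ n (λ a → ∑ᶠ (λ s → ∑ᶠ (λ s' → G (s ⊙ a) * G (s' ⊙ a))))       ≡⟨ ∑-swap vecs elems _ ⟩
            ∑ᶠ inner                                                         ≡⟨ ∑ᶠ-split inner lines inner-s ⟩
            inner 0# + (q - 1ℤ) * lines                                      ≡⟨ cong (_+ (q - 1ℤ) * lines) inner-0 ⟩
            0ℤ + (q - 1ℤ) * lines                                            ≡⟨ ℤₚ.+-identityˡ _ ⟩
            (q - 1ℤ) * lines                                                 ∎

-- Valencies and norms of `Um` and `Um₀`.

module GraphSpectra where

  open FiniteSums
  open FieldTheory
  open Vectors
  open Counting
  open SpectralBound using (0≤*; 0≤-by; ≤⇒0≤)
  open import Data.Integer as ℤ using (ℤ; +_; 0ℤ; 1ℤ; _+_; _*_; _-_; -_)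

  module _ {A : Set} (p : A → Bool) where

    ∈-filterᵇ⁺ : ∀ {x xs} → x ∈ xs → p x ≡ true → x ∈ filterᵇ p xs
    ∈-filterᵇ⁺ x∈ e = ∈-filter⁺ (T? ∘ p) x∈ (Equivalence.from T-≡ e)

    ∈-filterᵇ⁻ : ∀ {x xs} → x ∈ filterᵇ p xs → p x ≡ true
    ∈-filterᵇ⁻ {xs = xs} x∈ = Equivalence.to T-≡ (proj₂ (∈-filter⁻ (T? ∘ p) {xs = xs} x∈))

    filterᵇ-unique : ∀ {xs} → Unique xs → Unique (filterᵇ p xs)
    filterᵇ-unique = Unique.filter⁺ (T? ∘ p)

    ∑-filter-*ʳ : ∀ xs (w G : A → ℤ) → ∑ (filterᵇ p xs) (λ a → w a * G a) ≡ ∑ xs (λ a → w a * (⟦ p a ⟧ * G a))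
    ∑-filter-*ʳ xs w G = trans (∑-filter p xs _) (∑-cong xs λ a → shuffle ⟦ p a ⟧ (w a) (G a))
      where
      shuffle : ∀ x y z → x * (y * z) ≡ y * (x * z)
      shuffle = solve-∀

    ∑-filter-square : ∀ xs (G : A → ℤ) → ∑ xs (λ a → (⟦ p a ⟧ * G a) * (⟦ p a ⟧ * G a)) ≡ ∑ (filterᵇ p xs) (λ a → G a * G a)
    ∑-filter-square xs G = sym (trans (∑-filter p xs _) (∑-cong xs λ a →
        trans (cong (_* (G a * G a)) (sym (⟦⟧² (p a)))) (shuffle ⟦ p a ⟧ (G a))))
      where
      shuffle : ∀ x y → (x * x) * (y * y) ≡ (x * y) * (x * y)
      shuffle = solve-∀

  ∈⇒0<length : ∀ {A : Set} {x : A} {xs} → x ∈ xs → 0ℤ ℤ.< + length xs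
  ∈⇒0<length {xs = x ∷ xs} _ = ℤ.+<+ (s≤s z≤n)

  module NormalForms (F : FiniteField) where

    open Count F
    open Field F using (Carrier; 0#; 1#; _≟_; elems; card; zeros; listing; 0≢1; _⁻¹[_])
    open VectorSpace F

    isNonzero-zeros : ∀ n → isNonzero F (zeros n) ≡ false
    isNonzero-zeros zero = refl
    isNonzero-zeros (suc n) with 0# ≟ 0#
    ... | yes _ = isNonzero-zeros n
    ... | no 0≢0 = contradiction refl 0≢0

    isNonzero-≢ : ∀ {n} (v : Vec Carrier n) → v ≢ zeros n → isNonzero F v ≡ true
    isNonzero-≢ [] v≢0 = contradiction refl v≢0
    isNonzero-≢ (x ∷ v) v≢0 with x ≟ 0#
    ... | yes refl = isNonzero-≢ v (v≢0 ∘ cong (0# ∷_))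
    ... | no _ = refl

    isNonzero⇒≢ : ∀ {n} {v : Vec Carrier n} → isNonzero F v ≡ true → v ≢ zeros n
    isNonzero⇒≢ {n} e refl = contradiction (trans (sym e) (isNonzero-zeros n)) λ ()

    isNormalized-zeros : ∀ n → isNormalized F (zeros n) ≡ false
    isNormalized-zeros zero = refl
    isNormalized-zeros (suc n) with 0# ≟ 0#
    ... | yes _ = isNormalized-zeros n
    ... | no 0≢0 = contradiction refl 0≢0

    isNormalized⇒≢ : ∀ {n} {v : Vec Carrier n} → isNormalized F v ≡ true → v ≢ zeros n
    isNormalized⇒≢ {n} e refl = contradiction (trans (sym e) (isNormalized-zeros n)) λ ()

    isNormalized-0⊙ : ∀ {n} (v : Vec Carrier n) → isNormalized F (0# ⊙ v) ≡ false
    isNormalized-0⊙ {n} v = trans (cong (isNormalized F) (⊙-zeroˡ v)) (isNormalized-zeros n)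

    normalized-∷0 : ∀ {n} x (v : Vec Carrier n) → x ≡ 0# → isNormalized F (x ∷ v) ≡ isNormalized F v
    normalized-∷0 x v e with x ≟ 0#
    ... | yes _ = refl
    ... | no n = contradiction e n

    normalized-∷≢0 : ∀ {n} x (v : Vec Carrier n) → x ≢ 0# → isNormalized F (x ∷ v) ≡ does (x ≟ 1#)
    normalized-∷≢0 x v n with x ≟ 0#
    ... | yes e = contradiction e n
    ... | no _ = refl

    does-true : ∀ {P : Set} (d : Dec P) → does d ≡ true → P
    does-true (yes p) _ = p

    -- The only multiplier that normalizes v is the inverse of its first nonzero coordinate.
    ∑-normalized-multiples : ∀ {n} (v : Vec Carrier n) → ∑ᶠ (λ c → ⟦ isNormalized F (c ⊙ v) ⟧) ≡ ⟦ isNonzero F v ⟧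
    ∑-normalized-multiples [] = ∑-0 elems
    ∑-normalized-multiples (x ∷ v) with x ≟ 0#
    ... | yes refl = trans (∑-cong elems λ c → cong ⟦_⟧ (normalized-∷0 (c 𝔽.* 0#) (c ⊙ v) (𝔽.zeroʳ c))) (∑-normalized-multiples v)
    ... | no x≢0 = trans (∑-point listing c₀ _ other) (trans (cong ⟦_⟧ (normalized-∷≢0 (c₀ 𝔽.* x) (c₀ ⊙ v) (λ e → 0≢1 (trans (sym e) c₀x≡1))))
        (⟦yes⟧ ((c₀ 𝔽.* x) ≟ 1#) c₀x≡1))
      where
      c₀ = x ⁻¹[ x≢0 ]
      c₀x≡1 : c₀ 𝔽.* x ≡ 1#
      c₀x≡1 = 𝔽.inverseˡ x x≢0
      other : ∀ c → c ≢ c₀ → ⟦ isNormalized F (c 𝔽.* x ∷ c ⊙ v) ⟧ ≡ 0ℤ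
      other c c≢ with c ≟ 0#
      ... | yes refl = cong ⟦_⟧ (isNormalized-0⊙ (x ∷ v))
      ... | no c≢0 = trans (cong ⟦_⟧ (normalized-∷≢0 (c 𝔽.* x) (c ⊙ v) (𝔽.*-nonzero c≢0 x≢0)))
          (⟦no⟧ ((c 𝔽.* x) ≟ 1#) λ e → c≢ (𝔽.*-cancelˡ x x≢0 (trans (𝔽.*-comm x c) (trans e (sym (𝔽.inverseʳ x x≢0))))))

    normalized-multiple : ∀ {n} (v : Vec Carrier n) s → isNormalized F v ≡ true → isNormalized F (s ⊙ v) ≡ true → s ≡ 1#
    normalized-multiple (x ∷ v) s e e' with s ≟ 0#
    ... | yes refl = contradiction (trans (sym e') (isNormalized-0⊙ (x ∷ v))) λ ()
    ... | no s≢0 with x ≟ 0#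
    ...   | yes refl = normalized-multiple v s e (trans (sym (normalized-∷0 (s 𝔽.* 0#) (s ⊙ v) (𝔽.zeroʳ s))) e')
    ...   | no x≢0 = trans (sym (trans (cong (s 𝔽.*_) (does-true (x ≟ 1#) e)) (𝔽.*-identityʳ s)))
        (does-true ((s 𝔽.* x) ≟ 1#) (trans (sym (normalized-∷≢0 (s 𝔽.* x) (s ⊙ v) (𝔽.*-nonzero s≢0 x≢0))) e'))

    -- Every nonzero vector has exactly one normalized multiple.
    projective : ∀ {n} (h : Vec Carrier n → ℤ) → (∀ c v → c ≢ 0# → h (c ⊙ v) ≡ h v) →
      ∑ᵛ n h ≡ h (zeros n) + (q - 1ℤ) * ∑ᵛ n (λ v → ⟦ isNormalized F v ⟧ * h v)
    projective {n} h inv = begin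
      ∑ᵛ n h                                                     ≡⟨ ∑-cong vecs split ⟩
      ∑ᵛ n (λ v → isZeroᵛ v * h v + ⟦ isNonzero F v ⟧ * h v)     ≡⟨ ∑-+ vecs _ _ ⟩
      ∑ᵛ n (λ v → isZeroᵛ v * h v) + ∑ᵛ n (λ v → ⟦ isNonzero F v ⟧ * h v)
        ≡⟨ cong₂ _+_ at-zero (trans (sym side₁) side₂) ⟩
      h (zeros n) + (q - 1ℤ) * ∑ᵛ n (λ v → ⟦ isNormalized F v ⟧ * h v) ∎
      where
      open ≡-Reasoning
      vecs = allVecs F n
      split : ∀ v → h v ≡ isZeroᵛ v * h v + ⟦ isNonzero F v ⟧ * h v
      split v with v ≟ᵛ zeros n
      ... | yes refl = sym (trans (cong₂ _+_ (ℤₚ.*-identityˡ (h v)) (trans (cong (λ b → ⟦ b ⟧ * h v) (isNonzero-zeros n)) (ℤₚ.*-zeroˡ (h v)))) (ℤₚ.+-identityʳ _))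
      ... | no v≢0 = sym (trans (cong₂ _+_ (ℤₚ.*-zeroˡ (h v)) (trans (cong (λ b → ⟦ b ⟧ * h v) (isNonzero-≢ v v≢0)) (ℤₚ.*-identityˡ (h v)))) (ℤₚ.+-identityˡ _))
      at-zero : ∑ᵛ n (λ v → isZeroᵛ v * h v) ≡ h (zeros n)
      at-zero = trans (∑-point (vecListing n) (zeros n) _ λ v v≢0 → trans (cong (_* h v) (⟦no⟧ (v ≟ᵛ zeros n) v≢0)) (ℤₚ.*-zeroˡ (h v)))
        (trans (cong (_* h (zeros n)) (⟦yes⟧ (zeros n ≟ᵛ zeros n) refl)) (ℤₚ.*-identityˡ _))
      inner : Carrier → ℤ
      inner c = ∑ᵛ n (λ v → ⟦ isNormalized F (c ⊙ v) ⟧ * h v)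
      side₁ : ∑ᶠ inner ≡ ∑ᵛ n (λ v → ⟦ isNonzero F v ⟧ * h v)
      side₁ = trans (∑-swap elems vecs _) (∑-cong vecs λ v → trans (∑-*ʳ elems (h v) _) (cong (_* h v) (∑-normalized-multiples v)))
      off0 : ∀ c → c ≢ 0# → inner c ≡ ∑ᵛ n (λ v → ⟦ isNormalized F v ⟧ * h v)
      off0 c c≢0 = trans (∑-cong vecs λ v → cong (⟦ isNormalized F (c ⊙ v) ⟧ *_) (sym (inv c v c≢0)))
        (∑ᵛ-scale c c≢0 (λ v → ⟦ isNormalized F v ⟧ * h v))
      at0 : inner 0# ≡ 0ℤ
      at0 = trans (∑-cong vecs λ v → trans (cong (λ b → ⟦ b ⟧ * h v) (isNormalized-0⊙ v)) (ℤₚ.*-zeroˡ (h v))) (∑-0 vecs)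
      side₂ : ∑ᶠ inner ≡ (q - 1ℤ) * ∑ᵛ n (λ v → ⟦ isNormalized F v ⟧ * h v)
      side₂ = trans (∑ᶠ-split inner _ off0) (trans (cong (λ z → z + (q - 1ℤ) * ∑ᵛ n (λ v → ⟦ isNormalized F v ⟧ * h v)) at0) (ℤₚ.+-identityˡ _))

    -- (q^j - 1)/(q - 1), the number of points of the projective space of F^j. It is the valency of
    -- `Um₀` for j = n - 1; for j = n it is the exponent of the norm from K to F.
    geometric : ℕ → ℕ
    geometric zero = 0
    geometric (suc j) = card ℕ.^ j ℕ.+ geometric j

    geometric-sum : ∀ j → + (card ℕ.^ j) ≡ 1ℤ + (q - 1ℤ) * + geometric j
    geometric-sum zero = sym (trans (cong (_+_ 1ℤ) (ℤₚ.*-zeroʳ (q - 1ℤ))) refl)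
    geometric-sum (suc j) = begin
      + (card ℕ.* card ℕ.^ j)                                   ≡⟨ ℤₚ.pos-* card (card ℕ.^ j) ⟩
      q * + (card ℕ.^ j)                                        ≡⟨ split q (+ (card ℕ.^ j)) ⟩
      + (card ℕ.^ j) + (q - 1ℤ) * + (card ℕ.^ j) ≡⟨ cong (_+ (q - 1ℤ) * + (card ℕ.^ j)) (geometric-sum j) ⟩
      (1ℤ + (q - 1ℤ) * + geometric j) + (q - 1ℤ) * + (card ℕ.^ j) ≡⟨ collect (q - 1ℤ) (+ (card ℕ.^ j)) (+ geometric j) ⟩
      1ℤ + (q - 1ℤ) * (+ (card ℕ.^ j) + + geometric j) ≡⟨ cong (λ z → 1ℤ + (q - 1ℤ) * z) (ℤₚ.pos-+ (card ℕ.^ j) (geometric j)) ⟨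
      1ℤ + (q - 1ℤ) * + (card ℕ.^ j ℕ.+ geometric j)            ∎
      where
      open ≡-Reasoning
      split : ∀ q x → q * x ≡ x + (q - 1ℤ) * x
      split = solve-∀
      collect : ∀ d x g → (1ℤ + d * g) + d * x ≡ 1ℤ + d * (x + g)
      collect = solve-∀

    card^≥1 : ∀ j → 1 ℕ.≤ card ℕ.^ j
    card^≥1 j = ℕₚ.m^n>0 card {{ℕ.>-nonZero (ℕₚ.≤-trans (s≤s z≤n) 𝔽.card≥2)}} j

    module UmGraphs (m : ℕ) where

      open Dimension m

      vs vs₀ : List (Vec Carrier n)
      vs = filterᵇ (isNonzero F) vecs
      vs₀ = filterᵇ (isNormalized F) vecs

      r r₀ : Vec Carrier n → Vec Carrier n → Bool
      r a b = does (dot F a b ≟ 1#)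
      r₀ a b = does (dot F a b ≟ 0#)

      vs-unique : Unique vs
      vs-unique = filterᵇ-unique (isNonzero F) (Listing.unique (vecListing n))

      vs₀-unique : Unique vs₀
      vs₀-unique = filterᵇ-unique (isNormalized F) (Listing.unique (vecListing n))

      unit : Vec Carrier n
      unit = 1# ∷ zeros (suc m)

      0<N : 0ℤ ℤ.< + length vs
      0<N = ∈⇒0<length (∈-filterᵇ⁺ (isNonzero F) (Listing.complete (vecListing n) unit)
        (isNonzero-≢ unit λ e → 0≢1 (sym (cong Vec.head e))))

      0<N₀ : 0ℤ ℤ.< + length vs₀
      0<N₀ = ∈⇒0<length (∈-filterᵇ⁺ (isNormalized F) (Listing.complete (vecListing n) unit)
        (trans (normalized-∷≢0 1# (zeros (suc m)) (0≢1 ∘ sym)) (does-yes (1# ≟ 1#) refl)))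
        where
        does-yes : ∀ {P : Set} (d : Dec P) → P → does d ≡ true
        does-yes (yes _) _ = refl
        does-yes (no ¬p) p = contradiction p ¬p

      -- The zero vector has dot product 0 ≢ 1 with everything, so sums over neighbours in `Um` may
      -- run over all of F^n.
      ∑vs-adjacent : ∀ (w : Vec Carrier n → Carrier) → w (zeros n) ≡ 0# → ∑ vs (λ a → w a ≐ 1#) ≡ ∑ᵛ n (λ a → w a ≐ 1#)
      ∑vs-adjacent w w0 = trans (∑-filter (isNonzero F) vecs _) (∑-cong vecs pointwise)
        where
        pointwise : ∀ a → ⟦ isNonzero F a ⟧ * (w a ≐ 1#) ≡ (w a ≐ 1#)
        pointwise a with a ≟ᵛ zeros n
        ... | yes refl = trans (cong (⟦ isNonzero F a ⟧ *_) zero≐) (trans (ℤₚ.*-zeroʳ ⟦ isNonzero F a ⟧) (sym zero≐))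
          where
          zero≐ : (w (zeros n) ≐ 1#) ≡ 0ℤ
          zero≐ = ⟦no⟧ (w (zeros n) ≟ 1#) λ e → 0≢1 (trans (sym w0) e)
        ... | no a≢0 = trans (cong (λ z → ⟦ z ⟧ * (w a ≐ 1#)) (isNonzero-≢ a a≢0)) (ℤₚ.*-identityˡ _)

      regularʳ : ∀ {a} → a ∈ vs → ∑ vs (λ b → ⟦ r a b ⟧) ≡ + (card ℕ.^ suc m)
      regularʳ {a} a∈ = trans (∑vs-adjacent (dot F a) (dot-zerosʳ a)) (hyperplane (suc m) a 1# (isNonzero⇒≢ (∈-filterᵇ⁻ (isNonzero F) {xs = vecs} a∈)))

      regularˡ : ∀ {b} → b ∈ vs → ∑ vs (λ a → ⟦ r a b ⟧) ≡ + (card ℕ.^ suc m)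
      regularˡ {b} b∈ = trans (∑-cong vs λ a → cong (_≐ 1#) (dot-comm a b)) (regularʳ b∈)

      -- G is extended by 0. In `form₁` the J term vanishes as the sum is zero, and the `lines` term
      -- enters with a minus sign, so only p · `square` remains as an upper bound.
      spectral : ∀ G → ∑ vs G ≡ 0ℤ →
        ∑ vs (λ b → ∑ vs (λ a → ⟦ r a b ⟧ * G a) * ∑ vs (λ a → ⟦ r a b ⟧ * G a)) ℤ.≤ + (card ℕ.^ suc m) * ∑ vs (λ a → G a * G a)
      spectral G ∑G≡0 = begin
        ∑ vs (λ b → ∑ vs (λ a → ⟦ r a b ⟧ * G a) * ∑ vs (λ a → ⟦ r a b ⟧ * G a))
          ≡⟨ ∑-cong vs (λ b → cong₂ _*_ (∑-filter-*ʳ (isNonzero F) vecs (λ a → dot F a b ≐ 1#) G) (∑-filter-*ʳ (isNonzero F) vecs (λ a → dot F a b ≐ 1#) G)) ⟩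
        ∑ vs (λ b → R₁ b * R₁ b)                          ≡⟨ ∑-filter (isNonzero F) vecs _ ⟩
        ∑ᵛ n (λ b → ⟦ isNonzero F b ⟧ * (R₁ b * R₁ b))
          ≤⟨ ℤₚ.0≤i-j⇒j≤i (subst (0ℤ ℤ.≤_) (∑-- vecs _ _) (∑-nonneg vecs λ b → drop (isNonzero F b) (R₁ b))) ⟩
        ∑ᵛ n (λ b → R₁ b * R₁ b)                          ≡⟨ form₁ ⟩
        (p' * (total * total) + p * square) - p' * lines ≡⟨ cong (λ z → (p' * (z * z) + p * square) - p' * lines) total≡0 ⟩
        (p' * (0ℤ * 0ℤ) + p * square) - p' * lines ≤⟨ 0≤-by (0≤* {p'} (ℤ.+≤+ z≤n) 0≤lines) (rest p' p square lines) ⟩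
        p * square                                        ≡⟨ cong (p *_) (∑-filter-square (isNonzero F) vecs G) ⟩
        p * ∑ vs (λ a → G a * G a) ∎
        where
        open ℤₚ.≤-Reasoning
        open Form (λ a → ⟦ isNonzero F a ⟧ * G a) (trans (cong (λ b → ⟦ b ⟧ * G (zeros n)) (isNonzero-zeros n)) (ℤₚ.*-zeroˡ (G (zeros n))))
        total≡0 : total ≡ 0ℤ
        total≡0 = trans (sym (∑-filter (isNonzero F) vecs G)) ∑G≡0
        rest : ∀ p' p s l → p' * l ≡ p * s - ((p' * (0ℤ * 0ℤ) + p * s) - p' * l)
        rest = solve-∀
        drop : ∀ b x → 0ℤ ℤ.≤ x * x - ⟦ b ⟧ * (x * x)
        drop true x = ≤⇒0≤ (ℤₚ.≤-reflexive (ℤₚ.*-identityˡ (x * x)))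
        drop false x = subst (0ℤ ℤ.≤_) (sym (trans (cong (λ z → x * x - z) (ℤₚ.*-zeroˡ (x * x))) (ℤₚ.+-identityʳ (x * x)))) (0≤i*i x)

      ≐0-scale : ∀ c x → c ≢ 0# → (c 𝔽.* x ≐ 0#) ≡ (x ≐ 0#)
      ≐0-scale c x c≢0 = ⟦⇔⟧ ((c 𝔽.* x) ≟ 0#) (x ≟ 0#)
        (λ e → 𝔽.*-cancelˡ c c≢0 (trans e (sym (𝔽.zeroʳ c)))) (λ { refl → 𝔽.zeroʳ c })

      -- A hyperplane through 0 has q^(n-1) vectors: zero, and q - 1 on each of its points.
      regular₀ʳ : ∀ {a} → a ∈ vs₀ → ∑ vs₀ (λ b → ⟦ r₀ a b ⟧) ≡ + geometric (suc m)
      regular₀ʳ {a} a∈ = cancel-q-1 (begin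
        (q - 1ℤ) * ∑ vs₀ (λ b → ⟦ r₀ a b ⟧) ≡⟨ cong ((q - 1ℤ) *_) (∑-filter (isNormalized F) vecs _) ⟩
        (q - 1ℤ) * ∑ᵛ n (λ b → ⟦ isNormalized F b ⟧ * (dot F a b ≐ 0#))   ≡⟨ cancel₁ 1ℤ _ ⟩
        (1ℤ + (q - 1ℤ) * ∑ᵛ n (λ b → ⟦ isNormalized F b ⟧ * (dot F a b ≐ 0#))) - 1ℤ
          ≡⟨ cong (_- 1ℤ) (trans (cong (_+ (q - 1ℤ) * ∑ᵛ n (λ b → ⟦ isNormalized F b ⟧ * (dot F a b ≐ 0#))) (sym (⟦yes⟧ (dot F a (zeros n) ≟ 0#) (dot-zerosʳ a))))
               (trans (sym (projective (λ b → dot F a b ≐ 0#) λ c b c≢0 → trans (cong (_≐ 0#) (dot-⊙ʳ c a b)) (≐0-scale c (dot F a b) c≢0)))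
               (trans (hyperplane (suc m) a 0# (isNormalized⇒≢ (∈-filterᵇ⁻ (isNormalized F) {xs = vecs} a∈))) (geometric-sum (suc m))))) ⟩
        (1ℤ + (q - 1ℤ) * + geometric (suc m)) - 1ℤ                        ≡⟨ cancel₁ 1ℤ _ ⟨
        (q - 1ℤ) * + geometric (suc m)                                    ∎)
        where
        open ≡-Reasoning
        cancel₁ : ∀ x y → y ≡ (x + y) - x
        cancel₁ = solve-∀

      regular₀ˡ : ∀ {b} → b ∈ vs₀ → ∑ vs₀ (λ a → ⟦ r₀ a b ⟧) ≡ + geometric (suc m)
      regular₀ˡ {b} b∈ = trans (∑-cong vs₀ λ a → cong (_≐ 0#) (dot-comm a b)) (regular₀ʳ b∈)

      -- G is extended by 0 off the normalized vectors. Each line through 0 then meets the support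
      -- at most once, so `lines` equals `square` and the estimate is in fact an equality.
      spectral₀ : ∀ G → ∑ vs₀ G ≡ 0ℤ →
        ∑ vs₀ (λ b → ∑ vs₀ (λ a → ⟦ r₀ a b ⟧ * G a) * ∑ vs₀ (λ a → ⟦ r₀ a b ⟧ * G a)) ℤ.≤ + (card ℕ.^ m) * ∑ vs₀ (λ a → G a * G a)
      spectral₀ G ∑G≡0 = ℤₚ.≤-reflexive (cancel-q-1 (begin
        (q - 1ℤ) * ∑ vs₀ (λ b → ∑ vs₀ (λ a → ⟦ r₀ a b ⟧ * G a) * ∑ vs₀ (λ a → ⟦ r₀ a b ⟧ * G a))
          ≡⟨ cong ((q - 1ℤ) *_) (∑-cong vs₀ (λ b → cong₂ _*_ (∑-filter-*ʳ (isNormalized F) vecs (λ a → dot F a b ≐ 0#) G) (∑-filter-*ʳ (isNormalized F) vecs (λ a → dot F a b ≐ 0#) G))) ⟩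
        (q - 1ℤ) * ∑ vs₀ (λ b → R₀ b * R₀ b) ≡⟨ cong ((q - 1ℤ) *_) (∑-filter (isNormalized F) vecs _) ⟩
        (q - 1ℤ) * ∑ᵛ n (λ b → ⟦ isNormalized F b ⟧ * (R₀ b * R₀ b))      ≡⟨ ℤₚ.+-identityˡ _ ⟨
        0ℤ + (q - 1ℤ) * ∑ᵛ n (λ b → ⟦ isNormalized F b ⟧ * (R₀ b * R₀ b))
          ≡⟨ cong (_+ (q - 1ℤ) * ∑ᵛ n (λ b → ⟦ isNormalized F b ⟧ * (R₀ b * R₀ b))) (cong₂ _*_ R₀-zeros R₀-zeros) ⟨
        R₀ (zeros n) * R₀ (zeros n) + (q - 1ℤ) * ∑ᵛ n (λ b → ⟦ isNormalized F b ⟧ * (R₀ b * R₀ b))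
          ≡⟨ projective (λ b → R₀ b * R₀ b) (λ c b c≢0 → cong₂ _*_ (R₀-scale c b c≢0) (R₀-scale c b c≢0)) ⟨
        ∑ᵛ n (λ b → R₀ b * R₀ b)                                          ≡⟨ form₀ ⟩
        p' * (total * total) + (p' * (q - 1ℤ)) * lines ≡⟨ cong₂ (λ z l → p' * (z * z) + (p' * (q - 1ℤ)) * l) total≡0 lines≡ ⟩
        p' * (0ℤ * 0ℤ) + (p' * (q - 1ℤ)) * square                         ≡⟨ rest p' (q - 1ℤ) square ⟩
        (q - 1ℤ) * (p' * square) ≡⟨ cong (λ z → (q - 1ℤ) * (p' * z)) (∑-filter-square (isNormalized F) vecs G) ⟩
        (q - 1ℤ) * (p' * ∑ vs₀ (λ a → G a * G a))                         ∎))
        where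
        open ≡-Reasoning
        G̃ : Vec Carrier n → ℤ
        G̃ a = ⟦ isNormalized F a ⟧ * G a
        open Form G̃ (trans (cong (λ b → ⟦ b ⟧ * G (zeros n)) (isNormalized-zeros n)) (ℤₚ.*-zeroˡ (G (zeros n))))
        total≡0 : total ≡ 0ℤ
        total≡0 = trans (sym (∑-filter (isNormalized F) vecs G)) ∑G≡0
        R₀-zeros : R₀ (zeros n) ≡ 0ℤ
        R₀-zeros = trans (∑-cong vecs λ a → trans (cong (_* G̃ a) (⟦yes⟧ (dot F a (zeros n) ≟ 0#) (dot-zerosʳ a))) (ℤₚ.*-identityˡ (G̃ a))) total≡0
        R₀-scale : ∀ c b → c ≢ 0# → R₀ (c ⊙ b) ≡ R₀ b
        R₀-scale c b c≢0 = ∑-cong vecs λ a → cong (_* G̃ a) (trans (cong (_≐ 0#) (dot-⊙ʳ c a b)) (≐0-scale c (dot F a b) c≢0))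
        rest : ∀ p' d s → p' * (0ℤ * 0ℤ) + (p' * d) * s ≡ d * (p' * s)
        rest = solve-∀
        lines≡ : lines ≡ square
        lines≡ = ∑-cong vecs λ a → trans (∑-*ˡ elems (G̃ a) _) (line a)
          where
          line : ∀ a → G̃ a * ∑ᶠ (λ s → G̃ (s ⊙ a)) ≡ G̃ a * G̃ a
          line a with isNormalized F a in norm
          ... | false = trans (cong (_* ∑ᶠ (λ s → G̃ (s ⊙ a))) (ℤₚ.*-zeroˡ (G a)))
                  (trans (ℤₚ.*-zeroˡ (∑ᶠ (λ s → G̃ (s ⊙ a)))) (sym (trans (cong (_* (0ℤ * G a)) (ℤₚ.*-zeroˡ (G a))) (ℤₚ.*-zeroˡ (0ℤ * G a)))))
          ... | true = cong (1ℤ * G a *_) (trans (∑-point listing 1# (λ s → G̃ (s ⊙ a)) other) (trans (cong G̃ (⊙-identity a)) (cong (λ b → ⟦ b ⟧ * G a) norm)))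
            where
            other : ∀ s → s ≢ 1# → G̃ (s ⊙ a) ≡ 0ℤ
            other s s≢1 with isNormalized F (s ⊙ a) in norm'
            ... | true = contradiction (normalized-multiple a s norm norm') s≢1
            ... | false = ℤₚ.*-zeroˡ (G (s ⊙ a))

      card^≤geometric : card ℕ.^ m ℕ.≤ geometric (suc m)
      card^≤geometric = ℕₚ.m≤m+n (card ℕ.^ m) (geometric m)

      L≤k² : card ℕ.^ suc m ℕ.≤ card ℕ.^ suc m ℕ.* card ℕ.^ suc m
      L≤k² = ℕₚ.m≤m*n _ _ {{ℕ.>-nonZero (card^≥1 (suc m))}}

      L₀≤k₀² : card ℕ.^ m ℕ.≤ geometric (suc m) ℕ.* geometric (suc m)
      L₀≤k₀² = ℕₚ.≤-trans card^≤geometric (ℕₚ.m≤m*n _ _ {{ℕ.>-nonZero (ℕₚ.≤-trans (card^≥1 m) card^≤geometric)}})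

-- The quadratic character of K and its hyperplane sums.

module QuadraticCharacter where

  open FiniteSums
  open FieldTheory
  open Vectors
  open CompanionRing
  open Counting
  open BipartiteCuts using (sgn; sgn²)
  open GraphSpectra
  open import Data.Integer as ℤ using (ℤ; +_; 0ℤ; 1ℤ; _+_; _*_; _-_; -_)

  -- By Euler's criterion x^H = ±1 for x ≢ 0, and the sign is the quadratic character.
  module EulerCharacter (K : FiniteField) (H : ℕ) (card≡ : FiniteField.card K ≡ suc (H ℕ.+ H)) where

    private
      module K = Field K
    open Field K using (Carrier; 0#; 1#; _≟_; _^_; elems; card)

    residue : Carrier → Bool
    residue x = does ((x ^ H) ≟ 1#)

    χ : Carrier → ℤ
    χ = sgn ∘ residue

    x^H² : ∀ x → x ≢ 0# → (x ^ H) K.* (x ^ H) ≡ 1#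
    x^H² x x≢0 = K.*-cancelˡ x x≢0 (begin
      x K.* ((x ^ H) K.* (x ^ H)) ≡⟨ cong (x K.*_) (K.^-homo-* x H H) ⟨
      x ^ suc (H ℕ.+ H)           ≡⟨ cong (x ^_) card≡ ⟨
      x ^ card                    ≡⟨ K.fermat x ⟩
      x                           ≡⟨ K.*-identityʳ x ⟨
      x K.* 1#                    ∎)
      where open ≡-Reasoning

    square≡1 : ∀ y → y K.* y ≡ 1# → y ≡ 1# ⊎ y ≡ K.- 1#
    square≡1 y e with K.noZeroDivisors (y K.+ K.- 1#) (y K.+ 1#) product
      where
      open ≡-Reasoning
      product : (y K.+ K.- 1#) K.* (y K.+ 1#) ≡ 0#
      product = begin
        (y K.+ K.- 1#) K.* (y K.+ 1#)                       ≡⟨ K.distribʳ (y K.+ 1#) y (K.- 1#) ⟩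
        y K.* (y K.+ 1#) K.+ (K.- 1#) K.* (y K.+ 1#) ≡⟨ cong₂ K._+_ (K.distribˡ y y 1#) (trans (sym (K.-‿distribˡ-* 1# (y K.+ 1#))) (cong K.-_ (K.*-identityˡ _))) ⟩
        (y K.* y K.+ y K.* 1#) K.+ K.- (y K.+ 1#) ≡⟨ cong (K._+ (K.- (y K.+ 1#))) (trans (cong₂ K._+_ e (K.*-identityʳ y)) (K.+-comm 1# y)) ⟩
        (y K.+ 1#) K.+ K.- (y K.+ 1#)                       ≡⟨ K.-‿inverseʳ _ ⟩
        0#                                                  ∎
    ... | inj₁ z = inj₁ (K.x-y≡0⇒x≡y z)
    ... | inj₂ z = inj₂ (K.x-y≡0⇒x≡y (trans (cong (y K.+_) (K.-‿involutive 1#)) z))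

    residue-* : ∀ y z → y K.* y ≡ 1# → z K.* z ≡ 1# → sgn (does ((y K.* z) ≟ 1#)) ≡ sgn (does (y ≟ 1#)) * sgn (does (z ≟ 1#))
    residue-* y z yy zz with y ≟ 1# | z ≟ 1# | (y K.* z) ≟ 1#
    ... | yes refl | yes refl | yes _ = refl
    ... | yes refl | yes refl | no n = contradiction (K.*-identityˡ 1#) n
    ... | yes refl | no n | yes e = contradiction (trans (sym (K.*-identityˡ z)) e) n
    ... | yes refl | no _ | no _ = refl
    ... | no n | yes refl | yes e = contradiction (trans (sym (K.*-identityʳ y)) e) n
    ... | no _ | yes refl | no _ = refl
    ... | no _ | no _ | yes _ = refl
    ... | no y≢1 | no z≢1 | no n = contradiction product n
      where
      pick : ∀ {w} → w ≢ 1# → w ≡ 1# ⊎ w ≡ K.- 1# → w ≡ K.- 1#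
      pick n (inj₁ e) = contradiction e n
      pick n (inj₂ e) = e
      y≡z : y ≡ z
      y≡z = trans (pick y≢1 (square≡1 y yy)) (sym (pick z≢1 (square≡1 z zz)))
      product : y K.* z ≡ 1#
      product = trans (cong (y K.*_) (sym y≡z)) yy

    χ-* : ∀ x y → x ≢ 0# → y ≢ 0# → χ (x K.* y) ≡ χ x * χ y
    χ-* x y x≢0 y≢0 = trans (cong (λ z → sgn (does (z ≟ 1#))) (K.^-distrib-* x y H))
      (residue-* (x ^ H) (y ^ H) (x^H² x x≢0) (x^H² y y≢0))

    H≥1 : 1 ℕ.≤ H
    H≥1 = go H (subst (2 ℕ.≤_) card≡ K.card≥2)
      where
      go : ∀ h → 2 ℕ.≤ suc (h ℕ.+ h) → 1 ℕ.≤ h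
      go zero (s≤s ())
      go (suc h) _ = s≤s z≤n

    -- If x^H = 1 for all x ≢ 0, then x^(H+1) = x everywhere and K would have at most H + 1 < 2H + 1
    -- elements.
    nonresidue : ∃ λ x → x ≢ 0# × (x ^ H) ≢ 1#
    nonresidue = decide (search elems)
      where
      search : ∀ xs → All (λ x → x ≢ 0# → (x ^ H) ≡ 1#) xs ⊎ ∃ λ x → x ≢ 0# × (x ^ H) ≢ 1#
      search [] = inj₁ []
      search (x ∷ xs) with x ≟ 0# | (x ^ H) ≟ 1# | search xs
      ... | _ | _ | inj₂ r = inj₂ r
      ... | no x≢0 | no n | _ = inj₂ (x , x≢0 , n)
      ... | yes z | _ | inj₁ h = inj₁ ((λ n → contradiction z n) ∷ h)
      ... | no _ | yes e | inj₁ h = inj₁ ((λ _ → e) ∷ h)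
      decide : (All (λ x → x ≢ 0# → (x ^ H) ≡ 1#) elems ⊎ ∃ λ x → x ≢ 0# × (x ^ H) ≢ 1#) → ∃ λ x → x ≢ 0# × (x ^ H) ≢ 1#
      decide (inj₂ r) = r
      decide (inj₁ h) = contradiction (K.power-identity⇒card≤ (ℕ.pred H) fixed) (ℕₚ.<⇒≱ small)
        where
        sucpred : suc (ℕ.pred H) ≡ H
        sucpred = ℕₚ.suc-pred H {{ℕ.>-nonZero H≥1}}
        small : suc (suc (ℕ.pred H)) ℕ.< card
        small = subst₂ ℕ._<_ (cong suc (sym sucpred)) (sym card≡) (s≤s (ℕₚ.m<m+n H H≥1))
        fixed : ∀ x → x ^ suc (suc (ℕ.pred H)) ≡ x
        fixed x = trans (cong (λ k → x ^ suc k) sucpred) (by-cases (x ≟ 0#))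
          where
          by-cases : Dec (x ≡ 0#) → x K.* (x ^ H) ≡ x
          by-cases (yes refl) = K.zeroˡ _
          by-cases (no x≢0) = trans (cong (x K.*_) (All.lookup h (K.complete x) x≢0)) (K.*-identityʳ x)

    χ-nonresidue : ∀ x → (x ^ H) ≢ 1# → χ x ≡ - 1ℤ
    χ-nonresidue x n with (x ^ H) ≟ 1#
    ... | yes e = contradiction e n
    ... | no _ = refl

    χ-residue : ∀ x → (x ^ H) ≡ 1# → χ x ≡ 1ℤ
    χ-residue x e with (x ^ H) ≟ 1#
    ... | yes _ = refl
    ... | no n = contradiction e n

  self-negative⇒0 : ∀ {x} → x ≡ - 1ℤ * x → x ≡ 0ℤ
  self-negative⇒0 {x} e = ℤₚ.*-cancelˡ-≡ (+ 2) x 0ℤ (trans (double x) (trans (cong (_+_ x) e) (cancel x)))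
    where
    double : ∀ x → + 2 * x ≡ x + x
    double = solve-∀
    cancel : ∀ x → x + - 1ℤ * x ≡ 0ℤ
    cancel = solve-∀

  square-≡ : ∀ {x y} → x * x ≡ y * y → x ≡ y ⊎ x ≡ - y
  square-≡ {x} {y} e with ℤₚ.i*j≡0⇒i≡0∨j≡0 (x - y) (trans (factor x y) (ℤₚ.i≡j⇒i-j≡0 e))
    where
    factor : ∀ x y → (x - y) * (x + y) ≡ x * x - y * y
    factor = solve-∀
  ... | inj₁ z = inj₁ (ℤₚ.i-j≡0⇒i≡j x y z)
  ... | inj₂ z = inj₂ (ℤₚ.i-j≡0⇒i≡j x (- y) (trans (cong (_+_ x) (ℤₚ.neg-involutive y)) z))

  module OddOrder (F : FiniteField) (h : ℕ) (card≡ : FiniteField.card F ≡ suc (h ℕ.+ h)) where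

    open FiniteField F using (card)
    open NormalForms F using (geometric)

    -- Since q - 1 = 2h, q^j - 1 is twice h · geometric j. For j = n this number is the exponent H
    -- of Euler's criterion in K.
    card-power : ∀ j → card ℕ.^ j ≡ suc (h ℕ.* geometric j ℕ.+ h ℕ.* geometric j)
    card-power zero = cong suc (sym (cong₂ ℕ._+_ (ℕₚ.*-zeroʳ h) (ℕₚ.*-zeroʳ h)))
    card-power (suc j) = begin
      card ℕ.* c                                      ≡⟨ cong (ℕ._* c) card≡ ⟩
      c ℕ.+ (h ℕ.+ h) ℕ.* c                           ≡⟨ cong (ℕ._+ (h ℕ.+ h) ℕ.* c) (card-power j) ⟩
      suc (h ℕ.* g ℕ.+ h ℕ.* g) ℕ.+ (h ℕ.+ h) ℕ.* c   ≡⟨ lemma h g c ⟩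
      suc (h ℕ.* (c ℕ.+ g) ℕ.+ h ℕ.* (c ℕ.+ g))       ∎
      where
      open ≡-Reasoning
      c = card ℕ.^ j
      g = geometric j
      lemma : ∀ h g c → suc (h ℕ.* g ℕ.+ h ℕ.* g) ℕ.+ (h ℕ.+ h) ℕ.* c ≡ suc (h ℕ.* (c ℕ.+ g) ℕ.+ h ℕ.* (c ℕ.+ g))
      lemma = ℕ-solve-∀

    -- A sum of evenly many powers of q, all of them odd.
    geometric-even : ∀ j → ∃ λ g → geometric (j ℕ.+ j) ≡ 2 ℕ.* g
    geometric-even zero = 0 , refl
    geometric-even (suc j) = step (geometric-even j)
      where
      open ≡-Reasoning
      k = j ℕ.+ j
      lemma : ∀ x y g → suc (x ℕ.+ x) ℕ.+ (suc (y ℕ.+ y) ℕ.+ 2 ℕ.* g) ≡ 2 ℕ.* (suc (x ℕ.+ y) ℕ.+ g)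
      lemma = ℕ-solve-∀
      step : (∃ λ g → geometric k ≡ 2 ℕ.* g) → ∃ λ g → geometric (suc j ℕ.+ suc j) ≡ 2 ℕ.* g
      step (g , e) = suc (h ℕ.* geometric (suc k) ℕ.+ h ℕ.* geometric k) ℕ.+ g , (begin
        geometric (suc (j ℕ.+ suc j))                               ≡⟨ cong (λ l → geometric (suc l)) (ℕₚ.+-suc j j) ⟩
        card ℕ.^ suc k ℕ.+ (card ℕ.^ k ℕ.+ geometric k) ≡⟨ cong₂ ℕ._+_ (card-power (suc k)) (cong₂ ℕ._+_ (card-power k) e) ⟩
        suc (h ℕ.* geometric (suc k) ℕ.+ h ℕ.* geometric (suc k)) ℕ.+ (suc (h ℕ.* geometric k ℕ.+ h ℕ.* geometric k) ℕ.+ 2 ℕ.* g)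
          ≡⟨ lemma (h ℕ.* geometric (suc k)) (h ℕ.* geometric k) g ⟩
        2 ℕ.* (suc (h ℕ.* geometric (suc k) ℕ.+ h ℕ.* geometric k) ℕ.+ g) ∎)

    geometric-odd : ∀ j → ∃ λ g → geometric (suc (j ℕ.+ j)) ≡ suc (2 ℕ.* g)
    geometric-odd j = step (geometric-even j)
      where
      k = j ℕ.+ j
      lemma : ∀ x g → suc (x ℕ.+ x) ℕ.+ 2 ℕ.* g ≡ suc (2 ℕ.* (x ℕ.+ g))
      lemma = ℕ-solve-∀
      step : (∃ λ g → geometric k ≡ 2 ℕ.* g) → ∃ λ g → geometric (suc k) ≡ suc (2 ℕ.* g)
      step (g , e) = h ℕ.* geometric k ℕ.+ g , trans (cong₂ ℕ._+_ (card-power k) e) (lemma (h ℕ.* geometric k) g)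

  module CharacterSums (F : FiniteField) (h : ℕ) (card≡ : FiniteField.card F ≡ suc (h ℕ.+ h)) (m : ℕ)
    (r : Vec (FiniteField.Carrier F) (suc (suc m)))
    (invertible : ∀ a → a ≢ Field.zeros F (suc (suc m)) → ∃ λ b → Companion._⊛_ F (suc m) r a b ≡ Companion.one F (suc m) r) where

    open Field F using (Carrier; 0#; 1#; _≟_; _^_; elems; card; zeros; listing; 0≢1)
    open VectorSpace F
    open Count F
    open Dimension m
    open NormalForms F
    open UmGraphs m hiding (r)
    open Companion F (suc m) r using (_⊛_; one; act; shift; _⋆_; ⊛-comm; act-zeros; ⊙≡⊛; ⊙one-⋆; companionField)

    H : ℕ
    H = h ℕ.* geometric n

    𝕂 : FiniteField
    𝕂 = companionField invertible

    private
      module 𝕂 = Field 𝕂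

    open EulerCharacter 𝕂 H (trans (length-allVecs n) (OddOrder.card-power F h card≡ n)) public

    𝟎 : Vec Carrier n
    𝟎 = zeros n

    -- The character proper, with value 0 at 0. The function χ is a sign even at 0, as a cut needs a
    -- Boolean label.
    χ̃ : Vec Carrier n → ℤ
    χ̃ a = ⟦ isNonzero F a ⟧ * χ a

    χ̃-𝟎 : χ̃ 𝟎 ≡ 0ℤ
    χ̃-𝟎 = trans (cong (λ b → ⟦ b ⟧ * χ 𝟎) (isNonzero-zeros n)) (ℤₚ.*-zeroˡ (χ 𝟎))

    χ̃-≢ : ∀ {a} → a ≢ 𝟎 → χ̃ a ≡ χ a
    χ̃-≢ {a} a≢0 = trans (cong (λ b → ⟦ b ⟧ * χ a) (isNonzero-≢ a a≢0)) (ℤₚ.*-identityˡ (χ a))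

    χ̃-⊛ : ∀ u a → u ≢ 𝟎 → χ̃ (u ⊛ a) ≡ χ u * χ̃ a
    χ̃-⊛ u a u≢0 = by-cases (a ≟ᵛ 𝟎)
      where
      by-cases : Dec (a ≡ 𝟎) → χ̃ (u ⊛ a) ≡ χ u * χ̃ a
      by-cases (yes a≡0) = trans (trans (cong χ̃ (trans (cong (u ⊛_) a≡0) (act-zeros u))) χ̃-𝟎)
        (sym (trans (cong (χ u *_) (trans (cong χ̃ a≡0) χ̃-𝟎)) (ℤₚ.*-zeroʳ (χ u))))
      by-cases (no a≢0) = trans (χ̃-≢ (𝕂.*-nonzero u≢0 a≢0)) (trans (χ-* u a u≢0 a≢0) (cong (χ u *_) (sym (χ̃-≢ a≢0))))

    χ² : ∀ a → χ a * χ a ≡ 1ℤ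
    χ² a = sgn² (residue a)

    χ̃² : ∀ a → χ̃ a * χ̃ a ≡ ⟦ isNonzero F a ⟧
    χ̃² a = trans (shuffle ⟦ isNonzero F a ⟧ (χ a)) (trans (cong₂ _*_ (⟦⟧² (isNonzero F a)) (χ² a)) (ℤₚ.*-identityʳ _))
      where
      shuffle : ∀ x y → (x * y) * (x * y) ≡ (x * x) * (y * y)
      shuffle = solve-∀

    ∑-⊛ : ∀ u → u ≢ 𝟎 → (f : Vec Carrier n → ℤ) → ∑ᵛ n (λ a → f (u ⊛ a)) ≡ ∑ᵛ n f
    ∑-⊛ u u≢0 = ∑-reindex (vecListing n) (u ⊛_) (u⁻¹ ⊛_)
      (𝕂.y*[x*z] {u} {u⁻¹} (𝕂.inverseˡ u u≢0)) (𝕂.y*[x*z] {u⁻¹} {u} (𝕂.inverseʳ u u≢0))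
      where u⁻¹ = proj₁ (invertible u u≢0)

    open Form χ̃ χ̃-𝟎

    -- Multiplication by a nonresidue permutes K and changes the sign of the sum.
    total≡0 : total ≡ 0ℤ
    total≡0 = from nonresidue
      where
      from : (∃ λ u → u ≢ 𝟎 × (u ⋆ H) ≢ one) → total ≡ 0ℤ
      from (u , u≢0 , n) = self-negative⇒0 (trans (sym (∑-⊛ u u≢0 χ̃)) (trans (∑-cong vecs λ a →
        trans (χ̃-⊛ u a u≢0) (cong (_* χ̃ a) (χ-nonresidue u n))) (∑-*ˡ vecs (- 1ℤ) χ̃)))

    M : ℤ
    M = q * p - 1ℤ

    ∑-nonzero : ∑ᵛ n (λ a → ⟦ isNonzero F a ⟧) ≡ M
    ∑-nonzero = trans (add-zero (∑ᵛ n (λ a → ⟦ isNonzero F a ⟧))) (cong (_- 1ℤ) (begin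
      ∑ᵛ n (λ a → ⟦ isNonzero F a ⟧) + 1ℤ
        ≡⟨ cong (_+_ (∑ᵛ n (λ a → ⟦ isNonzero F a ⟧))) (trans (∑-point (vecListing n) 𝟎 isZeroᵛ (λ v v≢0 → ⟦no⟧ (v ≟ᵛ 𝟎) v≢0)) (⟦yes⟧ (𝟎 ≟ᵛ 𝟎) refl)) ⟨
      ∑ᵛ n (λ a → ⟦ isNonzero F a ⟧) + ∑ᵛ n isZeroᵛ                  ≡⟨ ∑-+ vecs _ _ ⟨
      ∑ᵛ n (λ a → ⟦ isNonzero F a ⟧ + isZeroᵛ a)                     ≡⟨ ∑-cong vecs (λ a → either a (a ≟ᵛ 𝟎) refl) ⟩
      ∑ᵛ n (λ a → 1ℤ)                                                ≡⟨ trans (∑ᵛ-const n 1ℤ) (ℤₚ.*-identityʳ _) ⟩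
      + (card ℕ.^ n)                                                 ≡⟨ qⁿ≡ ⟩
      q * p                                                          ∎))
      where
      open ≡-Reasoning
      add-zero : ∀ x → x ≡ (x + 1ℤ) - 1ℤ
      add-zero = solve-∀
      either : ∀ a (d : Dec (a ≡ 𝟎)) → d ≡ (a ≟ᵛ 𝟎) → ⟦ isNonzero F a ⟧ + isZeroᵛ a ≡ 1ℤ
      either a (yes a≡0) _ = cong₂ _+_ (cong ⟦_⟧ (trans (cong (isNonzero F) a≡0) (isNonzero-zeros n))) (⟦yes⟧ (a ≟ᵛ 𝟎) a≡0)
      either a (no a≢0) _ = cong₂ _+_ (cong ⟦_⟧ (isNonzero-≢ a a≢0)) (⟦no⟧ (a ≟ᵛ 𝟎) a≢0)

    square≡ : square ≡ M
    square≡ = trans (∑-cong vecs χ̃²) ∑-nonzero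

    scalar : Carrier → Vec Carrier n
    scalar s = s ⊙ one

    scalar≢𝟎 : ∀ {s} → s ≢ 0# → scalar s ≢ 𝟎
    scalar≢𝟎 {s} s≢0 e = s≢0 (trans (sym (𝔽.*-identityʳ s)) (cong Vec.head e))

    χ̃-⊙ : ∀ s a → s ≢ 0# → χ̃ (s ⊙ a) ≡ χ (scalar s) * χ̃ a
    χ̃-⊙ s a s≢0 = trans (cong χ̃ (⊙≡⊛ s a)) (χ̃-⊛ (scalar s) a (scalar≢𝟎 s≢0))

    -- The sum of the character over F*: it is q - 1 or 0, according to whether χ is trivial on F*.
    ω : ℤ
    ω = ∑ᶠ (λ s → χ̃ (scalar s))

    lines≡ : lines ≡ M * ω
    lines≡ = begin
      ∑ᵛ n (λ a → ∑ᶠ (λ s → χ̃ a * χ̃ (s ⊙ a))) ≡⟨ ∑-cong vecs (λ a → ∑-cong elems λ s → point a s (s ≟ 0#)) ⟩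
      ∑ᵛ n (λ a → ∑ᶠ (λ s → (χ̃ a * χ̃ a) * χ̃ (scalar s)))      ≡⟨ ∑-cong vecs (λ a → ∑-*ˡ elems (χ̃ a * χ̃ a) _) ⟩
      ∑ᵛ n (λ a → (χ̃ a * χ̃ a) * ω)                            ≡⟨ ∑-*ʳ vecs ω _ ⟩
      square * ω                                               ≡⟨ cong (_* ω) square≡ ⟩
      M * ω                                                    ∎
      where
      open ≡-Reasoning
      shuffle : ∀ x y → x * (y * x) ≡ (x * x) * y
      shuffle = solve-∀
      point : ∀ a s → Dec (s ≡ 0#) → χ̃ a * χ̃ (s ⊙ a) ≡ (χ̃ a * χ̃ a) * χ̃ (scalar s)
      point a s (yes s≡0) = trans (cong (χ̃ a *_) (vanish a)) (trans (ℤₚ.*-zeroʳ (χ̃ a))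
          (sym (trans (cong (χ̃ a * χ̃ a *_) (vanish one)) (ℤₚ.*-zeroʳ (χ̃ a * χ̃ a)))))
        where
        vanish : ∀ v → χ̃ (s ⊙ v) ≡ 0ℤ
        vanish v = trans (cong χ̃ (trans (cong (_⊙ v) s≡0) (⊙-zeroˡ v))) χ̃-𝟎
      point a s (no s≢0) = trans (cong (χ̃ a *_) (χ̃-⊙ s a s≢0)) (trans (shuffle (χ̃ a) (χ (scalar s)))
        (cong (χ̃ a * χ̃ a *_) (sym (χ̃-≢ (scalar≢𝟎 s≢0)))))

    -- The constant coefficients of b, Xb, X^2 b, ...: for k = n, the coordinates of the functional
    -- that sends a to the constant coefficient of ab.
    dual : ∀ k → Vec Carrier n → Vec Carrier k
    dual zero b = []
    dual (suc k) b = Vec.head b ∷ dual k (shift b)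

    head-⊕ : ∀ (u v : Vec Carrier n) → Vec.head (u ⊕ v) ≡ Vec.head u 𝔽.+ Vec.head v
    head-⊕ (x ∷ u) (y ∷ v) = refl

    head-⊙ : ∀ c (v : Vec Carrier n) → Vec.head (c ⊙ v) ≡ c 𝔽.* Vec.head v
    head-⊙ c (y ∷ v) = refl

    dot-dual : ∀ {k} (cs : Vec Carrier k) b → dot F cs (dual k b) ≡ Vec.head (act cs b)
    dot-dual [] b = refl
    dot-dual (c ∷ cs) b = trans (cong₂ 𝔽._+_ (sym (head-⊙ c b)) (dot-dual cs (shift b))) (sym (head-⊕ (c ⊙ b) (act cs (shift b))))

    -- For b ≢ b' the inverse a of b - b' separates the two functionals: the difference of their
    -- values at a is the constant coefficient of 1.
    dual-injective : ∀ {b b'} → dual n b ≡ dual n b' → b ≡ b'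
    dual-injective {b} {b'} e = by-cases (b ≟ᵛ b')
      where
      open ≡-Reasoning
      by-cases : Dec (b ≡ b') → b ≡ b'
      by-cases (yes b≡b') = b≡b'
      by-cases (no b≢b') = contradiction (begin
          0#                                                            ≡⟨ 𝔽.-‿inverseʳ (dot F a (dual n b)) ⟨
          dot F a (dual n b) 𝔽.+ 𝔽.- dot F a (dual n b) ≡⟨ cong₂ (λ x y → x 𝔽.+ 𝔽.- y) (dot-dual a b) (trans (cong (dot F a) e) (dot-dual a b')) ⟩
          Vec.head (a ⊛ b) 𝔽.+ 𝔽.- Vec.head (a ⊛ b') ≡⟨ cong (Vec.head (a ⊛ b) 𝔽.+_) (head-⊝ (a ⊛ b')) ⟨
          Vec.head (a ⊛ b) 𝔽.+ Vec.head (⊝ (a ⊛ b'))                    ≡⟨ head-⊕ (a ⊛ b) (⊝ (a ⊛ b')) ⟨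
          Vec.head (a ⊛ b ⊕ ⊝ (a ⊛ b')) ≡⟨ cong (λ v → Vec.head (a ⊛ b ⊕ v)) (𝕂.-‿distribʳ-* a b') ⟩
          Vec.head (a ⊛ b ⊕ a ⊛ (⊝ b'))                                 ≡⟨ cong Vec.head (𝕂.distribˡ a b (⊝ b')) ⟨
          Vec.head (a ⊛ (b ⊕ ⊝ b'))                                     ≡⟨ cong Vec.head (𝕂.inverseˡ (b ⊕ ⊝ b') d≢0) ⟩
          1#                                                            ∎) 0≢1
        where
        d≢0 : b ⊕ ⊝ b' ≢ 𝟎
        d≢0 z = b≢b' (u⊝v≡0⇒u≡v z)
        a = proj₁ (invertible (b ⊕ ⊝ b') d≢0)
        head-⊝ : ∀ (v : Vec Carrier n) → Vec.head (⊝ v) ≡ 𝔽.- Vec.head v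
        head-⊝ (x ∷ v) = refl

    E : ℤ
    E = ∑ᵛ n (λ a → (Vec.head a ≐ 1#) * χ̃ a)

    -- Substituting a for ab carries the hyperplane of `dual n b` to the fixed one on which the
    -- constant coefficient is 1, at the cost of the sign χ(b).
    R₁-dual : ∀ b → b ≢ 𝟎 → R₁ (dual n b) ≡ χ b * E
    R₁-dual b b≢0 = begin
      ∑ᵛ n (λ a → (dot F a (dual n b) ≐ 1#) * χ̃ a)
        ≡⟨ ∑-cong vecs (λ a → cong₂ (λ x y → (x ≐ 1#) * y) (trans (dot-dual a b) (cong Vec.head (⊛-comm a b))) (untwist a)) ⟩
      ∑ᵛ n (λ a → (Vec.head (b ⊛ a) ≐ 1#) * (χ b * χ̃ (b ⊛ a))) ≡⟨ ∑-⊛ b b≢0 (λ a → (Vec.head a ≐ 1#) * (χ b * χ̃ a)) ⟩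
      ∑ᵛ n (λ a → (Vec.head a ≐ 1#) * (χ b * χ̃ a)) ≡⟨ ∑-cong vecs (λ a → shuffle (Vec.head a ≐ 1#) (χ b) (χ̃ a)) ⟩
      ∑ᵛ n (λ a → χ b * ((Vec.head a ≐ 1#) * χ̃ a))               ≡⟨ ∑-*ˡ vecs (χ b) _ ⟩
      χ b * E                                                     ∎
      where
      open ≡-Reasoning
      shuffle : ∀ x y z → x * (y * z) ≡ y * (x * z)
      shuffle = solve-∀
      untwist : ∀ a → χ̃ a ≡ χ b * χ̃ (b ⊛ a)
      untwist a = sym (trans (cong (χ b *_) (χ̃-⊛ b a b≢0)) (trans (sym (ℤₚ.*-assoc (χ b) (χ b) (χ̃ a)))
        (trans (cong (_* χ̃ a) (χ² b)) (ℤₚ.*-identityˡ (χ̃ a)))))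

    R₁-𝟎 : R₁ 𝟎 ≡ 0ℤ
    R₁-𝟎 = trans (∑-cong vecs λ a → trans (cong (_* χ̃ a) (⟦no⟧ (dot F a 𝟎 ≟ 1#) λ e → 0≢1 (trans (sym (dot-zerosʳ a)) e))) (ℤₚ.*-zeroˡ (χ̃ a))) (∑-0 vecs)

    -- By injectivity on a finite set every v is `dual n b` for some b, and b ≢ 0 because `dual`
    -- sends 0 to 0.
    R₁² : ∀ v → v ≢ 𝟎 → R₁ v * R₁ v ≡ E * E
    R₁² v v≢0 = from (injective⇒surjective (vecListing n) _≟ᵛ_ (dual n) dual-injective v)
      where
      shuffle : ∀ x y → (x * y) * (x * y) ≡ (x * x) * (y * y)
      shuffle = solve-∀
      dual-𝟎 : dual n 𝟎 ≡ 𝟎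
      dual-𝟎 = dual-zeros n
        where
        dual-zeros : ∀ k → dual k 𝟎 ≡ zeros k
        dual-zeros zero = refl
        dual-zeros (suc k) = cong (0# ∷_) (trans (cong (dual k) shift-𝟎) (dual-zeros k))
          where
          shift-𝟎 : shift 𝟎 ≡ 𝟎
          shift-𝟎 = trans (Companion.shift≡⊛ F (suc m) r 𝟎) (act-zeros (shift one))
      from : (∃ λ b → dual n b ≡ v) → R₁ v * R₁ v ≡ E * E
      from (b , e) = trans (cong₂ _*_ R₁v R₁v) (trans (shuffle (χ b) E) (trans (cong (_* (E * E)) (χ² b)) (ℤₚ.*-identityˡ (E * E))))
        where
        R₁v : R₁ v ≡ χ b * E
        R₁v = trans (cong R₁ (sym e)) (R₁-dual b λ b≡0 → v≢0 (trans (sym e) (trans (cong (dual n) b≡0) dual-𝟎)))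

    M≢0 : M ≢ 0ℤ
    M≢0 e = ℕₚ.<⇒≢ (ℕₚ.≤-trans 𝔽.card≥2 (ℕₚ.m≤m*n card (card ℕ.^ suc m) {{ℕ.>-nonZero (card^≥1 (suc m))}}))
      (sym (ℤₚ.+-injective (trans qⁿ≡ (ℤₚ.i-j≡0⇒i≡j (q * p) 1ℤ e))))

    -- The sum of R₁² over all v is M · E² by `R₁²` and M(p - p'ω) by `form₁`, where M is the number
    -- of nonzero vectors.
    E² : E * E ≡ p - p' * ω
    E² = ℤₚ.*-cancelˡ-≡ M (E * E) (p - p' * ω) {{ℤ.≢-nonZero M≢0}} (begin
      M * (E * E)                                           ≡⟨ cong (_* (E * E)) ∑-nonzero ⟨
      ∑ᵛ n (λ v → ⟦ isNonzero F v ⟧) * (E * E)              ≡⟨ ∑-*ʳ vecs (E * E) _ ⟨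
      ∑ᵛ n (λ v → ⟦ isNonzero F v ⟧ * (E * E))              ≡⟨ ∑-cong vecs (λ v → point v (v ≟ᵛ 𝟎)) ⟨
      ∑ᵛ n (λ v → R₁ v * R₁ v)                              ≡⟨ form₁ ⟩
      (p' * (total * total) + p * square) - p' * lines ≡⟨ cong₂ (λ t l → (p' * (t * t) + p * square) - p' * l) total≡0 lines≡ ⟩
      (p' * (0ℤ * 0ℤ) + p * square) - p' * (M * ω) ≡⟨ cong (λ s → (p' * (0ℤ * 0ℤ) + p * s) - p' * (M * ω)) square≡ ⟩
      (p' * (0ℤ * 0ℤ) + p * M) - p' * (M * ω)               ≡⟨ collect p' p M ω ⟩
      M * (p - p' * ω)                                      ∎)
      where
      open ≡-Reasoning
      collect : ∀ p' p M ω → (p' * (0ℤ * 0ℤ) + p * M) - p' * (M * ω) ≡ M * (p - p' * ω)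
      collect = solve-∀
      point : ∀ v → Dec (v ≡ 𝟎) → R₁ v * R₁ v ≡ ⟦ isNonzero F v ⟧ * (E * E)
      point v (yes v≡0) = trans (cong₂ _*_ (trans (cong R₁ v≡0) R₁-𝟎) (trans (cong R₁ v≡0) R₁-𝟎))
        (sym (trans (cong (λ b → ⟦ b ⟧ * (E * E)) (trans (cong (isNonzero F) v≡0) (isNonzero-zeros n))) (ℤₚ.*-zeroˡ (E * E))))
      point v (no v≢0) = trans (R₁² v v≢0) (sym (trans (cong (λ b → ⟦ b ⟧ * (E * E)) (isNonzero-≢ v v≢0)) (ℤₚ.*-identityˡ (E * E))))

    scalar-power : ∀ s → scalar s ⋆ H ≡ scalar (s ^ H)
    scalar-power s = ⊙one-⋆ s H

    module F-character = EulerCharacter F h card≡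

    -- s^H = (s^h)^(1 + q + ... + q^(n-1)), so for s ∈ F* the parity of n decides whether χ s is 1 or the character of F.
    power-even : ∀ g → geometric n ≡ 2 ℕ.* g → ∀ s → s ≢ 0# → s ^ H ≡ 1#
    power-even g e s s≢0 = begin
      s ^ (h ℕ.* geometric n)   ≡⟨ cong (λ k → s ^ (h ℕ.* k)) e ⟩
      s ^ (h ℕ.* (2 ℕ.* g))     ≡⟨ cong (s ^_) (regroup h g) ⟩
      s ^ ((h ℕ.+ h) ℕ.* g)     ≡⟨ 𝔽.^-assocʳ s (h ℕ.+ h) g ⟨
      (s ^ (h ℕ.+ h)) ^ g       ≡⟨ cong (_^ g) (trans (𝔽.^-homo-* s h h) (F-character.x^H² s s≢0)) ⟩
      1# ^ g                    ≡⟨ 𝔽.1^n g ⟩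
      1#                        ∎
      where
      open ≡-Reasoning
      regroup : ∀ h g → h ℕ.* (2 ℕ.* g) ≡ (h ℕ.+ h) ℕ.* g
      regroup = ℕ-solve-∀

    power-odd : ∀ g → geometric n ≡ suc (2 ℕ.* g) → ∀ s → s ≢ 0# → s ^ H ≡ s ^ h
    power-odd g e s s≢0 = begin
      s ^ (h ℕ.* geometric n)               ≡⟨ cong (λ k → s ^ (h ℕ.* k)) e ⟩
      s ^ (h ℕ.* suc (2 ℕ.* g))             ≡⟨ cong (s ^_) (regroup h g) ⟩
      s ^ (h ℕ.+ (h ℕ.+ h) ℕ.* g)           ≡⟨ 𝔽.^-homo-* s h ((h ℕ.+ h) ℕ.* g) ⟩
      (s ^ h) 𝔽.* (s ^ ((h ℕ.+ h) ℕ.* g))   ≡⟨ cong ((s ^ h) 𝔽.*_) (𝔽.^-assocʳ s (h ℕ.+ h) g) ⟨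
      (s ^ h) 𝔽.* ((s ^ (h ℕ.+ h)) ^ g) ≡⟨ cong (λ z → (s ^ h) 𝔽.* (z ^ g)) (trans (𝔽.^-homo-* s h h) (F-character.x^H² s s≢0)) ⟩
      (s ^ h) 𝔽.* (1# ^ g)                  ≡⟨ cong ((s ^ h) 𝔽.*_) (𝔽.1^n g) ⟩
      (s ^ h) 𝔽.* 1#                        ≡⟨ 𝔽.*-identityʳ _ ⟩
      s ^ h                                 ∎
      where
      open ≡-Reasoning
      regroup : ∀ h g → h ℕ.* suc (2 ℕ.* g) ≡ h ℕ.+ (h ℕ.+ h) ℕ.* g
      regroup = ℕ-solve-∀

    χ-scalar-even : ∀ g → geometric n ≡ 2 ℕ.* g → ∀ s → s ≢ 0# → χ (scalar s) ≡ 1ℤ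
    χ-scalar-even g e s s≢0 = χ-residue (scalar s) (trans (scalar-power s)
      (trans (cong scalar (power-even g e s s≢0)) (⊙-identity one)))

    ω-even : ∀ g → geometric n ≡ 2 ℕ.* g → ω ≡ q - 1ℤ
    ω-even g e = trans (∑ᶠ-split (λ s → χ̃ (scalar s)) 1ℤ λ s s≢0 → trans (χ̃-≢ (scalar≢𝟎 s≢0)) (χ-scalar-even g e s s≢0))
      (trans (cong (_+ (q - 1ℤ) * 1ℤ) (trans (cong χ̃ (⊙-zeroˡ one)) χ̃-𝟎)) (simplify (q - 1ℤ)))
      where
      simplify : ∀ x → 0ℤ + x * 1ℤ ≡ x
      simplify = solve-∀

    ω-odd : ∀ g → geometric n ≡ suc (2 ℕ.* g) → ω ≡ 0ℤ
    ω-odd g e = from F-character.nonresidue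
      where
      from : (∃ λ c → c ≢ 0# × (c ^ h) ≢ 1#) → ω ≡ 0ℤ
      from (c , c≢0 , nr) = self-negative⇒0 (trans (sym (∑ᶠ-scale c c≢0 (λ s → χ̃ (scalar s)))) (trans
          (∑-cong elems λ s → trans (cong χ̃ (⊙-assoc c s one)) (trans (χ̃-⊙ c (scalar s) c≢0) (cong (_* χ̃ (scalar s)) negative)))
          (∑-*ˡ elems (- 1ℤ) _)))
        where
        negative : χ (scalar c) ≡ - 1ℤ
        negative = χ-nonresidue (scalar c) λ z → nr (trans (sym (power-odd g e c c≢0))
          (trans (sym (𝔽.*-identityʳ (c ^ H))) (cong Vec.head (trans (sym (scalar-power c)) z))))

    module Eigenfunction (ℓ : ℕ) (ℓ²≡ : E * E ≡ + ℓ * + ℓ) where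

      -- The sign of the hyperplane sum, whose values off 0 are ℓ and -ℓ; it labels the second side
      -- of the cut.
      image : Vec Carrier n → Bool
      image v = does (R₁ v ℤ.≟ + ℓ)

      R₁≡ : ∀ v → v ≢ 𝟎 → R₁ v ≡ + ℓ * sgn (image v)
      R₁≡ v v≢0 = by-cases (R₁ v ℤ.≟ + ℓ) (square-≡ (trans (R₁² v v≢0) ℓ²≡))
        where
        by-cases : (d : Dec (R₁ v ≡ + ℓ)) → R₁ v ≡ + ℓ ⊎ R₁ v ≡ - (+ ℓ) → R₁ v ≡ + ℓ * sgn (does d)
        by-cases (yes e) _ = trans e (sym (ℤₚ.*-identityʳ (+ ℓ)))
        by-cases (no n) (inj₁ e) = contradiction e n
        by-cases (no n) (inj₂ e) = trans e (negate (+ ℓ))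
          where
          negate : ∀ x → - x ≡ x * - 1ℤ
          negate = solve-∀

      ∑-residue : ∑ vs (sgn ∘ residue) ≡ 0ℤ
      ∑-residue = trans (∑-filter (isNonzero F) vecs χ) total≡0

      eigen : ∀ {b} → b ∈ vs → ∑ vs (λ a → ⟦ UmGraphs.r m a b ⟧ * sgn (residue a)) ≡ + ℓ * sgn (image b)
      eigen {b} b∈ = trans (∑-filter-*ʳ (isNonzero F) vecs (λ a → dot F a b ≐ 1#) χ)
        (R₁≡ b (isNonzero⇒≢ (∈-filterᵇ⁻ (isNonzero F) {xs = vecs} b∈)))

      -- If χ is trivial on F*, its value depends only on the point spanned by a vector, so the same
      -- labels define a cut of `Um₀`.
      module Invariant (χ-scalar : ∀ s → s ≢ 0# → χ (scalar s) ≡ 1ℤ) where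

        χ̃-invariant : ∀ s a → s ≢ 0# → χ̃ (s ⊙ a) ≡ χ̃ a
        χ̃-invariant s a s≢0 = trans (χ̃-⊙ s a s≢0) (trans (cong (_* χ̃ a) (χ-scalar s s≢0)) (ℤₚ.*-identityˡ (χ̃ a)))

        normalized-χ̃ : ∀ a → ⟦ isNormalized F a ⟧ * χ̃ a ≡ ⟦ isNormalized F a ⟧ * χ a
        normalized-χ̃ a = by-cases (isNormalized F a) refl
          where
          by-cases : ∀ b → isNormalized F a ≡ b → ⟦ b ⟧ * χ̃ a ≡ ⟦ b ⟧ * χ a
          by-cases true e = cong (1ℤ *_) (χ̃-≢ (isNormalized⇒≢ e))
          by-cases false _ = trans (ℤₚ.*-zeroˡ (χ̃ a)) (sym (ℤₚ.*-zeroˡ (χ a)))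

        -- Fibres of a ↦ a·b: R₀ + (q - 1) R₁ is the total sum.
        R₀≡ : ∀ b → R₀ b ≡ (q - 1ℤ) * (- R₁ b)
        R₀≡ b = trans (isolate (R₀ b) ((q - 1ℤ) * R₁ b)) (trans (cong (_- (q - 1ℤ) * R₁ b) (trans (sym side₁) side₂)) (simplify (q - 1ℤ) (R₁ b)))
          where
          isolate : ∀ x y → x ≡ (x + y) - y
          isolate = solve-∀
          simplify : ∀ d x → 0ℤ - d * x ≡ d * (- x)
          simplify = solve-∀
          fibre : Carrier → ℤ
          fibre s = ∑ᵛ n (λ a → (dot F a b ≐ s) * χ̃ a)
          side₁ : ∑ᶠ fibre ≡ R₀ b + (q - 1ℤ) * R₁ b
          side₁ = ∑ᶠ-split fibre (R₁ b) λ s s≢0 → trans (sym (∑ᵛ-scale s s≢0 (λ a → (dot F a b ≐ s) * χ̃ a)))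
            (∑-cong vecs λ a → cong₂ _*_ (⟦⇔⟧ (dot F (s ⊙ a) b ≟ s) (dot F a b ≟ 1#)
              (λ e → 𝔽.*-cancelˡ s s≢0 (trans (sym (dot-⊙ s a b)) (trans e (sym (𝔽.*-identityʳ s)))))
              (λ e → trans (dot-⊙ s a b) (trans (cong (s 𝔽.*_) e) (𝔽.*-identityʳ s)))) (χ̃-invariant s a s≢0))
          side₂ : ∑ᶠ fibre ≡ 0ℤ
          side₂ = trans (∑-swap elems vecs _) (trans (∑-cong vecs λ a → trans (∑-*ʳ elems (χ̃ a) _)
            (trans (cong (_* χ̃ a) (one-fibre (dot F a b))) (ℤₚ.*-identityˡ (χ̃ a)))) total≡0)
            where
            one-fibre : ∀ x → ∑ᶠ (λ s → x ≐ s) ≡ 1ℤ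
            one-fibre x = trans (∑-point listing x (x ≐_) λ s s≢x → ⟦no⟧ (x ≟ s) (s≢x ∘ sym)) (⟦yes⟧ (x ≟ x) refl)

        ∑-residue₀ : ∑ vs₀ (sgn ∘ residue) ≡ 0ℤ
        ∑-residue₀ = cancel-q-1 (begin
          (q - 1ℤ) * ∑ vs₀ χ ≡⟨ cong ((q - 1ℤ) *_) (trans (∑-filter (isNormalized F) vecs χ) (∑-cong vecs (sym ∘ normalized-χ̃))) ⟩
          (q - 1ℤ) * ∑ᵛ n (λ a → ⟦ isNormalized F a ⟧ * χ̃ a)                  ≡⟨ ℤₚ.+-identityˡ _ ⟨
          0ℤ + (q - 1ℤ) * ∑ᵛ n (λ a → ⟦ isNormalized F a ⟧ * χ̃ a) ≡⟨ cong (_+ (q - 1ℤ) * ∑ᵛ n (λ a → ⟦ isNormalized F a ⟧ * χ̃ a)) χ̃-𝟎 ⟨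
          χ̃ 𝟎 + (q - 1ℤ) * ∑ᵛ n (λ a → ⟦ isNormalized F a ⟧ * χ̃ a)            ≡⟨ projective χ̃ χ̃-invariant ⟨
          total                                                               ≡⟨ total≡0 ⟩
          0ℤ                                                                  ≡⟨ ℤₚ.*-zeroʳ (q - 1ℤ) ⟨
          (q - 1ℤ) * 0ℤ                                                       ∎)
          where open ≡-Reasoning

        -- Passing from vectors to points divides by q - 1 and so absorbs the factor in `R₀≡`; the
        -- minus sign there is why the second side carries the complement of `image`.
        eigen₀ : ∀ {b} → b ∈ vs₀ → ∑ vs₀ (λ a → ⟦ r₀ a b ⟧ * sgn (residue a)) ≡ + ℓ * sgn (not (image b))
        eigen₀ {b} b∈ = cancel-q-1 (begin
          (q - 1ℤ) * ∑ vs₀ (λ a → ⟦ r₀ a b ⟧ * χ a)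
            ≡⟨ cong ((q - 1ℤ) *_) (trans (∑-filter (isNormalized F) vecs _) (∑-cong vecs λ a →
                 trans (shuffle ⟦ isNormalized F a ⟧ (dot F a b ≐ 0#) (χ a)) (trans (cong ((dot F a b ≐ 0#) *_) (sym (normalized-χ̃ a)))
                 (shuffle (dot F a b ≐ 0#) ⟦ isNormalized F a ⟧ (χ̃ a))))) ⟩
          (q - 1ℤ) * ∑ᵛ n (λ a → ⟦ isNormalized F a ⟧ * hₐ a)                 ≡⟨ ℤₚ.+-identityˡ _ ⟨
          0ℤ + (q - 1ℤ) * ∑ᵛ n (λ a → ⟦ isNormalized F a ⟧ * hₐ a) ≡⟨ cong (_+ (q - 1ℤ) * ∑ᵛ n (λ a → ⟦ isNormalized F a ⟧ * hₐ a)) h𝟎 ⟨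
          hₐ 𝟎 + (q - 1ℤ) * ∑ᵛ n (λ a → ⟦ isNormalized F a ⟧ * hₐ a)          ≡⟨ projective hₐ h-invariant ⟨
          R₀ b                                                                ≡⟨ R₀≡ b ⟩
          (q - 1ℤ) * (- R₁ b)
            ≡⟨ cong (λ z → (q - 1ℤ) * (- z)) (R₁≡ b (isNormalized⇒≢ (∈-filterᵇ⁻ (isNormalized F) {xs = vecs} b∈))) ⟩
          (q - 1ℤ) * (- (+ ℓ * sgn (image b))) ≡⟨ cong ((q - 1ℤ) *_) (sgn-not (image b)) ⟩
          (q - 1ℤ) * (+ ℓ * sgn (not (image b)))                              ∎)
          where
          open ≡-Reasoning
          hₐ : Vec Carrier n → ℤ
          hₐ a = (dot F a b ≐ 0#) * χ̃ a
          shuffle : ∀ x y z → x * (y * z) ≡ y * (x * z)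
          shuffle = solve-∀
          h𝟎 : hₐ 𝟎 ≡ 0ℤ
          h𝟎 = trans (cong ((dot F 𝟎 b ≐ 0#) *_) χ̃-𝟎) (ℤₚ.*-zeroʳ (dot F 𝟎 b ≐ 0#))
          h-invariant : ∀ c a → c ≢ 0# → hₐ (c ⊙ a) ≡ hₐ a
          h-invariant c a c≢0 = cong₂ _*_ (trans (cong (_≐ 0#) (dot-⊙ c a b)) (≐0-scale c (dot F a b) c≢0)) (χ̃-invariant c a c≢0)
          plus : ∀ x → - (x * 1ℤ) ≡ x * - 1ℤ
          plus = solve-∀
          minus : ∀ x → - (x * - 1ℤ) ≡ x * 1ℤ
          minus = solve-∀
          sgn-not : ∀ c → - (+ ℓ * sgn c) ≡ + ℓ * sgn (not c)
          sgn-not true = plus (+ ℓ)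
          sgn-not false = minus (+ ℓ)

-- Parity of n and assembly of the bounds.

module UmIsoperimetry where

  open FiniteSums
  open FieldTheory
  open Counting
  open GraphSpectra
  open IsoBounds
  open RationalBounds
  open ExtensionField
  open QuadraticCharacter
  open import Data.Integer as ℤ using (ℤ; +_; 0ℤ; 1ℤ)
  open import Data.Nat using (_%_; _/_)
  open import Data.Rational as ℚ using (ℚ; ½; 1ℚ; _+_; _*_; _-_)

  even⇒half+half : ∀ k → k % 2 ≡ 0 → k ≡ k / 2 ℕ.+ k / 2
  even⇒half+half k e = trans (m≡m%n+[m/n]*n k 2) (trans (cong (ℕ._+ (k / 2) ℕ.* 2) e) (double (k / 2)))
    where
    double : ∀ x → x ℕ.* 2 ≡ x ℕ.+ x
    double = ℕ-solve-∀

  odd⇒pred-even : ∀ k → suc k % 2 ≡ 1 → k % 2 ≡ 0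
  odd⇒pred-even zero _ = refl
  odd⇒pred-even (suc zero) ()
  odd⇒pred-even (suc (suc k)) e = odd⇒pred-even k e

  odd⇒suc-half+half : ∀ k → k % 2 ≡ 1 → k ≡ suc (k / 2 ℕ.+ k / 2)
  odd⇒suc-half+half k e = trans (m≡m%n+[m/n]*n k 2) (trans (cong (ℕ._+ (k / 2) ℕ.* 2) e) (double (k / 2)))
    where
    double : ∀ x → 1 ℕ.+ x ℕ.* 2 ≡ suc (x ℕ.+ x)
    double = ℕ-solve-∀

  half∸1 : ∀ m → suc (suc m) / 2 ℕ.∸ 1 ≡ m / 2
  half∸1 m = cong (ℕ._∸ 1) (m/n≡1+[m∸n]/n {suc (suc m)} {2} (s≤s (s≤s z≤n)))

  module Isoperimetric (F : FiniteField) (h : ℕ) (card≡ : FiniteField.card F ≡ suc (h ℕ.+ h)) where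

    open FiniteField F using (card)
    open OddOrder F h card≡
    open NormalForms F

    geometric-÷ : ∀ j → (ℕ→ℚ (card ℕ.^ j) - 1ℚ) ÷ℕ (card ℕ.∸ 1) ≡ ℕ→ℚ (geometric j)
    geometric-÷ j = ÷ℕ-exact (card ℕ.^ j) (card ℕ.∸ 1) (geometric j)
      (trans (cong (λ c → geometric j ℕ.* (c ℕ.∸ 1) ℕ.+ 1) card≡) (trans (regroup (geometric j) h) (sym (card-power j))))
      (ℕₚ.∸-monoˡ-≤ 1 (Field.card≥2 F))
      where
      regroup : ∀ g h → g ℕ.* (h ℕ.+ h) ℕ.+ 1 ≡ suc (h ℕ.* g ℕ.+ h ℕ.* g)
      regroup = ℕ-solve-∀

    module _ (m : ℕ) where

      open UmGraphs m
      open Count.Dimension F m using (n; p; p'; p≡)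

      private
        module B = Bounds.RegularBounds F n vs r vs-unique (card ℕ.^ suc m) 0<N regularˡ regularʳ
        module B₀ = Bounds.RegularBounds F n vs₀ r₀ vs₀-unique (geometric (suc m)) 0<N₀ regular₀ˡ regular₀ʳ
        -- The degree of `extensionField F k` is k + 1, so k = m + 1 gives degree m + 2 = n.
        module C = CharacterSums F h card≡ m (proj₁ (extensionField F (suc m))) (proj₂ (extensionField F (suc m)))

      Um-lower : (ℕ→ℚ (card ℕ.^ suc m) - (iso (Um F n) + iso (Um F n))) ≤√ (card ℕ.^ suc m)
      Um-lower = B.iso-≤√ (card ℕ.^ suc m) L≤k² spectral

      Um₀-lower : (ℕ→ℚ (geometric (suc m)) - (iso (Um₀ F n) + iso (Um₀ F n))) ≤√ (card ℕ.^ m)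
      Um₀-lower = B₀.iso-≤√ (card ℕ.^ m) L₀≤k₀² spectral₀

      power-+ : ∀ {k} j → k ≡ j ℕ.+ j → card ℕ.^ k ≡ card ℕ.^ j ℕ.* card ℕ.^ j
      power-+ j refl = ℕₚ.^-distribˡ-+-* card j j

      +power-+ : ∀ {k} j → k ≡ j ℕ.+ j → + (card ℕ.^ k) ≡ + (card ℕ.^ j) ℤ.* + (card ℕ.^ j)
      +power-+ j e = trans (cong +_ (power-+ j e)) (ℤₚ.pos-* (card ℕ.^ j) (card ℕ.^ j))

      E²-odd : ∀ j → suc m ≡ j ℕ.+ j → C.E ℤ.* C.E ≡ + (card ℕ.^ j) ℤ.* + (card ℕ.^ j)
      E²-odd j e = trans C.E² (trans (cong (λ z → p ℤ.- p' ℤ.* z) ω≡0) (trans (drop p p') (+power-+ j e)))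
        where
        drop : ∀ x y → x ℤ.- y ℤ.* 0ℤ ≡ x
        drop = solve-∀
        ω≡0 : C.ω ≡ 0ℤ
        ω≡0 = C.ω-odd (proj₁ (geometric-odd j)) (trans (cong (geometric ∘ suc) e) (proj₂ (geometric-odd j)))

      geometric-n-even : ∀ j → m ≡ j ℕ.+ j → ∃ λ g → geometric n ≡ 2 ℕ.* g
      geometric-n-even j e = proj₁ (geometric-even (suc j)) ,
        trans (cong geometric (trans (cong (suc ∘ suc) e) (cong suc (sym (ℕₚ.+-suc j j))))) (proj₂ (geometric-even (suc j)))

      -- With ω = q - 1 and p = qp' the formula for E² collapses to p' = q^(n-2), a square as n is
      -- even.
      E²-even : ∀ j → m ≡ j ℕ.+ j → C.E ℤ.* C.E ≡ + (card ℕ.^ j) ℤ.* + (card ℕ.^ j)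
      E²-even j e = trans C.E² (trans (cong₂ (λ x z → x ℤ.- p' ℤ.* z) p≡ ω≡) (trans (drop (+ card) p') (+power-+ j e)))
        where
        drop : ∀ q x → q ℤ.* x ℤ.- x ℤ.* (q ℤ.- 1ℤ) ≡ x
        drop = solve-∀
        ω≡ : C.ω ≡ + card ℤ.- 1ℤ
        ω≡ = C.ω-even (proj₁ (geometric-n-even j e)) (proj₂ (geometric-n-even j e))

      -- For n odd q^j is the norm q^((n-1)/2), and the cut is optimal. For n even the character
      -- reaches only q^(n/2-1), which leaves a factor √q between the two bounds.
      Um-upper : ∀ j → C.E ℤ.* C.E ≡ + (card ℕ.^ j) ℤ.* + (card ℕ.^ j) →
        iso (Um F n) ℚ.≤ ½ * (ℕ→ℚ (card ℕ.^ suc m) - ℕ→ℚ (card ℕ.^ j))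
      Um-upper j E²≡ = B.iso-≤½ C.residue image (card ℕ.^ j) (card^≥1 j) ∑-residue eigen
        where open C.Eigenfunction (card ℕ.^ j) E²≡

      Um-odd : ∀ j → suc m ≡ j ℕ.+ j → iso (Um F n) ≡ ½ * (ℕ→ℚ (card ℕ.^ suc m) - ℕ→ℚ (card ℕ.^ j))
      Um-odd j e = ℚₚ.≤-antisym (Um-upper j (E²-odd j e)) (k-2c≤ℓ⇒½≤c (ℕ→ℚ (card ℕ.^ suc m)) (ℕ→ℚ (card ℕ.^ j)) (iso (Um F n))
        (≤√-square (card ℕ.^ j) (subst ((ℕ→ℚ (card ℕ.^ suc m) - (iso (Um F n) + iso (Um F n))) ≤√_) (power-+ j e) Um-lower)))

      Um₀-even : ∀ j → m ≡ j ℕ.+ j → iso (Um₀ F n) ≡ ½ * (ℕ→ℚ (geometric (suc m)) - ℕ→ℚ (card ℕ.^ j))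
      Um₀-even j e = ℚₚ.≤-antisym
          (B₀.iso-≤½ C.residue (not ∘ image) (card ℕ.^ j) (card^≥1 j) ∑-residue₀ eigen₀)
          (k-2c≤ℓ⇒½≤c (ℕ→ℚ (geometric (suc m))) (ℕ→ℚ (card ℕ.^ j)) (iso (Um₀ F n))
            (≤√-square (card ℕ.^ j) (subst ((ℕ→ℚ (geometric (suc m)) - (iso (Um₀ F n) + iso (Um₀ F n))) ≤√_) (power-+ j e) Um₀-lower)))
        where
        open C.Eigenfunction (card ℕ.^ j) (E²-even j e)
        open Invariant (C.χ-scalar-even (proj₁ (geometric-n-even j e)) (proj₂ (geometric-n-even j e)))

open import Defs
open import Data.Nat using (ℕ; _≤_; _^_; _∸_; _%_; _/_)
open import Data.Rational using (ℚ; ½; 1ℚ; _*_; _-_; _+_)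
open import Data.Rational as Q using ()
open import Data.Integer using (+_)
open import Data.Product using (_×_)
open import Relation.Binary.PropositionalEquality using (_≡_)
open UmIsoperimetry

theorem1p5 : (F : FiniteField) → let q = FiniteField.card F in q % 2 ≡ 1 →
    ((n : ℕ) → 2 ≤ n →
    (n % 2 ≡ 1 →
    iso (Um F n) ≡ ½ * (ℕ→ℚ (q ^ (n ∸ 1)) - ℕ→ℚ (q ^ ((n ∸ 1) / 2)))) ×
    (n % 2 ≡ 0 →
    (iso (Um F n) Q.≤ ½ * (ℕ→ℚ (q ^ (n ∸ 1)) - ℕ→ℚ (q ^ (n / 2 ∸ 1)))) ×
    ((ℕ→ℚ (q ^ (n ∸ 1)) - (iso (Um F n) + iso (Um F n))) ≤√ (q ^ (n ∸ 1)))))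
    ×
    ((n : ℕ) → 3 ≤ n →
    (n % 2 ≡ 1 →
    ((ℕ→ℚ (q ^ (n ∸ 1)) - 1ℚ) ÷ℕ (q ∸ 1) - (iso (Um₀ F n) + iso (Um₀ F n)))
    ≤√ (q ^ (n ∸ 2))) ×
    (n % 2 ≡ 0 →
    iso (Um₀ F n) ≡ ½ * ((ℕ→ℚ (q ^ (n ∸ 1)) - 1ℚ) ÷ℕ (q ∸ 1) - ℕ→ℚ (q ^ (n / 2 ∸ 1)))))
theorem1p5 F odd = um , um₀
  where
  q = FiniteField.card F
  open Isoperimetric F (q / 2) (odd⇒suc-half+half q odd)
  um : (n : ℕ) → 2 ≤ n →
    (n % 2 ≡ 1 → iso (Um F n) ≡ ½ * (ℕ→ℚ (q ^ (n ∸ 1)) - ℕ→ℚ (q ^ ((n ∸ 1) / 2)))) ×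
    (n % 2 ≡ 0 → (iso (Um F n) Q.≤ ½ * (ℕ→ℚ (q ^ (n ∸ 1)) - ℕ→ℚ (q ^ (n / 2 ∸ 1)))) ×
      ((ℕ→ℚ (q ^ (n ∸ 1)) - (iso (Um F n) + iso (Um F n))) ≤√ (q ^ (n ∸ 1))))
  um (suc (suc m)) _ =
    (λ n-odd → Um-odd m (suc m / 2) (even⇒half+half (suc m) (odd⇒pred-even (suc m) n-odd))) ,
    (λ n-even → subst (λ j → iso (Um F (suc (suc m))) Q.≤ ½ * (ℕ→ℚ (q ^ suc m) - ℕ→ℚ (q ^ j))) (sym (half∸1 m))
        (Um-upper m (m / 2) (E²-even m (m / 2) (even⇒half+half m n-even))) , Um-lower m)
  um (suc zero) (s≤s ())
  um₀ : (n : ℕ) → 3 ≤ n →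
    (n % 2 ≡ 1 → ((ℕ→ℚ (q ^ (n ∸ 1)) - 1ℚ) ÷ℕ (q ∸ 1) - (iso (Um₀ F n) + iso (Um₀ F n))) ≤√ (q ^ (n ∸ 2))) ×
    (n % 2 ≡ 0 → iso (Um₀ F n) ≡ ½ * ((ℕ→ℚ (q ^ (n ∸ 1)) - 1ℚ) ÷ℕ (q ∸ 1) - ℕ→ℚ (q ^ (n / 2 ∸ 1))))
  um₀ (suc (suc m)) _ =
    (λ _ → subst (λ k → (k - (iso (Um₀ F (suc (suc m))) + iso (Um₀ F (suc (suc m))))) ≤√ (q ^ m)) (sym (geometric-÷ (suc m))) (Um₀-lower m)) ,
    (λ n-even → trans (Um₀-even m (m / 2) (even⇒half+half m n-even))
      (cong₂ (λ k j → ½ * (k - ℕ→ℚ (q ^ j))) (sym (geometric-÷ (suc m))) (sym (half∸1 m))))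
  um₀ (suc zero) (s≤s ())
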